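{- Let $P$ be a well-formed protocol and $\Delta$ a network state. Let $\hat\lambda$ range over the network labels of the form $(id!\star)^f$ and $\tau$. 1. If $\Delta;P\to\Delta';Q$, then $[\![\Delta;P]\!]\xrightarrow{\hat\lambda}{}_{\equiv}\,[\![\Delta';Q]\!]$ for some $\hat\lambda$. 2. If $[\![\Delta;P]\!]\xrightarrow{\hat\lambda}N$, then there are $\Delta',Q$ such that $\Delta;P\to\Delta';Q$ and $N\equiv[\![\Delta';Q]\!]$. Here $N_1\xrightarrow{\lambda}{}_{\equiv}\,N_2$ means that there is a network $N'$ with $N_1\xrightarrow{\lambda}N'$ and $N'\equiv N_2$.
   Context: **Global protocols.** Fix node identifiers $id$, action labels $f$, logical conditions $c,i,o$, recursion variables $X$, and directions $d\in\{\star,\blacktriangle,\blacktriangleright,\bullet\}$ (children, parent, a neighbour, self). Protocols $P$ and summations $S$ are generated by: $P$ is $0$, or $P\,|\,P$, or $\mathbf{rec}\,X.P$, or $X$, or $S$, or $(id)P$ (node $id$ is active on $P$); $S$ is $[f^d]^o_iP$ (a synchronisation action) or $S+S$. **Structural congruence on protocols** $\equiv$ is the least congruence such that $|$ and $+$ are associative and commutative, $P|0\equiv P$, $\mathbf{rec}\,X.P\equiv P[\mathbf{rec}\,X.P/X]$, $(id)(P|Q)\equiv(id)P\,|\,(id)Q$, $(id_1)(id_2)P\equiv(id_2)(id_1)P$, $(id)0\equiv0$. **States.** A state is a register $s=id[id',t,n,k,a,e]$: node identifier $id$, identifier $id'$ of the power provider (parent), status $t$ of the input connection, set $n$ of identifiers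 of neighbours, capacity $k$, number $a$ of active supply links, number $e$ of faulty supply links. Write $id(s)=id$, $i(s)=id'$, $n(s)=n$. A network state $\Delta$ maps node identifiers to states, where the state $\Delta(id)$ has node identifier $id$. $s\models c$ is satisfaction in an unspecified logic with conjunction. For each $f$ and $d\in\{\blacktriangle,\blacktriangleright\}$ there are side-effect functions $f^d!(s,id')$ and $f^d?(s,id)$ returning states. For $\Delta=(\Delta'',id\mapsto s,id'\mapsto s')$, $\mathtt{upd}(id,id',f^d,\Delta)=(\Delta'',id\mapsto f^d!(s,id'),id'\mapsto f^d?(s',id))$. Targets: $\blacktriangle(\Delta,id)=i(\Delta(id))$; $\blacktriangleright(\Delta,id)=id'$ for any $id'\in n(\Delta(id))$; $\star(\Delta,id)=\{id'\mid\blacktriangle(\Delta,id')=id\}$. **Reduction** $\Delta;P\to\Delta';P'$ is the least relation such that: - (Bin) if $d\in\{\blacktriangle,\blacktriangleright\}$, $\Delta(id)\models o$, $d(\Delta,id)=id'$, $\Delta(id')\models i$, $\Delta'=\mathtt{upd}(id,id',f^d,\Delta)$, then $\Delta;(id)([f^d]^o_iP+S)\to\Delta';[f^d]^o_i((id')P)+S$; - (Brd) if $\Delta(id)\models o$ and $I=\{id'\in\star(\Delta,id)\mid\Delta(id')\models i\}$, then $\Delta;(id)([f^\star]^o_iP+S)\to\Delta;[f^\star]^o_i((\tilde I)P)+S$, where $(\tilde I)P=(id_1)\cdots(id_m)P$ for $I=\{id_1,\dots,id_m\}$ and $(\tilde\emptyset)P=P$; - (Loc) if $\Delta(id)\models o$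 and $\Delta(id)\models i$, then $\Delta;(id)([f^\bullet]^o_iP+S)\to\Delta;[f^\bullet]^o_i((id)P)+S$; - (closure) if $\Delta;P\to\Delta';P'$ then $\Delta;[f^d]^o_iP\to\Delta';[f^d]^o_iP'$, $\Delta;(id)P\to\Delta';(id)P'$, $\Delta;P+P_2\to\Delta';P'+P_2$ and $\Delta;P|P_2\to\Delta';P'|P_2$; and if $P\equiv P_0$, $\Delta;P_0\to\Delta';Q_0$, $Q_0\equiv Q$ then $\Delta;P\to\Delta';Q$. In the first three rules the summand $S$ may be absent. **Well-formed protocols** are those that originate (via reduction and structural congruence) from closed specifications in which active node constructs $(id)$ occur only at top level (not within a synchronisation action, summation or recursion), all action labels are distinct, and recursion is guarded (in each $\mathbf{rec}\,X.P$, every free occurrence of $X$ in $P$ is within the continuation of a synchronisation action of $P$). **Distributed language.** Definitions $D$ are $\langle c\rangle f^d?.R$, or $R$, or $D|D$; reactions $R$ are $C$, or $0$, or $R|R$; choices $C$ are $\langle c\rangle f^d!$ or $C+C$; networks $N$ are nodes $s:D$ or $N\,\|\,N$. Structural congruence on definitions and networks: the least congruence such that $|$, $+$, $\|$ are associative and commutative, $D|0\equiv D$, $\langle c\rangle f^d?.R\,|\,\langle c\rangle f^d?.R\equiv\langle c\rangle f^d?.R$, and $s:D_1\equiv s:D_2$ whenever $D_1\equiv D_2$. Transitions of definitions: $\langle c\rangle f^d?.R\xrightarrow{\langle c\rangle f^d?}R\,|\,\langle c\rangle f^d?.R$; $\langle c\rangle f^d!\xrightarrow{\langle c\rangle f^d!}0$;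 if $C_1\xrightarrow{\alpha}C_1'$ then $C_1+C_2\xrightarrow{\alpha}C_1'$; if $D_1\xrightarrow{\alpha}D_1'$ then $D_1|D_2\xrightarrow{\alpha}D_1'|D_2$; if $D_1\xrightarrow{\langle c_1\rangle f^\bullet!}D_1'$ and $D_2\xrightarrow{\langle c_2\rangle f^\bullet?}D_2'$ then $D_1|D_2\xrightarrow{\langle c_1\wedge c_2\rangle f}D_1'|D_2'$; plus the symmetric versions of the last three rules. Transitions of networks (labels $\tau$, $(id_1\to id_2)^f$, $(id_1\leftarrow id_2)^f$, $(id!\star)^f$, $(id?\star)^f$): - if $D\xrightarrow{\langle c\rangle f}D'$, $s\models c$, then $s:D\xrightarrow{\tau}s:D'$; - if $D\xrightarrow{\langle c\rangle f^\blacktriangle!}D'$, $s\models c$, then $s:D\xrightarrow{(id(s)\to i(s))^f}f^\blacktriangle!(s,i(s)):D'$; - if $D\xrightarrow{\langle c\rangle f^\blacktriangleright!}D'$, $s\models c$, $id\in n(s)$, then $s:D\xrightarrow{(id(s)\to id)^f}f^\blacktriangleright!(s,id):D'$; - if $d\in\{\blacktriangle,\blacktriangleright\}$, $D\xrightarrow{\langle c\rangle f^d?}D'$, $s\models c$, then $s:D\xrightarrow{(id(s)\leftarrow id)^f}f^d?(s,id):D'$; - if $D\xrightarrow{\langle c\rangle f^\star!}D'$, $s\models c$, then $s:D\xrightarrow{(id(s)!\star)^f}s:D'$; - if $D\xrightarrow{\langle c\rangle f^\star?}D'$, $s\models c$, then $s:D\xrightarrow{(i(s)?\star)^f}s:D'$;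 - if $\mathit{discard}(s:D,(id?\star)^f)$, then $s:D\xrightarrow{(id?\star)^f}s:D$, where discard holds iff it is not the case that $i(s)=id$ and $D\xrightarrow{\langle c\rangle f^\star?}D'$ for some $c,D'$ with $s\models c$; - if $N_1\xrightarrow{\lambda_1}N_1'$, $N_2\xrightarrow{\lambda_2}N_2'$ and $\gamma(\lambda_1,\lambda_2)$ is defined, then $N_1\|N_2\xrightarrow{\gamma(\lambda_1,\lambda_2)}N_1'\|N_2'$; - if $N_1\xrightarrow{\lambda}N_1'$ and $\lambda$ is not of the form $(id!\star)^f$ or $(id?\star)^f$, then $N_1\|N_2\xrightarrow{\lambda}N_1'\|N_2$ (and symmetrically). Here $\gamma$ gives $\tau$ on $(id_1\to id_2)^f,(id_2\leftarrow id_1)^f$ (in either order); $(id!\star)^f$ on $(id!\star)^f,(id?\star)^f$ (in either order); $(id?\star)^f$ on two copies of $(id?\star)^f$; and is undefined otherwise. **Projection** $[\![P]\!]^r_\sigma$, with $r\in\{?,!\}$ or $r$ a node identifier $id$, and $\sigma$ a mapping from recursion variables to protocols: $[\![[f^d]^o_iP]\!]^?_\sigma=\langle i\rangle f^d?.[\![P]\!]^!_\sigma\,|\,[\![P]\!]^?_\sigma$; $[\![[f^d]^o_iP]\!]^!_\sigma=\langle o\rangle f^d!$; $[\![[f^d]^o_iP]\!]^{id}_\sigma=[\![P]\!]^{id}_\sigma$; $[\![(id)P]\!]^{id}_\sigma=[\![P]\!]^{id}_\sigma\,|\,[\![P]\!]^!_\sigma$; $[\![(id)P]\!]^r_\sigma=[\![P]\!]^r_\sigma$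 for $r\ne id$; $[\![0]\!]^r_\sigma=0$; $[\![X]\!]^r_\sigma=0$ for $r\ne\,!$; $[\![X]\!]^!_\sigma=[\![\sigma(X)]\!]^!_\sigma$; $[\![\mathbf{rec}\,X.P]\!]^r_\sigma=[\![P]\!]^r_{\sigma[X\mapsto P]}$; $[\![P|Q]\!]^r_\sigma=[\![P]\!]^r_\sigma\,|\,[\![Q]\!]^r_\sigma$; $[\![S_1+S_2]\!]^!_\sigma=[\![S_1]\!]^!_\sigma+[\![S_2]\!]^!_\sigma$; $[\![S_1+S_2]\!]^r_\sigma=[\![S_1]\!]^r_\sigma\,|\,[\![S_2]\!]^r_\sigma$ for $r\neq\,!$. For configurations, $[\![\Delta;P]\!]$ is the parallel composition ($\|$) over all $id\in\mathrm{dom}(\Delta)$ of the nodes $\Delta(id):([\![P]\!]^?_\emptyset\,|\,[\![P]\!]^{id}_\emptyset)$.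
   Formalization: It is additionally assumed that no node of Δ is its own power provider; otherwise item 1 fails, since a self-parent node is a target of its own broadcast in a reduction but never receives it in the network. -}

module Defs where

open import Data.Empty using (⊥; ⊥-elim)
open import Data.Fin using (Fin; zero; suc)
open import Data.List as List using (List; []; _∷_; _++_; foldr)
open import Data.List.Membership.Propositional using (_∈_)
open import Data.List.NonEmpty as List⁺ using (List⁺; _∷_; toList)
open import Data.List.Properties using (map-∘; map-cong)
open import Data.List.Relation.Unary.Unique.Propositional using (Unique)
open import Data.Maybe using (Maybe; just; nothing)
open import Data.Nat using (ℕ; suc)
open import Data.Product using (∃-syntax; _×_; _,_)
open import Data.Unit using (⊤)
open import Data.Vec as Vec using (Vec; []; _∷_; lookup)
open import Function.Bundles using (_⇔_)
open import Relation.Binary.Definitions using (DecidableEquality)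
open import Relation.Binary.PropositionalEquality
  using (_≡_; _≢_; refl; sym; trans; cong; cong₂; subst)
open import Relation.Nullary using (¬_; yes; no)

-- The directions along which exactly two distinct nodes interact.
data Link : Set where
  ▲ ▶ : Link

data Dir : Set where
  ⋆ •  : Dir
  link : Link → Dir

-- The set of neighbours is given by a list, of which only membership is used.
record Register (Id Status Capacity : Set) : Set where
  field
    ident      : Id
    provider   : Id
    status     : Status
    neighbours : List Id
    capacity   : Capacity
    active     : ℕ
    faulty     : ℕ

record Setting : Set₁ where
  infix  4 _⊨_
  infixr 6 _∧_
  field
    Id Label Cond Status Capacity : Set
    _≟_ : DecidableEquality Id

  State : Set
  State = Register Id Status Capacity

  open Register public

  field
    _⊨_ : State → Cond → Set
    _∧_ : Cond → Cond → Cond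
    ⊨-∧ : ∀ {s c c′} → (s ⊨ c ∧ c′) ⇔ (s ⊨ c × s ⊨ c′)

    side! side? : Label → Link → State → Id → State

    -- Needed for an updated network state to be a network state again:
    -- the state stored at a node carries the identifier of that node.
    side!-ident : ∀ f d s j → ident (side! f d s j) ≡ ident s
    side?-ident : ∀ f d s j → ident (side? f d s j) ≡ ident s

module Language (𝒮 : Setting) where
  open Setting 𝒮 public

  ------------------------------------------------------------------------
  -- Global protocols

  infixr 5 _∣_
  infixr 6 _⊕_ _⊕?_
  infixr 7 ⦅_⦆_ ⦅_⦆*_

  -- Recursion variables are well-scoped de Bruijn indices: Proto n has its
  -- free variables among n, so Proto 0 is the type of closed protocols.
  mutual
    data Proto : ℕ → Set where
      𝟎     : ∀ {n} → Proto n
      _∣_   : ∀ {n} → Proto n → Proto n → Proto n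
      rec   : ∀ {n} → Proto (suc n) → Proto n
      var   : ∀ {n} → Fin n → Proto n
      sum   : ∀ {n} → Summ n → Proto n
      ⦅_⦆_  : ∀ {n} → Id → Proto n → Proto n

    data Summ : ℕ → Set where
      act : ∀ {n} → Label → Dir → (o i : Cond) → Proto n → Summ n
      _⊕_ : ∀ {n} → Summ n → Summ n → Summ n

  -- A summation whose second part may be absent.
  _⊕?_ : ∀ {n} → Summ n → Maybe (Summ n) → Summ n
  S ⊕? nothing = S
  S ⊕? just T  = S ⊕ T

  ⦅_⦆*_ : ∀ {n} → List Id → Proto n → Proto n
  ⦅ I ⦆* P = foldr ⦅_⦆_ P I

  liftRen : ∀ {m n} → (Fin m → Fin n) → Fin (suc m) → Fin (suc n)
  liftRen ρ zero    = zero
  liftRen ρ (suc x) = suc (ρ x)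

  mutual
    rename : ∀ {m n} → (Fin m → Fin n) → Proto m → Proto n
    rename ρ 𝟎         = 𝟎
    rename ρ (P ∣ Q)   = rename ρ P ∣ rename ρ Q
    rename ρ (rec P)   = rec (rename (liftRen ρ) P)
    rename ρ (var x)   = var (ρ x)
    rename ρ (sum S)   = sum (renameˢ ρ S)
    rename ρ (⦅ j ⦆ P) = ⦅ j ⦆ rename ρ P

    renameˢ : ∀ {m n} → (Fin m → Fin n) → Summ m → Summ n
    renameˢ ρ (act f d o i P) = act f d o i (rename ρ P)
    renameˢ ρ (S ⊕ T)         = renameˢ ρ S ⊕ renameˢ ρ T

  weaken : ∀ {n} → Proto n → Proto (suc n)
  weaken = rename suc

  liftSub : ∀ {m n} → (Fin m → Proto n) → Fin (suc m) → Proto (suc n)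
  liftSub θ zero    = var zero
  liftSub θ (suc x) = weaken (θ x)

  mutual
    subs : ∀ {m n} → (Fin m → Proto n) → Proto m → Proto n
    subs θ 𝟎         = 𝟎
    subs θ (P ∣ Q)   = subs θ P ∣ subs θ Q
    subs θ (rec P)   = rec (subs (liftSub θ) P)
    subs θ (var x)   = θ x
    subs θ (sum S)   = sum (subsˢ θ S)
    subs θ (⦅ j ⦆ P) = ⦅ j ⦆ subs θ P

    subsˢ : ∀ {m n} → (Fin m → Proto n) → Summ m → Summ n
    subsˢ θ (act f d o i P) = act f d o i (subs θ P)
    subsˢ θ (S ⊕ T)         = subsˢ θ S ⊕ subsˢ θ T

  single : ∀ {n} → Proto n → Fin (suc n) → Proto n
  single Q zero    = Q
  single Q (suc x) = var x

  infix 8 _[_]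
  _[_] : ∀ {n} → Proto (suc n) → Proto n → Proto n
  P [ Q ] = subs (single Q) P

  infix 4 _≋_
  data _≋_ {n} : Proto n → Proto n → Set where
    ≋-refl  : ∀ {P} → P ≋ P
    ≋-sym   : ∀ {P Q} → P ≋ Q → Q ≋ P
    ≋-trans : ∀ {P Q R} → P ≋ Q → Q ≋ R → P ≋ R

    ∣-cong   : ∀ {P P′ Q Q′} → P ≋ P′ → Q ≋ Q′ → P ∣ Q ≋ P′ ∣ Q′
    rec-cong : ∀ {P P′ : Proto (suc n)} → P ≋ P′ → rec P ≋ rec P′
    ⦅⦆-cong  : ∀ {j P P′} → P ≋ P′ → ⦅ j ⦆ P ≋ ⦅ j ⦆ P′
    act-cong : ∀ {f d o i P P′} → P ≋ P′ →
               sum (act f d o i P) ≋ sum (act f d o i P′)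
    ⊕-cong   : ∀ {S S′ T T′} → sum S ≋ sum S′ → sum T ≋ sum T′ →
               sum (S ⊕ T) ≋ sum (S′ ⊕ T′)

    ∣-assoc    : ∀ {P Q R} → (P ∣ Q) ∣ R ≋ P ∣ (Q ∣ R)
    ∣-comm     : ∀ {P Q} → P ∣ Q ≋ Q ∣ P
    ⊕-assoc    : ∀ {S T U} → sum ((S ⊕ T) ⊕ U) ≋ sum (S ⊕ (T ⊕ U))
    ⊕-comm     : ∀ {S T} → sum (S ⊕ T) ≋ sum (T ⊕ S)
    ∣-identity : ∀ {P} → P ∣ 𝟎 ≋ P
    unfold     : ∀ {P} → rec P ≋ P [ rec P ]
    ⦅⦆-∣       : ∀ {j P Q} → ⦅ j ⦆ (P ∣ Q) ≋ ⦅ j ⦆ P ∣ ⦅ j ⦆ Q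
    ⦅⦆-swap    : ∀ {j k P} → ⦅ j ⦆ ⦅ k ⦆ P ≋ ⦅ k ⦆ ⦅ j ⦆ P
    ⦅⦆-𝟎       : ∀ {j} → ⦅ j ⦆ 𝟎 ≋ 𝟎

  ------------------------------------------------------------------------
  -- Network states

  -- A finite map from identifiers to states is given by the states
  -- themselves, each stored under the identifier it carries.  The domain is
  -- nonempty because there is no empty network to project to.
  record NetState : Set where
    field
      states : List⁺ State
      unique : Unique (List.map ident (toList states))

  open NetState public

  infix 4 _at_is_
  _at_is_ : NetState → Id → State → Set
  Δ at j is s = s ∈ toList (states Δ) × ident s ≡ j

  Target : Link → State → Id → Set
  Target ▲ s k = provider s ≡ k
  Target ▶ s k = k ∈ neighbours s

  Child : NetState → Id → Id → Set
  Child Δ j k = ∃[ s ] (Δ at k is s × Target ▲ s j)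

  -- Only meaningful when j ≢ k.
  updState : (j k : Id) → Label → Link → State → State
  updState j k f d s with ident s ≟ j | ident s ≟ k
  ... | yes _ | _     = side! f d s k
  ... | no _  | yes _ = side? f d s j
  ... | no _  | no _  = s

  updState-ident : ∀ j k f d s → ident (updState j k f d s) ≡ ident s
  updState-ident j k f d s with ident s ≟ j | ident s ≟ k
  ... | yes _ | _     = side!-ident f d s k
  ... | no _  | yes _ = side?-ident f d s j
  ... | no _  | no _  = refl

  upd : (j k : Id) → Label → Link → NetState → NetState
  upd j k f d Δ = record
    { states = List⁺.map (updState j k f d) (states Δ)
    ; unique = subst Unique
        (sym (trans (sym (map-∘ (toList (states Δ))))
                    (map-cong (updState-ident j k f d) (toList (states Δ)))))
        (unique Δ)
    }

  ------------------------------------------------------------------------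
  -- Reduction

  infix 3 _⨾_⟶_⨾_
  data _⨾_⟶_⨾_ {n} : NetState → Proto n → NetState → Proto n → Set where
    -- j ≢ k: the update is defined on Δ = (Δ″, j ↦ s, k ↦ s′) only.
    bin : ∀ {Δ j k s s′ f d o i P} {S : Maybe (Summ n)} →
          Δ at j is s → s ⊨ o → Target d s k →
          Δ at k is s′ → s′ ⊨ i → j ≢ k →
          Δ              ⨾ ⦅ j ⦆ sum (act f (link d) o i P ⊕? S) ⟶
          upd j k f d Δ  ⨾ sum (act f (link d) o i (⦅ k ⦆ P) ⊕? S)

    brd : ∀ {Δ j s f o i P} {S : Maybe (Summ n)} {I : List Id} →
          Δ at j is s → s ⊨ o →
          Unique I →
          (∀ k → k ∈ I ⇔ (Child Δ j k × ∃[ s′ ] (Δ at k is s′ × s′ ⊨ i))) →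
          Δ ⨾ ⦅ j ⦆ sum (act f ⋆ o i P ⊕? S) ⟶
          Δ ⨾ sum (act f ⋆ o i (⦅ I ⦆* P) ⊕? S)

    loc : ∀ {Δ j s f o i P} {S : Maybe (Summ n)} →
          Δ at j is s → s ⊨ o → s ⊨ i →
          Δ ⨾ ⦅ j ⦆ sum (act f • o i P ⊕? S) ⟶
          Δ ⨾ sum (act f • o i (⦅ j ⦆ P) ⊕? S)

    in-act : ∀ {Δ Δ′ f d o i P P′} → Δ ⨾ P ⟶ Δ′ ⨾ P′ →
             Δ ⨾ sum (act f d o i P) ⟶ Δ′ ⨾ sum (act f d o i P′)
    in-⦅⦆  : ∀ {Δ Δ′ j P P′} → Δ ⨾ P ⟶ Δ′ ⨾ P′ →
             Δ ⨾ ⦅ j ⦆ P ⟶ Δ′ ⨾ ⦅ j ⦆ P′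
    in-⊕   : ∀ {Δ Δ′ S S′ T} → Δ ⨾ sum S ⟶ Δ′ ⨾ sum S′ →
             Δ ⨾ sum (S ⊕ T) ⟶ Δ′ ⨾ sum (S′ ⊕ T)
    in-∣   : ∀ {Δ Δ′ P P′ Q} → Δ ⨾ P ⟶ Δ′ ⨾ P′ →
             Δ ⨾ P ∣ Q ⟶ Δ′ ⨾ P′ ∣ Q
    in-≋   : ∀ {Δ Δ′ P P₀ Q₀ Q} → P ≋ P₀ → Δ ⨾ P₀ ⟶ Δ′ ⨾ Q₀ → Q₀ ≋ Q →
             Δ ⨾ P ⟶ Δ′ ⨾ Q

  ------------------------------------------------------------------------
  -- Well-formed protocols

  mutual
    NoActive : ∀ {n} → Proto n → Set
    NoActive 𝟎         = ⊤
    NoActive (P ∣ Q)   = NoActive P × NoActive Q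
    NoActive (rec P)   = NoActive P
    NoActive (var x)   = ⊤
    NoActive (sum S)   = NoActiveˢ S
    NoActive (⦅ j ⦆ P) = ⊥

    NoActiveˢ : ∀ {n} → Summ n → Set
    NoActiveˢ (act f d o i P) = NoActive P
    NoActiveˢ (S ⊕ T)         = NoActiveˢ S × NoActiveˢ T

  ActiveAtTop : ∀ {n} → Proto n → Set
  ActiveAtTop 𝟎         = ⊤
  ActiveAtTop (P ∣ Q)   = ActiveAtTop P × ActiveAtTop Q
  ActiveAtTop (rec P)   = NoActive P
  ActiveAtTop (var x)   = ⊤
  ActiveAtTop (sum S)   = NoActiveˢ S
  ActiveAtTop (⦅ j ⦆ P) = ActiveAtTop P

  -- Every free occurrence of x is within the continuation of an action; in a
  -- summation there are no other places for it to occur.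
  GuardedIn : ∀ {n} → Fin n → Proto n → Set
  GuardedIn x 𝟎         = ⊤
  GuardedIn x (P ∣ Q)   = GuardedIn x P × GuardedIn x Q
  GuardedIn x (rec P)   = GuardedIn (suc x) P
  GuardedIn x (var y)   = x ≢ y
  GuardedIn x (sum S)   = ⊤
  GuardedIn x (⦅ j ⦆ P) = GuardedIn x P

  mutual
    RecGuarded : ∀ {n} → Proto n → Set
    RecGuarded 𝟎         = ⊤
    RecGuarded (P ∣ Q)   = RecGuarded P × RecGuarded Q
    RecGuarded (rec P)   = GuardedIn zero P × RecGuarded P
    RecGuarded (var x)   = ⊤
    RecGuarded (sum S)   = RecGuardedˢ S
    RecGuarded (⦅ j ⦆ P) = RecGuarded P

    RecGuardedˢ : ∀ {n} → Summ n → Set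
    RecGuardedˢ (act f d o i P) = RecGuarded P
    RecGuardedˢ (S ⊕ T)         = RecGuardedˢ S × RecGuardedˢ T

  mutual
    labels : ∀ {n} → Proto n → List Label
    labels 𝟎         = []
    labels (P ∣ Q)   = labels P ++ labels Q
    labels (rec P)   = labels P
    labels (var x)   = []
    labels (sum S)   = labelsˢ S
    labels (⦅ j ⦆ P) = labels P

    labelsˢ : ∀ {n} → Summ n → List Label
    labelsˢ (act f d o i P) = f ∷ labels P
    labelsˢ (S ⊕ T)         = labelsˢ S ++ labelsˢ T

  Specification : Proto 0 → Set
  Specification P = ActiveAtTop P × Unique (labels P) × RecGuarded P

  data Originates : NetState → Proto 0 → Set where
    spec : ∀ {Δ P} → Specification P → Originates Δ P
    equi : ∀ {Δ P Q} → Originates Δ P → P ≋ Q → Originates Δ Q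
    red  : ∀ {Δ Δ′ P Q} → Originates Δ P → Δ ⨾ P ⟶ Δ′ ⨾ Q → Originates Δ′ Q

  WellFormed : Proto 0 → Set
  WellFormed P = ∃[ Δ ] Originates Δ P

  ------------------------------------------------------------------------
  -- Distributed language

  data Choice : Set where
    send : Cond → Label → Dir → Choice
    _⊕_  : Choice → Choice → Choice

  data Reaction : Set where
    choice : Choice → Reaction
    𝟎      : Reaction
    _∣_    : Reaction → Reaction → Reaction

  -- The reactions are included among the definitions by ⌈_⌉ rather than by a
  -- constructor, so that there is only one parallel composition of reactions.
  data Def : Set where
    recv   : Cond → Label → Dir → Reaction → Def
    choice : Choice → Def
    𝟎      : Def
    _∣_    : Def → Def → Def

  ⌈_⌉ : Reaction → Def
  ⌈ choice C ⌉ = choice C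
  ⌈ 𝟎 ⌉        = 𝟎
  ⌈ R ∣ R′ ⌉   = ⌈ R ⌉ ∣ ⌈ R′ ⌉

  infix  5 _⦂_
  infixr 4 _∥_
  data Network : Set where
    _⦂_ : State → Def → Network
    _∥_ : Network → Network → Network

  infix 4 _≋ᵈ_
  data _≋ᵈ_ : Def → Def → Set where
    ≋-refl  : ∀ {D} → D ≋ᵈ D
    ≋-sym   : ∀ {D E} → D ≋ᵈ E → E ≋ᵈ D
    ≋-trans : ∀ {D E F} → D ≋ᵈ E → E ≋ᵈ F → D ≋ᵈ F

    ∣-cong    : ∀ {D D′ E E′} → D ≋ᵈ D′ → E ≋ᵈ E′ → D ∣ E ≋ᵈ D′ ∣ E′
    recv-cong : ∀ {c f d R R′} → ⌈ R ⌉ ≋ᵈ ⌈ R′ ⌉ →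
                recv c f d R ≋ᵈ recv c f d R′
    ⊕-cong    : ∀ {A A′ B B′} → choice A ≋ᵈ choice A′ → choice B ≋ᵈ choice B′ →
                choice (A ⊕ B) ≋ᵈ choice (A′ ⊕ B′)

    ∣-assoc    : ∀ {D E F} → (D ∣ E) ∣ F ≋ᵈ D ∣ (E ∣ F)
    ∣-comm     : ∀ {D E} → D ∣ E ≋ᵈ E ∣ D
    ⊕-assoc    : ∀ {A B C} → choice ((A ⊕ B) ⊕ C) ≋ᵈ choice (A ⊕ (B ⊕ C))
    ⊕-comm     : ∀ {A B} → choice (A ⊕ B) ≋ᵈ choice (B ⊕ A)
    ∣-identity : ∀ {D} → D ∣ 𝟎 ≋ᵈ D
    recv-idem  : ∀ {c f d R} → recv c f d R ∣ recv c f d R ≋ᵈ recv c f d R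

  infix 3 _≋ⁿ_
  data _≋ⁿ_ : Network → Network → Set where
    ≋-refl  : ∀ {M} → M ≋ⁿ M
    ≋-sym   : ∀ {M N} → M ≋ⁿ N → N ≋ⁿ M
    ≋-trans : ∀ {L M N} → L ≋ⁿ M → M ≋ⁿ N → L ≋ⁿ N

    ∥-cong  : ∀ {M M′ N N′} → M ≋ⁿ M′ → N ≋ⁿ N′ → M ∥ N ≋ⁿ M′ ∥ N′
    ⦂-cong  : ∀ {s D E} → D ≋ᵈ E → s ⦂ D ≋ⁿ s ⦂ E

    ∥-assoc : ∀ {L M N} → (L ∥ M) ∥ N ≋ⁿ L ∥ (M ∥ N)
    ∥-comm  : ∀ {M N} → M ∥ N ≋ⁿ N ∥ M

  data Action : Set where
    output input : Cond → Label → Dir → Action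
    local        : Cond → Label → Action

  infix 3 _—⟨_⟩→_
  data _—⟨_⟩→_ : Def → Action → Def → Set where
    recv : ∀ {c f d R} →
           recv c f d R —⟨ input c f d ⟩→ ⌈ R ⌉ ∣ recv c f d R
    send : ∀ {c f d} → choice (send c f d) —⟨ output c f d ⟩→ 𝟎
    ⊕ˡ   : ∀ {A B α D} → choice A —⟨ α ⟩→ D → choice (A ⊕ B) —⟨ α ⟩→ D
    ⊕ʳ   : ∀ {A B α D} → choice B —⟨ α ⟩→ D → choice (A ⊕ B) —⟨ α ⟩→ D
    ∣ˡ   : ∀ {D D′ E α} → D —⟨ α ⟩→ D′ → D ∣ E —⟨ α ⟩→ D′ ∣ E
    ∣ʳ   : ∀ {D E E′ α} → E —⟨ α ⟩→ E′ → D ∣ E —⟨ α ⟩→ D ∣ E′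
    syncˡ : ∀ {D D′ E E′ c₁ c₂ f} →
            D —⟨ output c₁ f • ⟩→ D′ → E —⟨ input c₂ f • ⟩→ E′ →
            D ∣ E —⟨ local (c₁ ∧ c₂) f ⟩→ D′ ∣ E′
    syncʳ : ∀ {D D′ E E′ c₁ c₂ f} →
            D —⟨ input c₂ f • ⟩→ D′ → E —⟨ output c₁ f • ⟩→ E′ →
            D ∣ E —⟨ local (c₁ ∧ c₂) f ⟩→ D′ ∣ E′

  data NetLabel : Set where
    τ         : NetLabel
    _⇢_by_    : Id → Id → Label → NetLabel
    _⇠_by_    : Id → Id → Label → NetLabel
    _!⋆by_    : Id → Label → NetLabel
    _?⋆by_    : Id → Label → NetLabel

  data γ : NetLabel → NetLabel → NetLabel → Set where
    pairˡ : ∀ {j k f} → γ (j ⇢ k by f) (k ⇠ j by f) τ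
    pairʳ : ∀ {j k f} → γ (k ⇠ j by f) (j ⇢ k by f) τ
    castˡ : ∀ {j f} → γ (j !⋆by f) (j ?⋆by f) (j !⋆by f)
    castʳ : ∀ {j f} → γ (j ?⋆by f) (j !⋆by f) (j !⋆by f)
    hear  : ∀ {j f} → γ (j ?⋆by f) (j ?⋆by f) (j ?⋆by f)

  data NonBroadcast : NetLabel → Set where
    τ      : NonBroadcast τ
    _⇢_by_ : ∀ j k f → NonBroadcast (j ⇢ k by f)
    _⇠_by_ : ∀ j k f → NonBroadcast (j ⇠ k by f)

  -- The labels ranged over by λ̂.
  data Hat : NetLabel → Set where
    τ      : Hat τ
    _!⋆by_ : ∀ j f → Hat (j !⋆by f)

  Discards : State → Def → Id → Label → Set
  Discards s D j f =
    ¬ (provider s ≡ j × ∃[ c ] ∃[ D′ ] (D —⟨ input c f ⋆ ⟩→ D′ × s ⊨ c))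

  infix 3 _—[_]→_
  data _—[_]→_ : Network → NetLabel → Network → Set where
    local   : ∀ {s D D′ c f} → D —⟨ local c f ⟩→ D′ → s ⊨ c →
              s ⦂ D —[ τ ]→ s ⦂ D′
    out     : ∀ {s D D′ c f d k} → D —⟨ output c f (link d) ⟩→ D′ → s ⊨ c →
              Target d s k →
              s ⦂ D —[ ident s ⇢ k by f ]→ side! f d s k ⦂ D′
    inp     : ∀ {s D D′ c f d j} → D —⟨ input c f (link d) ⟩→ D′ → s ⊨ c →
              s ⦂ D —[ ident s ⇠ j by f ]→ side? f d s j ⦂ D′
    cast    : ∀ {s D D′ c f} → D —⟨ output c f ⋆ ⟩→ D′ → s ⊨ c →
              s ⦂ D —[ ident s !⋆by f ]→ s ⦂ D′
    hear    : ∀ {s D D′ c f} → D —⟨ input c f ⋆ ⟩→ D′ → s ⊨ c →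
              s ⦂ D —[ provider s ?⋆by f ]→ s ⦂ D′
    discard : ∀ {s D j f} → Discards s D j f →
              s ⦂ D —[ j ?⋆by f ]→ s ⦂ D
    com     : ∀ {M M′ N N′ λ₁ λ₂ λ₃} →
              M —[ λ₁ ]→ M′ → N —[ λ₂ ]→ N′ → γ λ₁ λ₂ λ₃ →
              M ∥ N —[ λ₃ ]→ M′ ∥ N′
    ∥ˡ      : ∀ {M M′ N λ₁} → M —[ λ₁ ]→ M′ → NonBroadcast λ₁ →
              M ∥ N —[ λ₁ ]→ M′ ∥ N
    ∥ʳ      : ∀ {M N N′ λ₁} → N —[ λ₁ ]→ N′ → NonBroadcast λ₁ →
              M ∥ N —[ λ₁ ]→ M ∥ N′

  infix 3 _—[_]→≋_
  _—[_]→≋_ : Network → NetLabel → Network → Set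
  M —[ λ₁ ]→≋ N = ∃[ N′ ] ((M —[ λ₁ ]→ N′) × (N′ ≋ⁿ N))

  ------------------------------------------------------------------------
  -- Projection

  data Role : Set where
    ?? !! : Role
    node  : Id → Role

  -- σ, mapping each recursion variable in scope to the body of its recursion.
  Env : ℕ → Set
  Env n = Vec (Proto n) n

  -- σ[X ↦ P], where X is the variable just entering the scope.
  _,[_] : ∀ {n} → Env n → Proto (suc n) → Env (suc n)
  σ ,[ P ] = P ∷ Vec.map weaken σ

  -- The equations defining the projection terminate on guarded protocols only
  -- (consider rec X.X), so they are read as generating the graph of a partial
  -- function, which projection-functional shows to be single-valued.
  infix 3 ⟦_⟧[_,_]↦_
  data ⟦_⟧[_,_]↦_ {n} : Proto n → Role → Env n → Def → Set where
    act-?    : ∀ {f d o i P σ R D} →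
               ⟦ P ⟧[ !! , σ ]↦ ⌈ R ⌉ → ⟦ P ⟧[ ?? , σ ]↦ D →
               ⟦ sum (act f d o i P) ⟧[ ?? , σ ]↦ recv i f d R ∣ D
    act-!    : ∀ {f d o i P σ} →
               ⟦ sum (act f d o i P) ⟧[ !! , σ ]↦ choice (send o f d)
    act-node : ∀ {f d o i P σ j D} →
               ⟦ P ⟧[ node j , σ ]↦ D →
               ⟦ sum (act f d o i P) ⟧[ node j , σ ]↦ D
    ⦅⦆-self  : ∀ {j P σ D E} →
               ⟦ P ⟧[ node j , σ ]↦ D → ⟦ P ⟧[ !! , σ ]↦ E →
               ⟦ ⦅ j ⦆ P ⟧[ node j , σ ]↦ D ∣ E
    ⦅⦆-other : ∀ {j P r σ D} → r ≢ node j →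
               ⟦ P ⟧[ r , σ ]↦ D → ⟦ ⦅ j ⦆ P ⟧[ r , σ ]↦ D
    𝟎        : ∀ {r σ} → ⟦ 𝟎 ⟧[ r , σ ]↦ 𝟎
    var-≢!   : ∀ {x r σ} → r ≢ !! → ⟦ var x ⟧[ r , σ ]↦ 𝟎
    var-!    : ∀ {x σ D} →
               ⟦ lookup σ x ⟧[ !! , σ ]↦ D → ⟦ var x ⟧[ !! , σ ]↦ D
    rec      : ∀ {P : Proto (suc n)} {r σ D} →
               ⟦ P ⟧[ r , σ ,[ P ] ]↦ D → ⟦ rec P ⟧[ r , σ ]↦ D
    _∣_      : ∀ {P Q r σ D E} →
               ⟦ P ⟧[ r , σ ]↦ D → ⟦ Q ⟧[ r , σ ]↦ E →
               ⟦ P ∣ Q ⟧[ r , σ ]↦ D ∣ E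
    ⊕-!      : ∀ {S T σ A B} →
               ⟦ sum S ⟧[ !! , σ ]↦ choice A → ⟦ sum T ⟧[ !! , σ ]↦ choice B →
               ⟦ sum (S ⊕ T) ⟧[ !! , σ ]↦ choice (A ⊕ B)
    ⊕-≢!     : ∀ {S T r σ D E} → r ≢ !! →
               ⟦ sum S ⟧[ r , σ ]↦ D → ⟦ sum T ⟧[ r , σ ]↦ E →
               ⟦ sum (S ⊕ T) ⟧[ r , σ ]↦ D ∣ E

  data NodeProjection (P : Proto 0) : State → Network → Set where
    node : ∀ {s D E} →
           ⟦ P ⟧[ ?? , [] ]↦ D → ⟦ P ⟧[ node (ident s) , [] ]↦ E →
           NodeProjection P s (s ⦂ (D ∣ E))

  data Composition (P : Proto 0) : List⁺ State → Network → Set where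
    last : ∀ {s N} → NodeProjection P s N → Composition P (s ∷ []) N
    _∷_  : ∀ {s t ss M N} →
           NodeProjection P s M → Composition P (t ∷ ss) N →
           Composition P (s ∷ t ∷ ss) (M ∥ N)

  infix 3 ⟦_⨾_⟧↦_
  ⟦_⨾_⟧↦_ : NetState → Proto 0 → Network → Set
  ⟦ Δ ⨾ P ⟧↦ N = Composition P (states Δ) N

  private
    ∣-injective : ∀ {D D′ E E′ : Def} → D ∣ E ≡ D′ ∣ E′ → D ≡ D′ × E ≡ E′
    ∣-injective refl = refl , refl

    choice-injective : ∀ {A B} → Def.choice A ≡ choice B → A ≡ B
    choice-injective refl = refl

    ⌈⌉-injective : ∀ R R′ → ⌈ R ⌉ ≡ ⌈ R′ ⌉ → R ≡ R′
    ⌈⌉-injective (choice A) (choice B) refl = refl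
    ⌈⌉-injective 𝟎          𝟎          refl = refl
    ⌈⌉-injective (R₁ ∣ R₂)  (R₃ ∣ R₄)  eq with ∣-injective eq
    ... | e₁ , e₂ = cong₂ _∣_ (⌈⌉-injective R₁ R₃ e₁) (⌈⌉-injective R₂ R₄ e₂)

  role-functional : ∀ {n} {P : Proto n} {r σ D E} →
                    ⟦ P ⟧[ r , σ ]↦ D → ⟦ P ⟧[ r , σ ]↦ E → D ≡ E
  role-functional (act-? {R = R} p q) (act-? {R = R′} p′ q′) =
    cong₂ (λ R D → recv _ _ _ R ∣ D)
      (⌈⌉-injective R R′ (role-functional p p′)) (role-functional q q′)
  role-functional act-! act-! = refl
  role-functional (act-node p) (act-node p′) = role-functional p p′
  role-functional (⦅⦆-self p q) (⦅⦆-self p′ q′) =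
    cong₂ _∣_ (role-functional p p′) (role-functional q q′)
  role-functional (⦅⦆-self p q) (⦅⦆-other r≢j _) = ⊥-elim (r≢j refl)
  role-functional (⦅⦆-other r≢j _) (⦅⦆-self p q) = ⊥-elim (r≢j refl)
  role-functional (⦅⦆-other _ p) (⦅⦆-other _ p′) = role-functional p p′
  role-functional 𝟎 𝟎 = refl
  role-functional (var-≢! _) (var-≢! _) = refl
  role-functional (var-≢! r≢!) (var-! _) = ⊥-elim (r≢! refl)
  role-functional (var-! _) (var-≢! r≢!) = ⊥-elim (r≢! refl)
  role-functional (var-! p) (var-! p′) = role-functional p p′
  role-functional (rec p) (rec p′) = role-functional p p′
  role-functional (p ∣ q) (p′ ∣ q′) =
    cong₂ _∣_ (role-functional p p′) (role-functional q q′)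
  role-functional (⊕-! p q) (⊕-! p′ q′) =
    cong₂ (λ A B → choice (A ⊕ B))
      (choice-injective (role-functional p p′))
      (choice-injective (role-functional q q′))
  role-functional (⊕-! _ _) (⊕-≢! r≢! _ _) = ⊥-elim (r≢! refl)
  role-functional (⊕-≢! r≢! _ _) (⊕-! _ _) = ⊥-elim (r≢! refl)
  role-functional (⊕-≢! _ p q) (⊕-≢! _ p′ q′) =
    cong₂ _∣_ (role-functional p p′) (role-functional q q′)

  projection-functional : ∀ {Δ P M N} → ⟦ Δ ⨾ P ⟧↦ M → ⟦ Δ ⨾ P ⟧↦ N → M ≡ N
  projection-functional = composition-functional
    where
    node-functional : ∀ {P s M N} →
                      NodeProjection P s M → NodeProjection P s N → M ≡ N
    node-functional (node p q) (node p′ q′) =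
      cong₂ (λ D E → _ ⦂ (D ∣ E)) (role-functional p p′) (role-functional q q′)

    composition-functional : ∀ {P ss M N} →
                             Composition P ss M → Composition P ss N → M ≡ N
    composition-functional (last p) (last p′) = node-functional p p′
    composition-functional (p ∷ ps) (p′ ∷ ps′) =
      cong₂ _∥_ (node-functional p p′) (composition-functional ps ps′)

  -- No node is its own power provider.  A node for which this failed would be
  -- a target of its own broadcasts in a reduction, but never in a network,
  -- where the sender does not take part in the reception.
  NoSelfProvider : NetState → Set
  NoSelfProvider Δ = ∀ {j s} → Δ at j is s → provider s ≢ j

-- The projections of a guarded protocol are the values of total compositional
-- functions: "bang" for the role !, "hears" for ?, and "sends k" for the node k.
-- They are invariant under ≋.  For "hears" this rests on idempotence: unfolding
-- a recursion only adds copies of receptions that are already there.  For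
-- "sends" it rests on the absence of live active nodes in a recursion whose
-- variable occurs; the congruence can create rec X.(id)[f]P with X not in P, and
-- (id)0 anywhere, so this is the invariant to use, not the absence of active
-- nodes.  In a well-formed protocol, moreover, all receptions of the same label
-- agree up to ≋.
--
-- A reduction then leaves "bang" and "hears" as they are, removes one choice
-- offering f from "sends j" of the sender j, and adds the reactions to f at each
-- target.  This is exactly what a network step on τ or (j!⋆)^f does, and
-- conversely the choice that j resolves in such a step points at an action that
-- can be exposed in the protocol under an active node j.

module Submission where

import Algebra.Solver.CommutativeMonoid
open import Algebra.Bundles using (CommutativeMonoid)
open import Defs
open import Data.Bool using (Bool; true; false; _∨_)
open import Data.Bool.Properties
  using (∨-assoc; ∨-comm; ∨-identityʳ; ∨-conicalˡ; ∨-conicalʳ; ∨-zeroʳ)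
open import Data.Empty using (⊥; ⊥-elim)
open import Data.Fin using (Fin; zero; suc)
open import Data.List as List using (List; []; _∷_; _++_)
open import Data.List.Membership.Propositional using (_∈_; _∉_)
open import Data.List.Membership.Propositional.Properties using (∈-++⁺ˡ; ∈-++⁺ʳ; ∈-map⁺)
open import Data.List.NonEmpty as List⁺ using (List⁺)
open import Data.List.Relation.Unary.All as All using ([]; _∷_)
import Data.List.Relation.Unary.All.Properties as AllP
open import Data.List.Relation.Unary.AllPairs using ([]; _∷_)
open import Data.List.Relation.Unary.Any using (here; there)
open import Data.List.Relation.Unary.Unique.Propositional using (Unique)
open import Data.Maybe using (just; nothing)
open import Data.Nat as ℕ using (ℕ; zero; suc; _⊔_; _≤_; _<_; z≤n; s≤s)
open import Data.Nat.Properties as ℕP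
  using (⊔-assoc; ⊔-comm; ⊔-identityʳ; ≤-refl; ≤-trans; m≤m⊔n; m≤n⊔m; ⊔-lub; ⊔-pres-<m)
open import Data.Product using (∃-syntax; Σ-syntax; _×_; _,_; proj₁; proj₂; swap)
open import Data.Product.Function.NonDependent.Propositional using (_×-⇔_)
open import Data.Sum as ⊎ using (_⊎_; inj₁; inj₂)
open import Data.Unit using (⊤; tt)
open import Data.Vec using ([]; lookup)
open import Data.Vec.Properties using (lookup-map)
open import Data.Vec.Functional using () renaming (_∷_ to _▹_)
open import Function using (_∘_; id)
open import Function.Bundles using (_⇔_; mk⇔; Equivalence)
open import Function.Properties.Equivalence
  using () renaming (sym to ⇔-sym; trans to ⇔-trans)
open import Relation.Binary.PropositionalEquality
  using (_≡_; _≢_; refl; sym; trans; cong; cong₂; subst)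
open import Relation.Nullary using (Dec; yes; no)

-- The congruence may fold a recursion back as well as unfold it, so every invariant has to cross
-- `unfold` in both directions. The syntactic conditions on specifications do not survive: unfolding
-- duplicates labels, and a reduction puts active nodes below actions. `Guarded`, a grade below 3
-- and `Consistent` take their place. Grades, guardedness, meanings and sizes are all
-- interpretations in an `Algebra`. Substitution is thus treated once, and invariance under `unfold`
-- becomes a fixed-point question for each interpretation. The obstacle in the converse direction is
-- that a choice at `j` does not show where in the protocol it comes from. Finding its action may
-- require unfolding recursions, which enlarges the protocol in general. Two measures resolve this:
-- one for pushing an active node inward to a choice it releases, where guardedness bounds the
-- unfolding, and one for reaching that active node, possibly below actions, where a recursion that
-- has to be unfolded does not contain its variable.

module Proof (𝒮 : Setting) where
  open Language 𝒮

  -- Interpretations of protocols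

  record Algebra : Set₁ where
    field
      Proc Choices : Set
      nil   : Proc
      par   : Proc → Proc → Proc
      fix   : (Proc → Proc) → Proc
      total : Choices → Proc
      grant : Id → Proc → Proc
      pre   : Label → Dir → Cond → Cond → Proc → Choices
      plus  : Choices → Choices → Choices
      fix-cong : ∀ {F G} → (∀ a → F a ≡ G a) → fix F ≡ fix G

  module Eval (𝒜 : Algebra) where
    open Algebra 𝒜

    mutual
      eval : ∀ {n} → (Fin n → Proc) → Proto n → Proc
      eval φ 𝟎         = nil
      eval φ (P ∣ Q)   = par (eval φ P) (eval φ Q)
      eval φ (rec P)   = fix (λ a → eval (a ▹ φ) P)
      eval φ (var x)   = φ x
      eval φ (sum S)   = total (evalˢ φ S)
      eval φ (⦅ j ⦆ P) = grant j (eval φ P)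

      evalˢ : ∀ {n} → (Fin n → Proc) → Summ n → Choices
      evalˢ φ (act f d o i P) = pre f d o i (eval φ P)
      evalˢ φ (S ⊕ T)         = plus (evalˢ φ S) (evalˢ φ T)

    ▹-cong : ∀ {n} {φ ψ : Fin n → Proc} {a} →
             (∀ x → φ x ≡ ψ x) → ∀ x → (a ▹ φ) x ≡ (a ▹ ψ) x
    ▹-cong e zero    = refl
    ▹-cong e (suc x) = e x

    mutual
      eval-cong : ∀ {n} {φ ψ : Fin n → Proc} →
                  (∀ x → φ x ≡ ψ x) → ∀ P → eval φ P ≡ eval ψ P
      eval-cong e 𝟎         = refl
      eval-cong e (P ∣ Q)   = cong₂ par (eval-cong e P) (eval-cong e Q)
      eval-cong e (rec P)   = fix-cong λ a → eval-cong (▹-cong e) P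
      eval-cong e (var x)   = e x
      eval-cong e (sum S)   = cong total (evalˢ-cong e S)
      eval-cong e (⦅ j ⦆ P) = cong (grant j) (eval-cong e P)

      evalˢ-cong : ∀ {n} {φ ψ : Fin n → Proc} →
                   (∀ x → φ x ≡ ψ x) → ∀ S → evalˢ φ S ≡ evalˢ ψ S
      evalˢ-cong e (act f d o i P) = cong (pre f d o i) (eval-cong e P)
      evalˢ-cong e (S ⊕ T) = cong₂ plus (evalˢ-cong e S) (evalˢ-cong e T)

    mutual
      eval-rename : ∀ {m n} (r : Fin m → Fin n) φ P →
                    eval φ (rename r P) ≡ eval (φ ∘ r) P
      eval-rename r φ 𝟎         = refl
      eval-rename r φ (P ∣ Q)   = cong₂ par (eval-rename r φ P) (eval-rename r φ Q)
      eval-rename r φ (rec P)   = fix-cong λ a →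
        trans (eval-rename (liftRen r) (a ▹ φ) P)
              (eval-cong (λ { zero → refl ; (suc x) → refl }) P)
      eval-rename r φ (var x)   = refl
      eval-rename r φ (sum S)   = cong total (evalˢ-rename r φ S)
      eval-rename r φ (⦅ j ⦆ P) = cong (grant j) (eval-rename r φ P)

      evalˢ-rename : ∀ {m n} (r : Fin m → Fin n) φ S →
                     evalˢ φ (renameˢ r S) ≡ evalˢ (φ ∘ r) S
      evalˢ-rename r φ (act f d o i P) = cong (pre f d o i) (eval-rename r φ P)
      evalˢ-rename r φ (S ⊕ T) =
        cong₂ plus (evalˢ-rename r φ S) (evalˢ-rename r φ T)

    eval-liftSub : ∀ {m n} (θ : Fin m → Proto n) φ a x →
                   eval (a ▹ φ) (liftSub θ x) ≡ (a ▹ (eval φ ∘ θ)) x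
    eval-liftSub θ φ a zero    = refl
    eval-liftSub θ φ a (suc x) = eval-rename suc (a ▹ φ) (θ x)

    mutual
      eval-subs : ∀ {m n} (θ : Fin m → Proto n) φ P →
                  eval φ (subs θ P) ≡ eval (eval φ ∘ θ) P
      eval-subs θ φ 𝟎         = refl
      eval-subs θ φ (P ∣ Q)   = cong₂ par (eval-subs θ φ P) (eval-subs θ φ Q)
      eval-subs θ φ (rec P)   = fix-cong λ a →
        trans (eval-subs (liftSub θ) (a ▹ φ) P)
              (eval-cong (eval-liftSub θ φ a) P)
      eval-subs θ φ (var x)   = refl
      eval-subs θ φ (sum S)   = cong total (evalˢ-subs θ φ S)
      eval-subs θ φ (⦅ j ⦆ P) = cong (grant j) (eval-subs θ φ P)

      evalˢ-subs : ∀ {m n} (θ : Fin m → Proto n) φ S →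
                   evalˢ φ (subsˢ θ S) ≡ evalˢ (eval φ ∘ θ) S
      evalˢ-subs θ φ (act f d o i P) = cong (pre f d o i) (eval-subs θ φ P)
      evalˢ-subs θ φ (S ⊕ T) = cong₂ plus (evalˢ-subs θ φ S) (evalˢ-subs θ φ T)

    -- Reduces the effect of `unfold` on an interpretation to comparing the value of `fix` with one
    -- further application of the body to it.
    eval-unfold : ∀ {n} (φ : Fin n → Proc) P →
                  eval φ (P [ rec P ]) ≡ eval (eval φ (rec P) ▹ φ) P
    eval-unfold φ P = trans (eval-subs (single (rec P)) φ P)
      (eval-cong (λ { zero → refl ; (suc x) → refl }) P)

  -- Grades: 0 for a protocol without actions and variables, 1 for one whose
  -- active nodes are all on parts of grade 0, 2 for one with finitely many
  -- active nodes in its infinite unfolding, and 3 if there may be infinitely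
  -- many.  A recursion variable is first taken to have grade 1; if this leads
  -- to a higher grade, giving it grade 3 shows whether it occurs at all.
  settle : ℕ → ℕ → ℕ
  settle 0             b = 0
  settle 1             b = 1
  settle (suc (suc _)) b = b

  -- An active node above a dead part must not count, because of `⦅⦆-𝟎`; hence 0 stays 0.
  boost : ℕ → ℕ
  boost 0             = 0
  boost 1             = 2
  boost (suc (suc n)) = suc (suc n)

  Grade : Algebra
  Grade = record
    { Proc = ℕ ; Choices = ℕ ; nil = 0 ; par = _⊔_
    ; fix = λ F → settle (F 1) (F 3)
    ; total = id ; grant = λ _ → boost ; pre = λ _ _ _ _ → 1 ⊔_ ; plus = _⊔_
    ; fix-cong = λ e → cong₂ settle (e 1) (e 3) }

  module Graded = Eval Grade
  open Graded using () renaming (eval to grade)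

  -- The two tractable kinds of recursion. In the first the body has no live active node. In the
  -- second, for `m` at most 3, the variable does not occur in the body, since it was given grade 3.
  grade-rec : ∀ {n m} {γ : Fin n → ℕ} P → grade γ (rec P) < m →
              (grade (1 ▹ γ) P < m × grade (1 ▹ γ) P < 2)
              ⊎ grade (3 ▹ γ) P < m
  grade-rec {γ = γ} P p with grade (1 ▹ γ) P
  ... | 0           = inj₁ (p , s≤s z≤n)
  ... | 1           = inj₁ (p , ≤-refl)
  ... | suc (suc _) = inj₂ p

  boost-inv : ∀ {m} a → boost a < m → a < m
  boost-inv 0             p       = p
  boost-inv 1             p       = ≤-trans (s≤s (s≤s z≤n)) p
  boost-inv (suc (suc a)) p       = p

  boost-dead : ∀ a → boost a < 2 → a < 1
  boost-dead 0             p = s≤s z≤n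
  boost-dead 1             (s≤s (s≤s ()))
  boost-dead (suc (suc a)) (s≤s (s≤s ()))

  boost-⊔ : ∀ a b → boost (a ⊔ b) ≡ boost a ⊔ boost b
  boost-⊔ 0             b             = refl
  boost-⊔ 1             0             = refl
  boost-⊔ 1             1             = refl
  boost-⊔ 1             (suc (suc b)) = refl
  boost-⊔ (suc (suc a)) 0             = refl
  boost-⊔ (suc (suc a)) 1             = sym (cong (λ n → suc (suc n)) (⊔-identityʳ a))
  boost-⊔ (suc (suc a)) (suc (suc b)) = refl

  boost-≤3 : ∀ a → a ≤ 3 → boost a ≤ 3
  boost-≤3 0             p = p
  boost-≤3 1             p = s≤s (s≤s z≤n)
  boost-≤3 (suc (suc a)) p = p

  ⊔-<ˡ : ∀ {m} a b → a ⊔ b < m → a < m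
  ⊔-<ˡ a b p = ≤-trans (s≤s (m≤m⊔n a b)) p

  ⊔-<ʳ : ∀ {m} a b → a ⊔ b < m → b < m
  ⊔-<ʳ a b p = ≤-trans (s≤s (m≤n⊔m a b)) p

  ▹-⊎ : ∀ {n} {A : Set} {B : A → A → Set} {m} {φ ψ : Fin n → A} {γ : Fin n → ℕ} {a b k} →
        B a b → (∀ x → B (φ x) (ψ x) ⊎ m ≤ γ x) →
        ∀ x → B ((a ▹ φ) x) ((b ▹ ψ) x) ⊎ m ≤ (k ▹ γ) x
  ▹-⊎ e h zero    = inj₁ e
  ▹-⊎ e h (suc x) = h x

  <⇒≱-elim : ∀ {m n} {A : Set} → n < m → m ≤ n → A
  <⇒≱-elim p q = ⊥-elim (ℕP.<-irrefl refl (≤-trans p q))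

  module _ (𝒜 : Algebra) where
    open Algebra 𝒜
    open Eval 𝒜

    -- A variable of grade at least m does not occur in a protocol of grade
    -- less than m.
    eval-irrelevant : ∀ {n} m {γ} {φ ψ : Fin n → Proc} P → grade γ P < m →
                      (∀ x → φ x ≡ ψ x ⊎ m ≤ γ x) → eval φ P ≡ eval ψ P
    eval-irrelevant m 𝟎 p h = refl
    eval-irrelevant m {γ} (P ∣ Q) p h =
      cong₂ par (eval-irrelevant m P (⊔-<ˡ (grade γ P) _ p) h)
                (eval-irrelevant m Q (⊔-<ʳ (grade γ P) _ p) h)
    eval-irrelevant m (rec P) p h with grade-rec P p
    ... | inj₁ (q , _) = fix-cong λ a → eval-irrelevant m P q (▹-⊎ {B = _≡_} refl h)
    ... | inj₂ q       = fix-cong λ a → eval-irrelevant m P q (▹-⊎ {B = _≡_} refl h)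
    eval-irrelevant m (var x) p h with h x
    ... | inj₁ e = e
    ... | inj₂ q = <⇒≱-elim p q
    eval-irrelevant m (sum S) p h = cong total (irrelevantˢ S p)
      where
      -- The placeholders on the two sides of the equation stand for the two valuations.
      irrelevantˢ : ∀ S → grade _ (sum S) < m → evalˢ _ S ≡ evalˢ _ S
      irrelevantˢ (act f d o i P) p =
        cong (pre f d o i) (eval-irrelevant m P (⊔-<ʳ 1 (grade _ P) p) h)
      irrelevantˢ (S ⊕ T) p =
        cong₂ plus (irrelevantˢ S (⊔-<ˡ (grade _ (sum S)) _ p))
                   (irrelevantˢ T (⊔-<ʳ (grade _ (sum S)) _ p))
    eval-irrelevant m {γ} (⦅ j ⦆ P) p h =
      cong (grant j) (eval-irrelevant m P (boost-inv (grade γ P) p) h)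

  grade-≤3 : ∀ {n} {γ : Fin n → ℕ} → (∀ x → γ x ≤ 3) → ∀ P → grade γ P ≤ 3
  grade-≤3 b 𝟎 = z≤n
  grade-≤3 b (P ∣ Q) = ⊔-lub (grade-≤3 b P) (grade-≤3 b Q)
  grade-≤3 {γ = γ} b (rec P)
    with grade (1 ▹ γ) P
       | grade-≤3 {γ = 3 ▹ γ} (λ { zero → ≤-refl ; (suc x) → b x }) P
  ... | 0           | q = z≤n
  ... | 1           | q = s≤s z≤n
  ... | suc (suc _) | q = q
  grade-≤3 b (var x) = b x
  grade-≤3 b (sum (act f d o i P)) = ⊔-lub (s≤s z≤n) (grade-≤3 b P)
  grade-≤3 b (sum (S ⊕ T)) = ⊔-lub (grade-≤3 b (sum S)) (grade-≤3 b (sum T))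
  grade-≤3 b (⦅ j ⦆ P) = boost-≤3 _ (grade-≤3 b P)

  -- The results 1 and 3 are the very grades that the variable was given. A result 0, or one below 3
  -- when the variable has grade 3, shows that the variable does not occur, so its grade is
  -- irrelevant.
  grade-fixpoint : ∀ {n} {γ : Fin n → ℕ} → (∀ x → γ x ≤ 3) → ∀ P →
                   grade (grade γ (rec P) ▹ γ) P ≡ grade γ (rec P)
  grade-fixpoint {γ = γ} b P
    with grade (1 ▹ γ) P in e₁ | grade (3 ▹ γ) P in e₃
  ... | 0 | _ = trans
    (eval-irrelevant Grade 1 {γ = 1 ▹ γ} P (subst (_< 1) (sym e₁) ≤-refl)
       λ { zero → inj₂ ≤-refl ; (suc x) → inj₁ refl }) e₁
  ... | 1 | _ = e₁
  ... | suc (suc _) | k with 3 ℕ.≤? k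
  ...   | yes 3≤k = trans
    (cong (λ a → grade (a ▹ γ) P)
       (ℕP.≤-antisym (subst (_≤ 3) e₃ (grade-≤3 (λ { zero → ≤-refl ; (suc x) → b x }) P)) 3≤k)) e₃
  ...   | no 3≰k = trans
    (eval-irrelevant Grade 3 {γ = 3 ▹ γ} P (subst (_< 3) (sym e₃) (ℕP.≰⇒> 3≰k))
       λ { zero → inj₂ ≤-refl ; (suc x) → inj₁ refl }) e₃

  grade-≋ : ∀ {n} {γ : Fin n → ℕ} {P Q} → (∀ x → γ x ≤ 3) → P ≋ Q →
            grade γ P ≡ grade γ Q
  grade-≋ b ≋-refl         = refl
  grade-≋ b (≋-sym p)      = sym (grade-≋ b p)
  grade-≋ b (≋-trans p q)  = trans (grade-≋ b p) (grade-≋ b q)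
  grade-≋ b (∣-cong p q)   = cong₂ _⊔_ (grade-≋ b p) (grade-≋ b q)
  grade-≋ b (rec-cong p)   = cong₂ settle
    (grade-≋ (λ { zero → s≤s z≤n ; (suc x) → b x }) p)
    (grade-≋ (λ { zero → ≤-refl ; (suc x) → b x }) p)
  grade-≋ b (⦅⦆-cong p)    = cong boost (grade-≋ b p)
  grade-≋ b (act-cong p)   = cong (1 ⊔_) (grade-≋ b p)
  grade-≋ b (⊕-cong p q)   = cong₂ _⊔_ (grade-≋ b p) (grade-≋ b q)
  grade-≋ b (∣-assoc {P})  = ⊔-assoc (grade _ P) _ _
  grade-≋ b (∣-comm {P})   = ⊔-comm (grade _ P) _
  grade-≋ b (⊕-assoc {S})  = ⊔-assoc (grade _ (sum S)) _ _
  grade-≋ b (⊕-comm {S})   = ⊔-comm (grade _ (sum S)) _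
  grade-≋ b ∣-identity     = ⊔-identityʳ _
  grade-≋ {γ = γ} b (unfold {P}) =
    sym (trans (Graded.eval-unfold γ P) (grade-fixpoint b P))
  grade-≋ b (⦅⦆-∣ {P = P}) = boost-⊔ (grade _ P) _
  grade-≋ b ⦅⦆-swap        = refl
  grade-≋ b ⦅⦆-𝟎           = refl

  -- Guardedness of recursion

  false≢true : false ≢ true
  false≢true ()

  -- The value is `true` when a variable valued `true` occurs outside all actions. The
  -- interpretation of a body is monotone, so its value at `false` is already its least fixed point.
  Guard : Algebra
  Guard = record
    { Proc = Bool ; Choices = ⊤ ; nil = false ; par = _∨_
    ; fix = λ F → F false
    ; total = λ _ → false ; grant = λ _ → id ; pre = λ _ _ _ _ _ → tt ; plus = λ _ _ → tt
    ; fix-cong = λ e → e false }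

  module Guarding = Eval Guard
  open Guarding using () renaming (eval to unguarded)

  none : ∀ {n} → Fin n → Bool
  none _ = false

  unguarded-none : ∀ {n} {χ : Fin n → Bool} → (∀ x → χ x ≡ false) →
                   ∀ P → unguarded χ P ≡ false
  unguarded-none h 𝟎         = refl
  unguarded-none h (P ∣ Q)   = cong₂ _∨_ (unguarded-none h P) (unguarded-none h Q)
  unguarded-none h (rec P)   = unguarded-none (λ { zero → refl ; (suc x) → h x }) P
  unguarded-none h (var x)   = h x
  unguarded-none h (sum S)   = refl
  unguarded-none h (⦅ j ⦆ P) = unguarded-none h P

  unguarded-mono : ∀ {n} {χ ψ : Fin n → Bool} → (∀ x → χ x ≡ true → ψ x ≡ true) →
                   ∀ P → unguarded χ P ≡ true → unguarded ψ P ≡ true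
  unguarded-mono {χ = χ} {ψ} h (P ∣ Q) e with unguarded χ P in e₁
  ... | true rewrite unguarded-mono {ψ = ψ} h P e₁ = refl
  ... | false rewrite unguarded-mono {ψ = ψ} h Q e = ∨-zeroʳ (unguarded ψ P)
  unguarded-mono h (rec P) e = unguarded-mono (λ { zero () ; (suc x) → h x }) P e
  unguarded-mono h (var x) e = h x e
  unguarded-mono h (⦅ j ⦆ P) e = unguarded-mono h P e

  unguarded-fixpoint : ∀ {n} (χ : Fin n → Bool) P →
                       unguarded (unguarded χ (rec P) ▹ χ) P ≡ unguarded χ (rec P)
  unguarded-fixpoint χ P with unguarded (false ▹ χ) P in e
  ... | false = e
  ... | true  = unguarded-mono (λ { zero () ; (suc x) → id }) P e

  unguarded-≋ : ∀ {n} (χ : Fin n → Bool) {P Q} → P ≋ Q →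
                unguarded χ P ≡ unguarded χ Q
  unguarded-≋ χ ≋-refl         = refl
  unguarded-≋ χ (≋-sym p)      = sym (unguarded-≋ χ p)
  unguarded-≋ χ (≋-trans p q)  = trans (unguarded-≋ χ p) (unguarded-≋ χ q)
  unguarded-≋ χ (∣-cong p q)   = cong₂ _∨_ (unguarded-≋ χ p) (unguarded-≋ χ q)
  unguarded-≋ χ (rec-cong p)   = unguarded-≋ (false ▹ χ) p
  unguarded-≋ χ (⦅⦆-cong p)    = unguarded-≋ χ p
  unguarded-≋ χ (act-cong p)   = refl
  unguarded-≋ χ (⊕-cong p q)   = refl
  unguarded-≋ χ (∣-assoc {P})  = ∨-assoc (unguarded χ P) _ _
  unguarded-≋ χ (∣-comm {P})   = ∨-comm (unguarded χ P) _
  unguarded-≋ χ ⊕-assoc        = refl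
  unguarded-≋ χ ⊕-comm         = refl
  unguarded-≋ χ ∣-identity     = ∨-identityʳ _
  unguarded-≋ χ (unfold {P})   =
    sym (trans (Guarding.eval-unfold χ P) (unguarded-fixpoint χ P))
  unguarded-≋ χ ⦅⦆-∣           = refl
  unguarded-≋ χ ⦅⦆-swap        = refl
  unguarded-≋ χ ⦅⦆-𝟎           = refl

  -- A form of `RecGuarded` based on the interpretation `unguarded`, which makes the lemmas on
  -- algebras available for substitution and unfolding.
  Guarded : ∀ {n} → Proto n → Set
  Guarded 𝟎                       = ⊤
  Guarded (P ∣ Q)                 = Guarded P × Guarded Q
  Guarded (rec P)                 = unguarded (true ▹ none) P ≡ false × Guarded P
  Guarded (var x)                 = ⊤
  Guarded (sum (act f d o i P))   = Guarded P
  Guarded (sum (S ⊕ T))           = Guarded (sum S) × Guarded (sum T)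
  Guarded (⦅ j ⦆ P)               = Guarded P

  Guarded-rename : ∀ {m n} (r : Fin m → Fin n) P → Guarded (rename r P) ≡ Guarded P
  Guarded-rename r 𝟎                     = refl
  Guarded-rename r (P ∣ Q)               =
    cong₂ _×_ (Guarded-rename r P) (Guarded-rename r Q)
  Guarded-rename r (rec P)               = cong₂ _×_
    (cong (_≡ false) (trans (Guarding.eval-rename (liftRen r) (true ▹ none) P)
      (Guarding.eval-cong (λ { zero → refl ; (suc x) → refl }) P)))
    (Guarded-rename (liftRen r) P)
  Guarded-rename r (var x)               = refl
  Guarded-rename r (sum (act f d o i P)) = Guarded-rename r P
  Guarded-rename r (sum (S ⊕ T))         =
    cong₂ _×_ (Guarded-rename r (sum S)) (Guarded-rename r (sum T))
  Guarded-rename r (⦅ j ⦆ P)             = Guarded-rename r P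

  -- The protocols substituted are weakened, so none of them mentions the bound variable, the only
  -- one that is marked.
  unguarded-liftSub : ∀ {m n} (θ : Fin m → Proto n) P →
    unguarded (true ▹ none) (subs (liftSub θ) P) ≡ unguarded (true ▹ none) P
  unguarded-liftSub θ P = trans (Guarding.eval-subs (liftSub θ) (true ▹ none) P)
    (Guarding.eval-cong
      (λ { zero → refl
         ; (suc x) → trans (Guarding.eval-rename suc (true ▹ none) (θ x))
                           (unguarded-none (λ _ → refl) (θ x)) }) P)

  Guarded-liftSub : ∀ {m n} {θ : Fin m → Proto n} →
                    (∀ x → Guarded (θ x)) → ∀ x → Guarded (liftSub θ x)
  Guarded-liftSub h zero    = tt
  Guarded-liftSub {θ = θ} h (suc x) = subst id (sym (Guarded-rename suc (θ x))) (h x)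

  Guarded-subs : ∀ {m n} {θ : Fin m → Proto n} → (∀ x → Guarded (θ x)) →
                 ∀ P → Guarded P → Guarded (subs θ P)
  Guarded-subs h 𝟎         g       = tt
  Guarded-subs h (P ∣ Q)   (g , k) = Guarded-subs h P g , Guarded-subs h Q k
  Guarded-subs h (rec P)   (g , k) =
    trans (unguarded-liftSub _ P) g , Guarded-subs (Guarded-liftSub h) P k
  Guarded-subs h (var x)   g       = h x
  Guarded-subs h (sum (act f d o i P)) g = Guarded-subs h P g
  Guarded-subs h (sum (S ⊕ T)) (g , k) = Guarded-subs h (sum S) g , Guarded-subs h (sum T) k
  Guarded-subs h (⦅ j ⦆ P) g       = Guarded-subs h P g

  Guarded-subs⁻ : ∀ {m n} {θ : Fin m → Proto n} P → Guarded (subs θ P) → Guarded P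
  Guarded-subs⁻ 𝟎         g       = tt
  Guarded-subs⁻ (P ∣ Q)   (g , k) = Guarded-subs⁻ P g , Guarded-subs⁻ Q k
  Guarded-subs⁻ (rec P)   (g , k) =
    trans (sym (unguarded-liftSub _ P)) g , Guarded-subs⁻ P k
  Guarded-subs⁻ (var x)   g       = tt
  Guarded-subs⁻ (sum (act f d o i P)) g = Guarded-subs⁻ P g
  Guarded-subs⁻ (sum (S ⊕ T)) (g , k) = Guarded-subs⁻ (sum S) g , Guarded-subs⁻ (sum T) k
  Guarded-subs⁻ (⦅ j ⦆ P) g       = Guarded-subs⁻ P g

  -- Guardedness passes to subterms, and the path to an unguarded occurrence ends at the protocol
  -- put in for the variable. Used to fold a recursion.
  Guarded-argument : ∀ {m n} {θ : Fin m → Proto n} {χ : Fin m → Bool} P →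
                     Guarded (subs θ P) → unguarded χ P ≡ true →
                     ∃[ x ] (χ x ≡ true × Guarded (θ x))
  Guarded-argument {χ = χ} (P ∣ Q) (g , k) e with unguarded χ P in e₁
  ... | true  = Guarded-argument P g e₁
  ... | false = Guarded-argument Q k e
  Guarded-argument {θ = θ} (rec P) (g , k) e with Guarded-argument P k e
  ... | suc x , e′ , g′ = x , e′ , subst id (Guarded-rename suc (θ x)) g′
  Guarded-argument (var x) g e = x , e , g
  Guarded-argument (⦅ j ⦆ P) g e = Guarded-argument P g e

  Guarded-≋ : ∀ {n} {P Q : Proto n} → P ≋ Q → Guarded P ⇔ Guarded Q
  Guarded-≋ ≋-refl = mk⇔ id id
  Guarded-≋ (≋-sym p) = ⇔-sym (Guarded-≋ p)
  Guarded-≋ (≋-trans p q) = ⇔-trans (Guarded-≋ p) (Guarded-≋ q)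
  Guarded-≋ (∣-cong p q) = Guarded-≋ p ×-⇔ Guarded-≋ q
  Guarded-≋ (rec-cong p) = mk⇔ (trans (sym e)) (trans e) ×-⇔ Guarded-≋ p
    where e = unguarded-≋ (true ▹ none) p
  Guarded-≋ (⦅⦆-cong p) = Guarded-≋ p
  Guarded-≋ (act-cong p) = Guarded-≋ p
  Guarded-≋ (⊕-cong p q) = Guarded-≋ p ×-⇔ Guarded-≋ q
  Guarded-≋ ∣-assoc = mk⇔ (λ { ((a , b) , c) → a , b , c }) (λ { (a , b , c) → (a , b) , c })
  Guarded-≋ ∣-comm = mk⇔ swap swap
  Guarded-≋ ⊕-assoc = mk⇔ (λ { ((a , b) , c) → a , b , c }) (λ { (a , b , c) → (a , b) , c })
  Guarded-≋ ⊕-comm = mk⇔ swap swap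
  Guarded-≋ ∣-identity = mk⇔ proj₁ (_, tt)
  Guarded-≋ (unfold {P}) = mk⇔
    (λ g → Guarded-subs (λ { zero → g ; (suc x) → tt }) P (proj₂ g)) fold
    where
    fold : Guarded (P [ rec P ]) → Guarded (rec P)
    fold g with unguarded (true ▹ none) P in e
    ... | false = refl , Guarded-subs⁻ P g
    -- If the variable were unguarded, `P [ rec P ]` would contain `rec P` itself outside actions,
    -- and guardedness of that copy refutes the assumption.
    ... | true with Guarded-argument {θ = single (rec P)} P g e
    ...   | zero , _ , e′ , k = ⊥-elim (false≢true (trans (sym e′) e))
  Guarded-≋ ⦅⦆-∣ = mk⇔ id id
  Guarded-≋ ⦅⦆-swap = mk⇔ id id
  Guarded-≋ ⦅⦆-𝟎 = mk⇔ id id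

  -- Definitions up to congruence

  Def-commutativeMonoid : CommutativeMonoid _ _
  Def-commutativeMonoid = record
    { Carrier = Def ; _≈_ = _≋ᵈ_ ; _∙_ = _∣_ ; ε = 𝟎
    ; isCommutativeMonoid = record
      { isMonoid = record
        { isSemigroup = record
          { isMagma = record
            { isEquivalence = record { refl = ≋-refl ; sym = ≋-sym ; trans = ≋-trans }
            ; ∙-cong = ∣-cong }
          ; assoc = λ _ _ _ → ∣-assoc }
        ; identity = (λ _ → ≋-trans ∣-comm ∣-identity) , (λ _ → ∣-identity) }
      ; comm = λ _ _ → ∣-comm } }

  module Solver = Algebra.Solver.CommutativeMonoid Def-commutativeMonoid
  open Solver using (solve; _⊜_) renaming (_⊕_ to _∙_; id to ε)

  ≡⇒≋ᵈ : ∀ {D E : Def} → D ≡ E → D ≋ᵈ E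
  ≡⇒≋ᵈ refl = ≋-refl

  -- Receptions of a definition

  data Hears : Def → Cond → Label → Dir → Reaction → Set where
    here : ∀ {c f d R} → Hears (recv c f d R) c f d R
    ∣ˡ   : ∀ {D E c f d R} → Hears D c f d R → Hears (D ∣ E) c f d R
    ∣ʳ   : ∀ {D E c f d R} → Hears E c f d R → Hears (D ∣ E) c f d R

  infix 4 _⊑_
  -- Inclusion of sets of receptions: copies are not counted, in accordance with `recv-idem`, and
  -- reactions are compared up to congruence, in accordance with `recv-cong`.
  _⊑_ : Def → Def → Set
  D ⊑ E = ∀ {c f d R} → Hears D c f d R →
          ∃[ R′ ] (Hears E c f d R′ × ⌈ R ⌉ ≋ᵈ ⌈ R′ ⌉)

  ⊑-refl : ∀ {D} → D ⊑ D
  ⊑-refl h = _ , h , ≋-refl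

  ⊑-trans : ∀ {D E F} → D ⊑ E → E ⊑ F → D ⊑ F
  ⊑-trans p q h with p h
  ... | _ , h₁ , e₁ with q h₁
  ...   | _ , h₂ , e₂ = _ , h₂ , ≋-trans e₁ e₂

  ∣-⊑ : ∀ {D E F} → D ⊑ F → E ⊑ F → D ∣ E ⊑ F
  ∣-⊑ p q (∣ˡ h) = p h
  ∣-⊑ p q (∣ʳ h) = q h

  ⊑-∣ˡ : ∀ {D E F} → D ⊑ E → D ⊑ E ∣ F
  ⊑-∣ˡ p h with p h
  ... | _ , h′ , e = _ , ∣ˡ h′ , e

  ⊑-∣ʳ : ∀ {D E F} → D ⊑ F → D ⊑ E ∣ F
  ⊑-∣ʳ p h with p h
  ... | _ , h′ , e = _ , ∣ʳ h′ , e

  ∣-mono-⊑ : ∀ {D D′ E E′} → D ⊑ D′ → E ⊑ E′ → D ∣ E ⊑ D′ ∣ E′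
  ∣-mono-⊑ p q = ∣-⊑ (⊑-∣ˡ p) (⊑-∣ʳ q)

  -- Both inclusions are proved together so that `≋-sym` merely swaps them.
  ≋⇒⊑ : ∀ {D E} → D ≋ᵈ E → D ⊑ E × E ⊑ D
  ≋⇒⊑ ≋-refl = ⊑-refl , ⊑-refl
  ≋⇒⊑ (≋-sym p) = swap (≋⇒⊑ p)
  ≋⇒⊑ (≋-trans p q) =
    ⊑-trans (proj₁ (≋⇒⊑ p)) (proj₁ (≋⇒⊑ q)) , ⊑-trans (proj₂ (≋⇒⊑ q)) (proj₂ (≋⇒⊑ p))
  ≋⇒⊑ (∣-cong p q) =
    ∣-mono-⊑ (proj₁ (≋⇒⊑ p)) (proj₁ (≋⇒⊑ q)) , ∣-mono-⊑ (proj₂ (≋⇒⊑ p)) (proj₂ (≋⇒⊑ q))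
  ≋⇒⊑ (recv-cong e) = (λ { here → _ , here , e }) , λ { here → _ , here , ≋-sym e }
  ≋⇒⊑ (⊕-cong p q) = (λ ()) , λ ()
  ≋⇒⊑ ∣-assoc =
    ∣-⊑ (∣-⊑ (⊑-∣ˡ ⊑-refl) (⊑-∣ʳ (⊑-∣ˡ ⊑-refl))) (⊑-∣ʳ (⊑-∣ʳ ⊑-refl)) ,
    ∣-⊑ (⊑-∣ˡ (⊑-∣ˡ ⊑-refl)) (∣-⊑ (⊑-∣ˡ (⊑-∣ʳ ⊑-refl)) (⊑-∣ʳ ⊑-refl))
  ≋⇒⊑ ∣-comm = ∣-⊑ (⊑-∣ʳ ⊑-refl) (⊑-∣ˡ ⊑-refl) , ∣-⊑ (⊑-∣ʳ ⊑-refl) (⊑-∣ˡ ⊑-refl)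
  ≋⇒⊑ ⊕-assoc = (λ ()) , λ ()
  ≋⇒⊑ ⊕-comm = (λ ()) , λ ()
  ≋⇒⊑ ∣-identity = ∣-⊑ ⊑-refl (λ ()) , ⊑-∣ˡ ⊑-refl
  ≋⇒⊑ recv-idem = ∣-⊑ ⊑-refl ⊑-refl , ⊑-∣ˡ ⊑-refl

  data Receivers : Def → Set where
    recv : ∀ {c f d R} → Receivers (recv c f d R)
    𝟎    : Receivers 𝟎
    _∣_  : ∀ {D E} → Receivers D → Receivers E → Receivers (D ∣ E)

  absorb : ∀ {D c f d R} → Hears D c f d R → D ∣ recv c f d R ≋ᵈ D
  absorb here = recv-idem
  absorb (∣ˡ h) = ≋-trans (solve 3 (λ a b c → (a ∙ b) ∙ c ⊜ (a ∙ c) ∙ b) ≋-refl _ _ _)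
                          (∣-cong (absorb h) ≋-refl)
  absorb (∣ʳ h) = ≋-trans ∣-assoc (∣-cong ≋-refl (absorb h))

  absorbs : ∀ {D E} → Receivers D → D ⊑ E → E ∣ D ≋ᵈ E
  absorbs recv p with p here
  ... | _ , h , e = ≋-trans (∣-cong ≋-refl (recv-cong e)) (absorb h)
  absorbs 𝟎 p = ∣-identity
  absorbs (r ∣ s) p = ≋-trans (≋-sym ∣-assoc)
    (≋-trans (∣-cong (absorbs r (p ∘ ∣ˡ)) ≋-refl) (absorbs s (p ∘ ∣ʳ)))

  -- Each side absorbs the other by idempotence, so both are congruent to `D ∣ E`.
  ⊑-antisym : ∀ {D E} → Receivers D → Receivers E → D ⊑ E → E ⊑ D → D ≋ᵈ E
  ⊑-antisym r s p q = ≋-trans (≋-sym (absorbs s q)) (≋-trans ∣-comm (absorbs r p))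

  -- Transitions of congruent definitions

  Outputs : Def → Cond → Label → Dir → Def → Set
  Outputs D c f d E = ∃[ E′ ] ((D —⟨ output c f d ⟩→ E′) × E′ ≋ᵈ E)

  Simulates : Def → Def → Set
  Simulates D E = ∀ {c f d D′} → D —⟨ output c f d ⟩→ D′ → Outputs E c f d D′

  simulates-trans : ∀ {D E F} → Simulates D E → Simulates E F → Simulates D F
  simulates-trans p q t with p t
  ... | _ , t₁ , e₁ with q t₁
  ...   | _ , t₂ , e₂ = _ , t₂ , ≋-trans e₂ e₁

  simulates-∣ : ∀ {D D′ E E′} → D ≋ᵈ D′ → E ≋ᵈ E′ →
                Simulates D D′ → Simulates E E′ → Simulates (D ∣ E) (D′ ∣ E′)
  simulates-∣ e k p q (∣ˡ t) with p t
  ... | _ , t′ , e′ = _ , ∣ˡ t′ , ∣-cong e′ (≋-sym k)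
  simulates-∣ e k p q (∣ʳ t) with q t
  ... | _ , t′ , e′ = _ , ∣ʳ t′ , ∣-cong (≋-sym e) e′

  simulates-⊕ : ∀ {A A′ B B′} →
                Simulates (choice A) (choice A′) → Simulates (choice B) (choice B′) →
                Simulates (choice (A ⊕ B)) (choice (A′ ⊕ B′))
  simulates-⊕ p q (⊕ˡ t) with p t
  ... | _ , t′ , e′ = _ , ⊕ˡ t′ , e′
  simulates-⊕ p q (⊕ʳ t) with q t
  ... | _ , t′ , e′ = _ , ⊕ʳ t′ , e′

  -- Receptions have no outputs, so `recv-cong` and `recv-idem` hold vacuously. Inputs are handled
  -- through `Hears` instead.
  ≋⇒simulates : ∀ {D E} → D ≋ᵈ E → Simulates D E × Simulates E D
  ≋⇒simulates ≋-refl = (λ t → _ , t , ≋-refl) , λ t → _ , t , ≋-refl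
  ≋⇒simulates (≋-sym p) = swap (≋⇒simulates p)
  ≋⇒simulates (≋-trans p q) with ≋⇒simulates p | ≋⇒simulates q
  ... | p₁ , p₂ | q₁ , q₂ = simulates-trans p₁ q₁ , simulates-trans q₂ p₂
  ≋⇒simulates (∣-cong p q) with ≋⇒simulates p | ≋⇒simulates q
  ... | p₁ , p₂ | q₁ , q₂ =
    simulates-∣ p q p₁ q₁ , simulates-∣ (≋-sym p) (≋-sym q) p₂ q₂
  ≋⇒simulates (recv-cong _) = (λ ()) , λ ()
  ≋⇒simulates (⊕-cong p q) with ≋⇒simulates p | ≋⇒simulates q
  ... | p₁ , p₂ | q₁ , q₂ = simulates-⊕ p₁ q₁ , simulates-⊕ p₂ q₂
  ≋⇒simulates ∣-assoc =
    (λ { (∣ˡ (∣ˡ t)) → _ , ∣ˡ t , ≋-sym ∣-assoc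
       ; (∣ˡ (∣ʳ t)) → _ , ∣ʳ (∣ˡ t) , ≋-sym ∣-assoc
       ; (∣ʳ t)      → _ , ∣ʳ (∣ʳ t) , ≋-sym ∣-assoc }) ,
    (λ { (∣ˡ t)      → _ , ∣ˡ (∣ˡ t) , ∣-assoc
       ; (∣ʳ (∣ˡ t)) → _ , ∣ˡ (∣ʳ t) , ∣-assoc
       ; (∣ʳ (∣ʳ t)) → _ , ∣ʳ t , ∣-assoc })
  ≋⇒simulates ∣-comm =
    (λ { (∣ˡ t) → _ , ∣ʳ t , ∣-comm ; (∣ʳ t) → _ , ∣ˡ t , ∣-comm }) ,
    (λ { (∣ˡ t) → _ , ∣ʳ t , ∣-comm ; (∣ʳ t) → _ , ∣ˡ t , ∣-comm })
  ≋⇒simulates ⊕-assoc =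
    (λ { (⊕ˡ (⊕ˡ t)) → _ , ⊕ˡ t , ≋-refl
       ; (⊕ˡ (⊕ʳ t)) → _ , ⊕ʳ (⊕ˡ t) , ≋-refl
       ; (⊕ʳ t)      → _ , ⊕ʳ (⊕ʳ t) , ≋-refl }) ,
    (λ { (⊕ˡ t)      → _ , ⊕ˡ (⊕ˡ t) , ≋-refl
       ; (⊕ʳ (⊕ˡ t)) → _ , ⊕ˡ (⊕ʳ t) , ≋-refl
       ; (⊕ʳ (⊕ʳ t)) → _ , ⊕ʳ t , ≋-refl })
  ≋⇒simulates ⊕-comm =
    (λ { (⊕ˡ t) → _ , ⊕ʳ t , ≋-refl ; (⊕ʳ t) → _ , ⊕ˡ t , ≋-refl }) ,
    (λ { (⊕ˡ t) → _ , ⊕ʳ t , ≋-refl ; (⊕ʳ t) → _ , ⊕ˡ t , ≋-refl })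
  ≋⇒simulates ∣-identity =
    (λ { (∣ˡ t) → _ , t , ≋-sym ∣-identity }) , (λ t → _ , ∣ˡ t , ∣-identity)
  ≋⇒simulates recv-idem = (λ { (∣ˡ ()) ; (∣ʳ ()) }) , λ ()

  simulate : ∀ {D E} → D ≋ᵈ E → Simulates D E
  simulate e = proj₁ (≋⇒simulates e)

  choice-only-outputs : ∀ {A α D} → choice A —⟨ α ⟩→ D →
                        ∃[ c ] ∃[ f ] ∃[ d ] α ≡ output c f d
  choice-only-outputs send   = _ , _ , _ , refl
  choice-only-outputs (⊕ˡ t) = choice-only-outputs t
  choice-only-outputs (⊕ʳ t) = choice-only-outputs t

  -- Receptions persist: an input leaves the definition intact and only adds the reaction.
  hears⁺ : ∀ {D c f d R} → Hears D c f d R →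
           ∃[ D′ ] ((D —⟨ input c f d ⟩→ D′) × D′ ≋ᵈ D ∣ ⌈ R ⌉)
  hears⁺ here = _ , recv , ∣-comm
  hears⁺ (∣ˡ h) with hears⁺ h
  ... | _ , t , e = _ , ∣ˡ t ,
    ≋-trans (∣-cong e ≋-refl) (solve 3 (λ a b c → (a ∙ c) ∙ b ⊜ (a ∙ b) ∙ c) ≋-refl _ _ _)
  hears⁺ (∣ʳ h) with hears⁺ h
  ... | _ , t , e = _ , ∣ʳ t , ≋-trans (∣-cong ≋-refl e) (≋-sym ∣-assoc)

  hears⁻ : ∀ {D c f d D′} → D —⟨ input c f d ⟩→ D′ →
           ∃[ R ] (Hears D c f d R × D′ ≋ᵈ D ∣ ⌈ R ⌉)
  hears⁻ recv = _ , here , ∣-comm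
  hears⁻ (⊕ˡ t) with choice-only-outputs t
  ... | _ , _ , _ , ()
  hears⁻ (⊕ʳ t) with choice-only-outputs t
  ... | _ , _ , _ , ()
  hears⁻ (∣ˡ t) with hears⁻ t
  ... | _ , h , e = _ , ∣ˡ h ,
    ≋-trans (∣-cong e ≋-refl) (solve 3 (λ a b c → (a ∙ c) ∙ b ⊜ (a ∙ b) ∙ c) ≋-refl _ _ _)
  hears⁻ (∣ʳ t) with hears⁻ t
  ... | _ , h , e = _ , ∣ʳ h , ≋-trans (∣-cong ≋-refl e) (≋-sym ∣-assoc)

  -- A projected node has `Receivers` on its left and `Senders` on its right, so the kind of a
  -- transition reveals which side makes it.
  data Senders : Def → Set where
    choice : ∀ {A} → Senders (choice A)
    𝟎      : Senders 𝟎
    _∣_    : ∀ {D E} → Senders D → Senders E → Senders (D ∣ E)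

  ⌈⌉-senders : ∀ R → Senders ⌈ R ⌉
  ⌈⌉-senders (choice A) = choice
  ⌈⌉-senders 𝟎          = 𝟎
  ⌈⌉-senders (R ∣ R′)   = ⌈⌉-senders R ∣ ⌈⌉-senders R′

  senders-only-output : ∀ {D α D′} → Senders D → D —⟨ α ⟩→ D′ →
                        ∃[ c ] ∃[ f ] ∃[ d ] α ≡ output c f d
  senders-only-output choice t = choice-only-outputs t
  senders-only-output (s ∣ _) (∣ˡ t) = senders-only-output s t
  senders-only-output (_ ∣ s) (∣ʳ t) = senders-only-output s t
  senders-only-output (_ ∣ s) (syncˡ _ t) with senders-only-output s t
  ... | _ , _ , _ , ()
  senders-only-output (s ∣ _) (syncʳ t _) with senders-only-output s t
  ... | _ , _ , _ , ()

  receivers-only-input : ∀ {D α D′} → Receivers D → D —⟨ α ⟩→ D′ →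
                         ∃[ c ] ∃[ f ] ∃[ d ] α ≡ input c f d
  receivers-only-input recv recv = _ , _ , _ , refl
  receivers-only-input (r ∣ _) (∣ˡ t) = receivers-only-input r t
  receivers-only-input (_ ∣ r) (∣ʳ t) = receivers-only-input r t
  receivers-only-input (r ∣ _) (syncˡ t _) with receivers-only-input r t
  ... | _ , _ , _ , ()
  receivers-only-input (_ ∣ r) (syncʳ _ t) with receivers-only-input r t
  ... | _ , _ , _ , ()

  -- The meaning of a protocol

  record Meaning (A : Set) : Set where
    constructor ⟨_,_,_⟩
    field
      bang  : A
      hears : Def
      sends : Id → Def

  open Meaning

  -- The value of a recursion variable: in agreement with `var-≢!` it contributes reactions only.
  blank : Reaction → Meaning Reaction
  blank R = ⟨ R , 𝟎 , (λ _ → 𝟎) ⟩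

  enable : Id → Id → Def → Reaction → Def
  enable j k D R with j ≟ k
  ... | yes _ = D ∣ ⌈ R ⌉
  ... | no _  = D

  Semantics : Algebra
  Semantics = record
    { Proc = Meaning Reaction ; Choices = Meaning Choice
    ; nil = blank 𝟎
    ; par = λ a b → ⟨ bang a ∣ bang b , hears a ∣ hears b , (λ k → sends a k ∣ sends b k) ⟩
    -- The value at 𝟎 suffices to compute bang of a guarded recursion.
    ; fix = λ F → F (blank (bang (F (blank 𝟎))))
    ; total = λ a → ⟨ choice (bang a) , hears a , sends a ⟩
    ; grant = λ j a → ⟨ bang a , hears a , (λ k → enable j k (sends a k) (bang a)) ⟩
    ; pre = λ f d o i a → ⟨ send o f d , recv i f d (bang a) ∣ hears a , sends a ⟩
    ; plus = λ a b → ⟨ bang a ⊕ bang b , hears a ∣ hears b , (λ k → sends a k ∣ sends b k) ⟩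
    ; fix-cong = λ {F} e → trans (cong (F ∘ blank ∘ bang) (e (blank 𝟎))) (e _) }

  module Semantic = Eval Semantics
  open Semantic using (eval; evalˢ)

  Valuation : ℕ → Set
  Valuation n = Fin n → Meaning Reaction

  -- Dependence of meanings on the values of variables

  infix 4 _≈ᵇ_
  _≈ᵇ_ : Meaning Reaction → Meaning Reaction → Set
  a ≈ᵇ b = ⌈ bang a ⌉ ≋ᵈ ⌈ bang b ⌉

  -- `bang` of an action does not look at the continuation, so the values of guarded variables are
  -- irrelevant.
  bang-cong-guarded : ∀ {n} {χ : Fin n → Bool} {φ ψ : Valuation n} P →
                      unguarded χ P ≡ false →
                      (∀ x → χ x ≡ true ⊎ φ x ≈ᵇ ψ x) → eval φ P ≈ᵇ eval ψ P
  bang-cong-guarded 𝟎 g h = ≋-refl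
  bang-cong-guarded {χ = χ} (P ∣ Q) g h =
    ∣-cong (bang-cong-guarded P (∨-conicalˡ (unguarded χ P) _ g) h)
           (bang-cong-guarded Q (∨-conicalʳ (unguarded χ P) _ g) h)
  bang-cong-guarded (rec P) g h = bang-cong-guarded P g
    -- The bound variable is itself valued by `bang` of the body at `𝟎`, so the induction hypothesis
    -- is used once to compare these values and once for the body.
    λ { zero → inj₂ (bang-cong-guarded P g λ { zero → inj₂ ≋-refl ; (suc x) → h x })
      ; (suc x) → h x }
  bang-cong-guarded (var x) g h with h x
  ... | inj₂ e = e
  ... | inj₁ e = ⊥-elim (false≢true (trans (sym g) e))
  bang-cong-guarded (sum S) g h = ≡⇒≋ᵈ (cong choice (bangˢ S))
    where
    -- The two placeholders stand for `φ` and `ψ`.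
    bangˢ : ∀ S → bang (evalˢ _ S) ≡ bang (evalˢ _ S)
    bangˢ (act f d o i P) = refl
    bangˢ (S ⊕ T)         = cong₂ _⊕_ (bangˢ S) (bangˢ T)
  bang-cong-guarded (⦅ j ⦆ P) g h = bang-cong-guarded P g h

  bang-cong : ∀ {n} {φ ψ : Valuation n} P → (∀ x → φ x ≈ᵇ ψ x) → eval φ P ≈ᵇ eval ψ P
  bang-cong P h =
    bang-cong-guarded P (unguarded-none {χ = none} (λ _ → refl) P) (λ x → inj₂ (h x))

  bound-value : ∀ {n} → Valuation n → Proto (suc n) → Meaning Reaction
  bound-value φ P = blank (bang (eval (blank 𝟎 ▹ φ) P))

  bound-value-cong : ∀ {n} {φ ψ : Valuation n} P → (∀ x → φ x ≈ᵇ ψ x) →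
                     bound-value φ P ≈ᵇ bound-value ψ P
  bound-value-cong P h = bang-cong P λ { zero → ≋-refl ; (suc x) → h x }

  ▹-≈ᵇ : ∀ {n} {φ ψ : Valuation n} P → (∀ x → φ x ≈ᵇ ψ x) →
         ∀ x → (bound-value φ P ▹ φ) x ≈ᵇ (bound-value ψ P ▹ ψ) x
  ▹-≈ᵇ P h zero    = bound-value-cong P h
  ▹-≈ᵇ P h (suc x) = h x

  -- `Z` bounds what the variables may hear in addition. For an unfolding it is everything the
  -- recursion hears, so that the copy put in for the variable adds nothing new.
  hears-mono : ∀ {n} {φ ψ : Valuation n} {Z} P → (∀ x → φ x ≈ᵇ ψ x) →
               (∀ x → hears (φ x) ⊑ hears (ψ x) ∣ Z) →
               hears (eval φ P) ⊑ hears (eval ψ P) ∣ Z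
  hears-mono 𝟎 h k = λ ()
  hears-mono (P ∣ Q) h k =
    ∣-⊑ (⊑-trans (hears-mono P h k) (∣-mono-⊑ (⊑-∣ˡ ⊑-refl) ⊑-refl))
        (⊑-trans (hears-mono Q h k) (∣-mono-⊑ (⊑-∣ʳ ⊑-refl) ⊑-refl))
  hears-mono (rec P) h k =
    hears-mono P (▹-≈ᵇ P h) λ { zero → λ () ; (suc x) → k x }
  hears-mono (var x) h k = k x
  hears-mono (sum (act f d o i P)) h k =
    ∣-⊑ (λ { here → _ , ∣ˡ (∣ˡ here) , bang-cong P h })
        (⊑-trans (hears-mono P h k) (∣-mono-⊑ (⊑-∣ʳ ⊑-refl) ⊑-refl))
  hears-mono (sum (S ⊕ T)) h k =
    ∣-⊑ (⊑-trans (hears-mono (sum S) h k) (∣-mono-⊑ (⊑-∣ˡ ⊑-refl) ⊑-refl))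
        (⊑-trans (hears-mono (sum T) h k) (∣-mono-⊑ (⊑-∣ʳ ⊑-refl) ⊑-refl))
  hears-mono (⦅ j ⦆ P) h k = hears-mono P h k

  hears-receivers : ∀ {n} {φ : Valuation n} → (∀ x → Receivers (hears (φ x))) →
                    ∀ P → Receivers (hears (eval φ P))
  hears-receivers h 𝟎         = 𝟎
  hears-receivers h (P ∣ Q)   = hears-receivers h P ∣ hears-receivers h Q
  hears-receivers h (rec P)   = hears-receivers (λ { zero → 𝟎 ; (suc x) → h x }) P
  hears-receivers h (var x)   = h x
  hears-receivers h (sum (act f d o i P)) = recv ∣ hears-receivers h P
  hears-receivers h (sum (S ⊕ T)) = hears-receivers h (sum S) ∣ hears-receivers h (sum T)
  hears-receivers h (⦅ j ⦆ P) = hears-receivers h P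

  enable-cong : ∀ j k {D E R R′} → D ≋ᵈ E → ⌈ R ⌉ ≋ᵈ ⌈ R′ ⌉ →
                enable j k D R ≋ᵈ enable j k E R′
  enable-cong j k e e′ with j ≟ k
  ... | yes _ = ∣-cong e e′
  ... | no _  = e

  -- A variable of grade 3 does not occur in `P`, so nothing is asked of what it sends.
  sends-cong : ∀ {n γ} {φ ψ : Valuation n} {k} P → grade γ P < 3 →
               (∀ x → φ x ≈ᵇ ψ x) →
               (∀ x → sends (φ x) k ≋ᵈ sends (ψ x) k ⊎ 3 ≤ γ x) →
               sends (eval φ P) k ≋ᵈ sends (eval ψ P) k
  sends-cong 𝟎 p h e = ≋-refl
  sends-cong {γ = γ} (P ∣ Q) p h e =
    ∣-cong (sends-cong P (⊔-<ˡ (grade γ P) _ p) h e)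
           (sends-cong Q (⊔-<ʳ (grade γ P) _ p) h e)
  sends-cong (rec P) p h e with grade-rec P p
  ... | inj₁ (q , _) = sends-cong P q (▹-≈ᵇ P h) λ { zero → inj₁ ≋-refl ; (suc x) → e x }
  ... | inj₂ q       = sends-cong P q (▹-≈ᵇ P h) λ { zero → inj₁ ≋-refl ; (suc x) → e x }
  sends-cong (var x) p h e with e x
  ... | inj₁ q = q
  ... | inj₂ q = <⇒≱-elim p q
  sends-cong {γ = γ} (sum (act f d o i P)) p h e = sends-cong P (⊔-<ʳ 1 (grade γ P) p) h e
  sends-cong {γ = γ} (sum (S ⊕ T)) p h e =
    ∣-cong (sends-cong (sum S) (⊔-<ˡ (grade γ (sum S)) _ p) h e)
           (sends-cong (sum T) (⊔-<ʳ (grade γ (sum S)) _ p) h e)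
  sends-cong {γ = γ} {k = k} (⦅ j ⦆ P) p h e =
    enable-cong j k (sends-cong P (boost-inv (grade γ P) p) h e) (bang-cong P h)

  -- Variables count as live, so that a protocol of grade 0 contains none.
  Positive : ∀ {n} → (Fin n → ℕ) → Set
  Positive γ = ∀ x → 1 ≤ γ x

  ▹-positive : ∀ {n m} {γ : Fin n → ℕ} → Positive γ → Positive (suc m ▹ γ)
  ▹-positive p zero    = s≤s z≤n
  ▹-positive p (suc x) = p x

  𝟎∣𝟎 : ∀ {D E} → D ≋ᵈ 𝟎 → E ≋ᵈ 𝟎 → D ∣ E ≋ᵈ 𝟎
  𝟎∣𝟎 p q = ≋-trans (∣-cong p q) ∣-identity

  dead-bang : ∀ {n γ} {φ : Valuation n} → Positive γ → ∀ P → grade γ P < 1 →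
              ⌈ bang (eval φ P) ⌉ ≋ᵈ 𝟎
  dead-bang pos 𝟎 p = ≋-refl
  dead-bang {γ = γ} pos (P ∣ Q) p =
    𝟎∣𝟎 (dead-bang pos P (⊔-<ˡ (grade γ P) _ p)) (dead-bang pos Q (⊔-<ʳ (grade γ P) _ p))
  dead-bang pos (rec P) p with grade-rec P p
  ... | inj₁ (q , _) = dead-bang (▹-positive pos) P q
  ... | inj₂ q       = dead-bang (▹-positive pos) P q
  dead-bang pos (var x) p = <⇒≱-elim p (pos x)
  dead-bang {γ = γ} pos (sum S) p = <⇒≱-elim p (positiveˢ S)
    where
    positiveˢ : ∀ S → 1 ≤ grade γ (sum S)
    positiveˢ (act f d o i P) = m≤m⊔n 1 (grade γ P)
    positiveˢ (S ⊕ T)         = ≤-trans (positiveˢ S) (m≤m⊔n _ _)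
  dead-bang {γ = γ} pos (⦅ j ⦆ P) p = dead-bang pos P (boost-inv (grade γ P) p)

  -- Below grade 2 every active node sits on a dead part, whose reactions vanish by `dead-bang`.
  quiet-sends : ∀ {n γ} {φ : Valuation n} {k} → Positive γ →
                (∀ x → sends (φ x) k ≋ᵈ 𝟎) → ∀ P → grade γ P < 2 →
                sends (eval φ P) k ≋ᵈ 𝟎
  quiet-sends pos h 𝟎 p = ≋-refl
  quiet-sends {γ = γ} pos h (P ∣ Q) p =
    𝟎∣𝟎 (quiet-sends pos h P (⊔-<ˡ (grade γ P) _ p))
        (quiet-sends pos h Q (⊔-<ʳ (grade γ P) _ p))
  quiet-sends pos h (rec P) p with grade-rec P p
  ... | inj₁ (q , _) =
    quiet-sends (▹-positive pos) (λ { zero → ≋-refl ; (suc x) → h x }) P q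
  ... | inj₂ q =
    quiet-sends (▹-positive pos) (λ { zero → ≋-refl ; (suc x) → h x }) P q
  quiet-sends pos h (var x) p = h x
  quiet-sends {γ = γ} pos h (sum (act f d o i P)) p =
    quiet-sends pos h P (⊔-<ʳ 1 (grade γ P) p)
  quiet-sends {γ = γ} pos h (sum (S ⊕ T)) p =
    𝟎∣𝟎 (quiet-sends pos h (sum S) (⊔-<ˡ (grade γ (sum S)) _ p))
        (quiet-sends pos h (sum T) (⊔-<ʳ (grade γ (sum S)) _ p))
  quiet-sends {γ = γ} {k = k} pos h (⦅ j ⦆ P) p with j ≟ k
  ... | yes _ = 𝟎∣𝟎 (quiet-sends pos h P (boost-inv (grade γ P) p))
                    (dead-bang pos P (boost-dead (grade γ P) p))
  ... | no _  = quiet-sends pos h P (boost-inv (grade γ P) p)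

  -- Invariance of meanings under structural congruence

  infix 4 _≈ᵐ_
  record _≈ᵐ_ (a b : Meaning Reaction) : Set where
    constructor ⟨_,_,_⟩
    field
      bang≋  : a ≈ᵇ b
      hears≋ : hears a ≋ᵈ hears b
      sends≋ : ∀ k → sends a k ≋ᵈ sends b k

  open _≈ᵐ_

  ≈ᵐ-refl : ∀ {a} → a ≈ᵐ a
  ≈ᵐ-refl = ⟨ ≋-refl , ≋-refl , (λ _ → ≋-refl) ⟩

  ≈ᵐ-sym : ∀ {a b} → a ≈ᵐ b → b ≈ᵐ a
  ≈ᵐ-sym e = ⟨ ≋-sym (bang≋ e) , ≋-sym (hears≋ e) , (λ k → ≋-sym (sends≋ e k)) ⟩

  ≈ᵐ-trans : ∀ {a b c} → a ≈ᵐ b → b ≈ᵐ c → a ≈ᵐ c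
  ≈ᵐ-trans e e′ = ⟨ ≋-trans (bang≋ e) (bang≋ e′) , ≋-trans (hears≋ e) (hears≋ e′)
                  , (λ k → ≋-trans (sends≋ e k) (sends≋ e′ k)) ⟩

  Blank : ∀ {n} → Valuation n → Set
  Blank φ = ∀ x → φ x ≡ blank (bang (φ x))

  ▹-blank : ∀ {n R} {φ : Valuation n} → Blank φ → Blank (blank R ▹ φ)
  ▹-blank b zero    = refl
  ▹-blank b (suc x) = b x

  blank-hears : ∀ {n} {φ : Valuation n} → Blank φ → ∀ x {D} → hears (φ x) ⊑ D
  blank-hears b x rewrite b x = λ ()

  blank-receivers : ∀ {n} {φ : Valuation n} → Blank φ → ∀ x → Receivers (hears (φ x))
  blank-receivers b x rewrite b x = 𝟎

  blank-sends : ∀ {n} {φ : Valuation n} → Blank φ → ∀ x k → sends (φ x) k ≋ᵈ 𝟎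
  blank-sends b x k rewrite b x = ≋-refl

  eval-≈ᵐ : ∀ {n γ} {φ ψ : Valuation n} P → grade γ P < 3 → Blank φ → Blank ψ →
            (∀ x → φ x ≈ᵇ ψ x) → eval φ P ≈ᵐ eval ψ P
  eval-≈ᵐ P p b b′ h =
    ⟨ bang-cong P h
    , ⊑-antisym (hears-receivers (blank-receivers b) P) (hears-receivers (blank-receivers b′) P)
        (⊑-trans (hears-mono {Z = 𝟎} P h (λ x → blank-hears b x)) (∣-⊑ ⊑-refl λ ()))
        (⊑-trans (hears-mono {Z = 𝟎} P (λ x → ≋-sym (h x)) (λ x → blank-hears b′ x)) (∣-⊑ ⊑-refl λ ()))
    , (λ k → sends-cong P p h
        (λ x → inj₁ (≋-trans (blank-sends b x k) (≋-sym (blank-sends b′ x k))))) ⟩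

  -- Both sides hear the same set of receptions, and what X receives is
  -- already received by its body.
  eval-unfold-≈ᵐ : ∀ {n γ} {φ : Valuation n} P → Positive γ → Blank φ →
                   Guarded (rec P) → grade γ (rec P) < 3 →
                   eval φ (P [ rec P ]) ≈ᵐ eval φ (rec P)
  eval-unfold-≈ᵐ {γ = γ} {φ} P pos b (g , _) p =
    subst (_≈ᵐ eval φ (rec P)) (sym (Semantic.eval-unfold φ P))
    ⟨ bang-cong P agree
    , ⊑-antisym
        (hears-receivers (λ { zero → hears-receivers (▹-receivers) P
                            ; (suc x) → blank-receivers b x }) P)
        (hears-receivers ▹-receivers P)
        (⊑-trans (hears-mono {Z = hears (eval φ (rec P))} P agree
                   λ { zero → ⊑-∣ʳ ⊑-refl ; (suc x) → blank-hears b x })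
                 (∣-⊑ ⊑-refl ⊑-refl))
        (⊑-trans (hears-mono {Z = 𝟎} P (≋-sym ∘ agree)
                   λ { zero → λ () ; (suc x) → blank-hears b x })
                 (∣-⊑ ⊑-refl λ ()))
    , sends-agree ⟩
    where
    ▹-receivers : ∀ x → Receivers (hears ((bound-value φ P ▹ φ) x))
    ▹-receivers = blank-receivers (▹-blank b)

    agree : ∀ x → (eval φ (rec P) ▹ φ) x ≈ᵇ (bound-value φ P ▹ φ) x
    -- The iteration from `𝟎` is stationary after one round, because the variable is guarded.
    agree zero = bang-cong-guarded P g λ { zero → inj₁ refl ; (suc x) → inj₂ ≋-refl }
    agree (suc x) = ≋-refl

    sends-agree : ∀ k → sends (eval (eval φ (rec P) ▹ φ) P) k ≋ᵈ sends (eval φ (rec P)) k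
    -- Either the copy put in for the variable sends nothing, just like the blank value, or the
    -- variable does not occur.
    sends-agree k with grade-rec {γ = γ} P p
    ... | inj₁ (q , r) = sends-cong P q agree
      λ { zero → inj₁ (quiet-sends (▹-positive pos)
            (λ { zero → ≋-refl ; (suc x) → blank-sends b x k }) P r)
        ; (suc x) → inj₁ ≋-refl }
    ... | inj₂ q = sends-cong P q agree
      λ { zero → inj₂ ≤-refl ; (suc x) → inj₁ ≋-refl }

  -- The lower bound is `Positive`; the upper one is what `grade-≋` asks for.
  Bounded : ∀ {n} → (Fin n → ℕ) → Set
  Bounded γ = ∀ x → 1 ≤ γ x × γ x ≤ 3

  ▹-bounded₁ : ∀ {n} {γ : Fin n → ℕ} → Bounded γ → Bounded (1 ▹ γ)
  ▹-bounded₁ b zero    = s≤s z≤n , s≤s z≤n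
  ▹-bounded₁ b (suc x) = b x

  ▹-bounded₃ : ∀ {n} {γ : Fin n → ℕ} → Bounded γ → Bounded (3 ▹ γ)
  ▹-bounded₃ b zero    = s≤s z≤n , ≤-refl
  ▹-bounded₃ b (suc x) = b x

  -- The assumptions concern `P` only; `Guarded-≋` and `grade-≋` carry them across `≋-sym` and to
  -- the middle of `≋-trans`.
  sound : ∀ {n γ} {φ : Valuation n} {P Q} → Bounded γ → Blank φ → P ≋ Q →
          Guarded P → grade γ P < 3 → eval φ P ≈ᵐ eval φ Q
  sound c b ≋-refl g p = ≈ᵐ-refl
  sound c b (≋-sym e) g p = ≈ᵐ-sym (sound c b e
    (Equivalence.from (Guarded-≋ e) g) (subst (_< 3) (sym (grade-≋ (proj₂ ∘ c) e)) p))
  sound c b (≋-trans e e′) g p = ≈ᵐ-trans (sound c b e g p) (sound c b e′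
    (Equivalence.to (Guarded-≋ e) g) (subst (_< 3) (grade-≋ (proj₂ ∘ c) e) p))
  sound {γ = γ} c b (∣-cong {P} e e′) (g , g′) p
    with sound c b e g (⊔-<ˡ (grade γ P) _ p) | sound c b e′ g′ (⊔-<ʳ (grade γ P) _ p)
  ... | s | s′ = ⟨ ∣-cong (bang≋ s) (bang≋ s′) , ∣-cong (hears≋ s) (hears≋ s′)
                 , (λ k → ∣-cong (sends≋ s k) (sends≋ s′ k)) ⟩
  sound {γ = γ} {φ} c b (rec-cong {P} {P′} e) (_ , g) p with grade-rec {γ = γ} P p
  -- The body is replaced under a fixed value of the variable; then that value, which depends on the
  -- body too, is replaced by means of `eval-≈ᵐ`.
  ... | inj₁ (q , _) = ≈ᵐ-trans (sound (▹-bounded₁ c) (▹-blank b) e g q)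
    (eval-≈ᵐ P′ (subst (_< 3) (grade-≋ (proj₂ ∘ ▹-bounded₁ c) e) q) (▹-blank b) (▹-blank b)
      λ { zero → bang≋ (sound (▹-bounded₁ c) (▹-blank b) e g q) ; (suc x) → ≋-refl })
  ... | inj₂ q = ≈ᵐ-trans (sound (▹-bounded₃ c) (▹-blank b) e g q)
    (eval-≈ᵐ P′ (subst (_< 3) (grade-≋ (proj₂ ∘ ▹-bounded₃ c) e) q) (▹-blank b) (▹-blank b)
      λ { zero → bang≋ (sound (▹-bounded₃ c) (▹-blank b) e g q) ; (suc x) → ≋-refl })
  sound {γ = γ} c b (⦅⦆-cong {j} {P} e) g p with sound c b e g (boost-inv (grade γ P) p)
  ... | s = ⟨ bang≋ s , hears≋ s , (λ k → enable-cong j k (sends≋ s k) (bang≋ s)) ⟩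
  sound {γ = γ} c b (act-cong {P = P} e) g p with sound c b e g (⊔-<ʳ 1 (grade γ P) p)
  ... | s = ⟨ ≋-refl , ∣-cong (recv-cong (bang≋ s)) (hears≋ s) , sends≋ s ⟩
  sound {γ = γ} c b (⊕-cong {S} e e′) (g , g′) p
    with sound c b e g (⊔-<ˡ (grade γ (sum S)) _ p) | sound c b e′ g′ (⊔-<ʳ (grade γ (sum S)) _ p)
  ... | s | s′ = ⟨ ⊕-cong (bang≋ s) (bang≋ s′) , ∣-cong (hears≋ s) (hears≋ s′)
                 , (λ k → ∣-cong (sends≋ s k) (sends≋ s′ k)) ⟩
  sound c b ∣-assoc g p = ⟨ ∣-assoc , ∣-assoc , (λ _ → ∣-assoc) ⟩
  sound c b ∣-comm g p = ⟨ ∣-comm , ∣-comm , (λ _ → ∣-comm) ⟩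
  sound c b ⊕-assoc g p = ⟨ ⊕-assoc , ∣-assoc , (λ _ → ∣-assoc) ⟩
  sound c b ⊕-comm g p = ⟨ ⊕-comm , ∣-comm , (λ _ → ∣-comm) ⟩
  sound c b ∣-identity g p = ⟨ ∣-identity , ∣-identity , (λ _ → ∣-identity) ⟩
  sound c b (unfold {P}) g p = ≈ᵐ-sym (eval-unfold-≈ᵐ P (proj₁ ∘ c) b g p)
  sound {φ = φ} c b (⦅⦆-∣ {j} {P} {Q}) g p =
    ⟨ ≋-refl , ≋-refl , (λ k → distribute k) ⟩
    where
    distribute : ∀ k → sends (eval φ (⦅ j ⦆ (P ∣ Q))) k ≋ᵈ sends (eval φ (⦅ j ⦆ P ∣ ⦅ j ⦆ Q)) k
    distribute k with j ≟ k
    ... | yes _ = solve 4 (λ a b c d → (a ∙ b) ∙ (c ∙ d) ⊜ (a ∙ c) ∙ (b ∙ d)) ≋-refl _ _ _ _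
    ... | no _  = ≋-refl
  sound {φ = φ} c b (⦅⦆-swap {j} {j′} {P}) g p =
    ⟨ ≋-refl , ≋-refl , (λ k → exchange k) ⟩
    where
    exchange : ∀ k → sends (eval φ (⦅ j ⦆ ⦅ j′ ⦆ P)) k ≋ᵈ sends (eval φ (⦅ j′ ⦆ ⦅ j ⦆ P)) k
    exchange k with j ≟ k | j′ ≟ k
    ... | yes _ | yes _ = ≋-refl
    ... | yes _ | no _  = ≋-refl
    ... | no _  | yes _ = ≋-refl
    ... | no _  | no _  = ≋-refl
  sound c b (⦅⦆-𝟎 {j}) g p = ⟨ ≋-refl , ≋-refl , (λ k → idle k) ⟩
    where
    idle : ∀ k → enable j k 𝟎 𝟎 ≋ᵈ 𝟎
    idle k with j ≟ k
    ... | yes _ = ∣-identity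
    ... | no _  = ≋-refl

  -- The projection of guarded protocols

  mutual
    rename-cong : ∀ {m n} {r r′ : Fin m → Fin n} → (∀ x → r x ≡ r′ x) →
                  ∀ P → rename r P ≡ rename r′ P
    rename-cong e 𝟎         = refl
    rename-cong e (P ∣ Q)   = cong₂ _∣_ (rename-cong e P) (rename-cong e Q)
    rename-cong e (rec P)   =
      cong rec (rename-cong (λ { zero → refl ; (suc x) → cong suc (e x) }) P)
    rename-cong e (var x)   = cong var (e x)
    rename-cong e (sum S)   = cong sum (renameˢ-cong e S)
    rename-cong e (⦅ j ⦆ P) = cong (⦅ j ⦆_) (rename-cong e P)

    renameˢ-cong : ∀ {m n} {r r′ : Fin m → Fin n} → (∀ x → r x ≡ r′ x) →
                   ∀ S → renameˢ r S ≡ renameˢ r′ S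
    renameˢ-cong e (act f d o i P) = cong (act f d o i) (rename-cong e P)
    renameˢ-cong e (S ⊕ T) = cong₂ _⊕_ (renameˢ-cong e S) (renameˢ-cong e T)

  mutual
    rename-∘ : ∀ {l m n} (r : Fin m → Fin n) (r′ : Fin l → Fin m) P →
               rename r (rename r′ P) ≡ rename (r ∘ r′) P
    rename-∘ r r′ 𝟎         = refl
    rename-∘ r r′ (P ∣ Q)   = cong₂ _∣_ (rename-∘ r r′ P) (rename-∘ r r′ Q)
    rename-∘ r r′ (rec P)   = cong rec (trans (rename-∘ (liftRen r) (liftRen r′) P)
      (rename-cong (λ { zero → refl ; (suc x) → refl }) P))
    rename-∘ r r′ (var x)   = refl
    rename-∘ r r′ (sum S)   = cong sum (renameˢ-∘ r r′ S)
    rename-∘ r r′ (⦅ j ⦆ P) = cong (⦅ j ⦆_) (rename-∘ r r′ P)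

    renameˢ-∘ : ∀ {l m n} (r : Fin m → Fin n) (r′ : Fin l → Fin m) S →
                renameˢ r (renameˢ r′ S) ≡ renameˢ (r ∘ r′) S
    renameˢ-∘ r r′ (act f d o i P) = cong (act f d o i) (rename-∘ r r′ P)
    renameˢ-∘ r r′ (S ⊕ T) = cong₂ _⊕_ (renameˢ-∘ r r′ S) (renameˢ-∘ r r′ T)

  lookup-rename : ∀ {m n} {r : Fin m → Fin n} {σ : Env m} {σ′ : Env n} P →
    (∀ x → lookup σ′ (r x) ≡ rename r (lookup σ x)) →
    ∀ x → lookup (σ′ ,[ rename (liftRen r) P ]) (liftRen r x)
          ≡ rename (liftRen r) (lookup (σ ,[ P ]) x)
  lookup-rename P e zero = refl
  lookup-rename {r = r} {σ} {σ′} P e (suc x) =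
    trans (lookup-map (r x) weaken σ′)
    (trans (cong weaken (e x))
    (trans (rename-∘ suc r (lookup σ x))
    (trans (sym (rename-∘ (liftRen r) suc (lookup σ x)))
           (cong (rename (liftRen r)) (sym (lookup-map x weaken σ))))))

  -- Entering a recursion weakens the whole environment, so projections of the earlier bodies must
  -- be transported along a renaming. Only the role `!!` consults the environment.
  rename-project-! : ∀ {m n} {r : Fin m → Fin n} {σ : Env m} {σ′ : Env n} {P D} →
    (∀ x → lookup σ′ (r x) ≡ rename r (lookup σ x)) →
    ⟦ P ⟧[ !! , σ ]↦ D → ⟦ rename r P ⟧[ !! , σ′ ]↦ D
  rename-project-! e act-!            = act-!
  rename-project-! e (⦅⦆-other r≢ p)  = ⦅⦆-other r≢ (rename-project-! e p)
  rename-project-! e 𝟎                = 𝟎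
  rename-project-! e (var-≢! r≢)      = ⊥-elim (r≢ refl)
  rename-project-! {r = r} {σ} {σ′} e (var-! {x} {D = D} p) =
    var-! (subst (⟦_⟧[ !! , σ′ ]↦ D) (sym (e x)) (rename-project-! e p))
  rename-project-! e (rec {P} p)      = rec (rename-project-! (lookup-rename P e) p)
  rename-project-! e (p ∣ q)          = rename-project-! e p ∣ rename-project-! e q
  rename-project-! e (⊕-! p q)        = ⊕-! (rename-project-! e p) (rename-project-! e q)
  rename-project-! e (⊕-≢! r≢ _ _)    = ⊥-elim (r≢ refl)

  -- Combines, for the body of a recursion, the guardedness of its own variable with that assumed of
  -- outer variables.
  unguarded-cover : ∀ {n} {χ χ′ ψ : Fin n → Bool} →
                    (∀ x → ψ x ≡ true → χ x ≡ true ⊎ χ′ x ≡ true) →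
                    ∀ P → unguarded χ P ≡ false → unguarded χ′ P ≡ false →
                    unguarded ψ P ≡ false
  unguarded-cover h 𝟎 g g′ = refl
  unguarded-cover {χ = χ} {χ′} h (P ∣ Q) g g′ = cong₂ _∨_
    (unguarded-cover h P (∨-conicalˡ (unguarded χ P) _ g) (∨-conicalˡ (unguarded χ′ P) _ g′))
    (unguarded-cover h Q (∨-conicalʳ (unguarded χ P) _ g) (∨-conicalʳ (unguarded χ′ P) _ g′))
  unguarded-cover h (rec P) g g′ =
    unguarded-cover (λ { zero () ; (suc x) → h x }) P g g′
  unguarded-cover {ψ = ψ} h (var x) g g′ with ψ x in e
  ... | false = refl
  ... | true with h x e
  ...   | inj₁ q = trans (sym q) g
  ...   | inj₂ q = trans (sym q) g′
  unguarded-cover h (sum S) g g′ = refl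
  unguarded-cover h (⦅ j ⦆ P) g g′ = unguarded-cover h P g g′

  Models : ∀ {n} → Env n → Valuation n → Fin n → Set
  Models σ φ x = ⟦ lookup σ x ⟧[ !! , σ ]↦ ⌈ bang (φ x) ⌉

  models-suc : ∀ {n} {σ : Env n} {φ} P x → Models σ φ x →
               ⟦ lookup (σ ,[ P ]) (suc x) ⟧[ !! , σ ,[ P ] ]↦ ⌈ bang (φ x) ⌉
  models-suc {σ = σ} {φ} P x m =
    subst (⟦_⟧[ !! , σ ,[ P ] ]↦ ⌈ bang (φ x) ⌉) (sym (lookup-map x weaken σ))
      (rename-project-! (λ y → lookup-map y weaken σ) m)

  projectˢ-! : ∀ {n} {σ : Env n} φ S →
               ⟦ sum S ⟧[ !! , σ ]↦ choice (bang (evalˢ φ S))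
  projectˢ-! φ (act f d o i P) = act-!
  projectˢ-! φ (S ⊕ T)         = ⊕-! (projectˢ-! φ S) (projectˢ-! φ T)

  -- A variable marked by `χ` is reached only below actions, where the role `!!` does not look, and
  -- so needs no model. This breaks the circle in `models-rec`, where the model of a variable is the
  -- projection of a body containing it.
  project-! : ∀ {n} {σ : Env n} {φ χ} P → Guarded P → unguarded χ P ≡ false →
              (∀ x → χ x ≡ true ⊎ Models σ φ x) →
              ⟦ P ⟧[ !! , σ ]↦ ⌈ bang (eval φ P) ⌉
  project-! 𝟎 g u m = 𝟎
  project-! {χ = χ} (P ∣ Q) (g , g′) u m =
    project-! P g (∨-conicalˡ (unguarded χ P) _ u) m
    ∣ project-! Q g′ (∨-conicalʳ (unguarded χ P) _ u) m
  project-! {σ = σ} {φ} {χ} (rec P) (v , g) u m = rec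
    (project-! {χ = true ▹ χ} P g
      (unguarded-cover {χ = true ▹ none} {false ▹ χ}
        (λ { zero _ → inj₁ refl ; (suc x) e → inj₂ e }) P v u)
      λ { zero → inj₁ refl ; (suc x) → ⊎.map₂ (models-suc {φ = φ} P x) (m x) })
  project-! (var x) g u m with m x
  ... | inj₁ e = ⊥-elim (false≢true (trans (sym u) e))
  ... | inj₂ p = var-! p
  project-! {φ = φ} (sum S) g u m = projectˢ-! φ S
  project-! (⦅ j ⦆ P) g u m = ⦅⦆-other (λ ()) (project-! P g u m)

  role : Role → Meaning Reaction → Def
  role ??       a = hears a
  role !!       a = ⌈ bang a ⌉
  role (node k) a = sends a k

  project-all-! : ∀ {n} {σ : Env n} {φ} P → Guarded P → (∀ x → Models σ φ x) →
                  ⟦ P ⟧[ !! , σ ]↦ ⌈ bang (eval φ P) ⌉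
  project-all-! P g m =
    project-! P g (unguarded-none {χ = none} (λ _ → refl) P) (λ x → inj₂ (m x))

  models-rec : ∀ {n} {σ : Env n} {φ} P → Guarded (rec P) → (∀ x → Models σ φ x) →
               ∀ x → Models (σ ,[ P ]) (bound-value φ P ▹ φ) x
  models-rec {φ = φ} P (v , g) m zero = project-! P g v
    λ { zero → inj₁ refl ; (suc x) → inj₂ (models-suc {φ = φ} P x (m x)) }
  models-rec {φ = φ} P g m (suc x) = models-suc {φ = φ} P x (m x)

  project : ∀ {n} {σ : Env n} {φ} r P → Guarded P → (∀ x → Models σ φ x) → Blank φ →
            ⟦ P ⟧[ r , σ ]↦ role r (eval φ P)
  project !! P g m b = project-all-! P g m
  project ?? 𝟎 g m b = 𝟎
  project ?? (P ∣ Q) (g , g′) m b = project ?? P g m b ∣ project ?? Q g′ m b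
  project ?? (rec P) g m b = rec (project ?? P (proj₂ g) (models-rec P g m) (▹-blank b))
  project ?? (var x) g m b rewrite b x = var-≢! λ ()
  project ?? (sum (act f d o i P)) g m b =
    act-? (project-all-! P g m) (project ?? P g m b)
  project ?? (sum (S ⊕ T)) (g , g′) m b =
    ⊕-≢! (λ ()) (project ?? (sum S) g m b) (project ?? (sum T) g′ m b)
  project ?? (⦅ j ⦆ P) g m b = ⦅⦆-other (λ ()) (project ?? P g m b)
  project (node k) 𝟎 g m b = 𝟎
  project (node k) (P ∣ Q) (g , g′) m b = project (node k) P g m b ∣ project (node k) Q g′ m b
  project (node k) (rec P) g m b =
    rec (project (node k) P (proj₂ g) (models-rec P g m) (▹-blank b))
  project (node k) (var x) g m b rewrite b x = var-≢! λ ()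
  project (node k) (sum (act f d o i P)) g m b = act-node (project (node k) P g m b)
  project (node k) (sum (S ⊕ T)) (g , g′) m b =
    ⊕-≢! (λ ()) (project (node k) (sum S) g m b) (project (node k) (sum T) g′ m b)
  project (node k) (⦅ j ⦆ P) g m b with j ≟ k
  ... | yes refl = ⦅⦆-self (project (node k) P g m b) (project-all-! P g m)
  ... | no j≢k   = ⦅⦆-other (λ { refl → j≢k refl }) (project (node k) P g m b)

  closed : Valuation 0
  closed ()

  meaning : Proto 0 → Meaning Reaction
  meaning = eval closed

  node-network : Meaning Reaction → State → Network
  node-network a s = s ⦂ (hears a ∣ sends a (ident s))

  compose : (State → Network) → State → List State → Network
  compose B s []       = B s
  compose B s (t ∷ ts) = B s ∥ compose B t ts

  network : NetState → Meaning Reaction → Network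
  network Δ a = compose (node-network a) (List⁺.head (states Δ)) (List⁺.tail (states Δ))

  project-network : ∀ Δ P → Guarded P → ⟦ Δ ⨾ P ⟧↦ network Δ (meaning P)
  project-network Δ P g =
    project-states (List⁺.head (states Δ)) (List⁺.tail (states Δ))
    where
    project-state : ∀ s → NodeProjection P s (node-network (meaning P) s)
    project-state s = node (project ?? P g (λ ()) λ ()) (project (node (ident s)) P g (λ ()) λ ())

    project-states : ∀ s ss → Composition P (List⁺._∷_ s ss)
                                (compose (node-network (meaning P)) s ss)
    project-states s []       = last (project-state s)
    project-states s (t ∷ ts) = project-state s ∷ project-states t ts

  -- The effect of a reduction

  enable-self : ∀ j D R → enable j j D R ≡ D ∣ ⌈ R ⌉
  enable-self j D R with j ≟ j
  ... | yes _  = refl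
  ... | no j≢j = ⊥-elim (j≢j refl)

  enable-other : ∀ {j k} D R → j ≢ k → enable j k D R ≡ D
  enable-other {j} {k} D R j≢k with j ≟ k
  ... | yes j≡k = ⊥-elim (j≢k j≡k)
  ... | no _    = refl

  enable-∣ : ∀ j k {D E R} → enable j k (D ∣ E) R ≋ᵈ enable j k D R ∣ E
  enable-∣ j k with j ≟ k
  ... | yes _ = solve 3 (λ a b c → (a ∙ b) ∙ c ⊜ (a ∙ c) ∙ b) ≋-refl _ _ _
  ... | no _  = ≋-refl

  gain : List Id → Reaction → Id → Def
  gain []      R k = 𝟎
  gain (j ∷ T) R k = enable j k (gain T R k) R

  gain-∉ : ∀ {T k} R → k ∉ T → gain T R k ≡ 𝟎
  gain-∉ {[]}    R k∉ = refl
  gain-∉ {j ∷ T} R k∉ =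
    trans (enable-other _ R λ j≡k → k∉ (here (sym j≡k))) (gain-∉ R (k∉ ∘ there))

  -- Choices, unlike receptions, are not idempotent, so the number of copies counts; uniqueness of
  -- `T` makes it one.
  gain-∈ : ∀ {T k} R → Unique T → k ∈ T → gain T R k ≋ᵈ ⌈ R ⌉
  gain-∈ {j ∷ T} {k} R (j∉ ∷ u) (here refl)
    rewrite enable-self j (gain T R j) R
          | gain-∉ {T} {j} R (λ j∈ → All.lookup j∉ j∈ refl) =
    ≋-trans ∣-comm ∣-identity
  gain-∈ {j ∷ T} {k} R (j∉ ∷ u) (there k∈)
    rewrite enable-other {j} {k} (gain T R k) R (All.lookup j∉ k∈) = gain-∈ R u k∈

  -- The invariant of reduction

  ungraded : Fin 0 → ℕ
  ungraded ()

  Good : Proto 0 → Set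
  Good P = Guarded P × grade ungraded P < 3

  good-≋ : ∀ {P Q} → P ≋ Q → Good P → Good Q
  good-≋ e (g , p) =
    Equivalence.to (Guarded-≋ e) g , subst (_< 3) (grade-≋ (λ ()) e) p

  good-sound : ∀ {P Q} → P ≋ Q → Good P → meaning P ≈ᵐ meaning Q
  good-sound e (g , p) = sound (λ ()) (λ ()) e g p

  boost-<3 : ∀ a → a < 3 → boost a < 3
  boost-<3 0             p = p
  boost-<3 1             p = ≤-refl
  boost-<3 (suc (suc a)) p = p

  good-⦅⦆ : ∀ {j P} → Good P → Good (⦅ j ⦆ P)
  good-⦅⦆ {P = P} (g , p) = g , boost-<3 (grade ungraded P) p

  good-⦅⦆⁻ : ∀ {j P} → Good (⦅ j ⦆ P) → Good P
  good-⦅⦆⁻ {P = P} (g , p) = g , boost-inv (grade ungraded P) p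

  good-⦅⦆* : ∀ T {P} → Good P → Good (⦅ T ⦆* P)
  good-⦅⦆* []      g = g
  good-⦅⦆* (j ∷ T) g = good-⦅⦆ {j} {⦅ T ⦆* _} (good-⦅⦆* T g)

  good-∣ : ∀ {P Q} → Good P → Good Q → Good (P ∣ Q)
  good-∣ (g , p) (g′ , p′) = (g , g′) , ⊔-pres-<m p p′

  good-∣⁻ : ∀ {P Q} → Good (P ∣ Q) → Good P × Good Q
  good-∣⁻ {P} ((g , g′) , p) =
    (g , ⊔-<ˡ (grade ungraded P) _ p) , (g′ , ⊔-<ʳ (grade ungraded P) _ p)

  good-⊕ : ∀ {S T} → Good (sum S) → Good (sum T) → Good (sum (S ⊕ T))
  good-⊕ (g , p) (g′ , p′) = (g , g′) , ⊔-pres-<m p p′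

  good-⊕⁻ : ∀ {S T} → Good (sum (S ⊕ T)) → Good (sum S) × Good (sum T)
  good-⊕⁻ {S} ((g , g′) , p) =
    (g , ⊔-<ˡ (grade ungraded (sum S)) _ p) , (g′ , ⊔-<ʳ (grade ungraded (sum S)) _ p)

  good-act : ∀ {f d o i P} → Good P → Good (sum (act f d o i P))
  good-act (g , p) = g , ⊔-pres-<m (s≤s (s≤s z≤n)) p

  good-act⁻ : ∀ {f d o i P} → Good (sum (act f d o i P)) → Good P
  good-act⁻ {P = P} (g , p) = g , ⊔-<ʳ 1 (grade ungraded P) p

  -- The active nodes moved below the action raise the grade of the continuation to 2 at most.
  good-act-⦅⦆* : ∀ T S {f d o i P j} → Good (⦅ j ⦆ sum (act f d o i P ⊕? S)) →
                 Good (sum (act f d o i (⦅ T ⦆* P) ⊕? S))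
  good-act-⦅⦆* T nothing {f} {d} {o} {i} {P} {j} g =
    good-act {f} {d} {o} {i} {⦅ T ⦆* P}
      (good-⦅⦆* T (good-act⁻ {f} {d} {o} {i} {P} (good-⦅⦆⁻ {j} {sum (act f d o i P)} g)))
  good-act-⦅⦆* T (just S) {f} {d} {o} {i} {P} {j} g
    with good-⊕⁻ {act f d o i P} {S} (good-⦅⦆⁻ {j} {sum (act f d o i P ⊕ S)} g)
  ... | g₁ , g₂ = good-⊕ {act f d o i (⦅ T ⦆* P)} {S}
    (good-act {f} {d} {o} {i} {⦅ T ⦆* P} (good-⦅⦆* T (good-act⁻ {f} {d} {o} {i} {P} g₁))) g₂

  good-⟶ : ∀ {Δ Δ′ P Q} → Good P → Δ ⨾ P ⟶ Δ′ ⨾ Q → Good Q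
  good-⟶ g (bin {j = j} {k} {P = P} {S} _ _ _ _ _ _) = good-act-⦅⦆* (k ∷ []) S {P = P} {j} g
  good-⟶ g (brd {j = j} {P = P} {S} {I} _ _ _ _) = good-act-⦅⦆* I S {P = P} {j} g
  good-⟶ g (loc {j = j} {P = P} {S} _ _ _) = good-act-⦅⦆* (j ∷ []) S {P = P} {j} g
  good-⟶ g (in-act {f = f} {d} {o} {i} {P} {P′} r) =
    good-act {f} {d} {o} {i} {P′} (good-⟶ (good-act⁻ {f} {d} {o} {i} {P} g) r)
  good-⟶ g (in-⦅⦆ {j = j} {P} {P′} r) = good-⦅⦆ {j} {P′} (good-⟶ (good-⦅⦆⁻ {j} {P} g) r)
  good-⟶ g (in-⊕ {S = S} {S′} {T} r) with good-⊕⁻ {S} {T} g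
  ... | g₁ , g₂ = good-⊕ {S′} {T} (good-⟶ g₁ r) g₂
  good-⟶ g (in-∣ {P = P} {P′} {Q} r) with good-∣⁻ {P} {Q} g
  ... | g₁ , g₂ = good-∣ {P′} {Q} (good-⟶ g₁ r) g₂
  good-⟶ g (in-≋ e r e′) = good-≋ e′ (good-⟶ (good-≋ e g) r)

  -- The premises of the rules (Bin), (Brd) and (Loc); T lists the nodes on
  -- which the continuation becomes active.
  data Fire (Δ : NetState) (j : Id) (f : Label) :
            Dir → Cond → Cond → List Id → NetState → Set where
    bin : ∀ {k s s′ d o i} →
          Δ at j is s → s ⊨ o → Target d s k → Δ at k is s′ → s′ ⊨ i → j ≢ k →
          Fire Δ j f (link d) o i (k ∷ []) (upd j k f d Δ)
    brd : ∀ {s o i I} →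
          Δ at j is s → s ⊨ o → Unique I →
          (∀ k → k ∈ I ⇔ (Child Δ j k × ∃[ s′ ] (Δ at k is s′ × s′ ⊨ i))) →
          Fire Δ j f ⋆ o i I Δ
    loc : ∀ {s o i} →
          Δ at j is s → s ⊨ o → s ⊨ i → Fire Δ j f • o i (j ∷ []) Δ

  fire-⟶ : ∀ {Δ Δ′ j f d o i T} {P : Proto 0} {S} → Fire Δ j f d o i T Δ′ →
           Δ ⨾ ⦅ j ⦆ sum (act f d o i P ⊕? S) ⟶ Δ′ ⨾ sum (act f d o i (⦅ T ⦆* P) ⊕? S)
  fire-⟶ {S = S} (bin a b c d e g) = bin {S = S} a b c d e g
  fire-⟶ {S = S} (brd a b c d)     = brd {S = S} a b c d
  fire-⟶ {S = S} (loc a b c)       = loc {S = S} a b c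

  Received : Def → Cond → Label → Dir → Reaction → Set
  Received D i f d R = ∃[ R′ ] (Hears D i f d R′ × ⌈ R ⌉ ≋ᵈ ⌈ R′ ⌉)

  received-⊑ : ∀ {D E i f d R} → D ⊑ E → Received D i f d R → Received E i f d R
  received-⊑ p (_ , h , e) with p h
  ... | _ , h′ , e′ = _ , h′ , ≋-trans e e′

  -- E is what remains of the reactions of the sender j after its output.
  record Outcome (j : Id) (T : List Id) (R : Reaction)
                 (a : Meaning Reaction) (E : Def) (b : Meaning Reaction) : Set where
    constructor outcome
    field
      bang≋  : a ≈ᵇ b
      hears≋ : hears a ≋ᵈ hears b
      -- The sender may itself be a target, as it is for `•`.
      fired  : E ∣ gain T R j ≋ᵈ sends b j
      others : ∀ k → j ≢ k → sends a k ∣ gain T R k ≋ᵈ sends b k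

  ∣-swapʳ : ∀ {D E F : Def} → (D ∣ E) ∣ F ≋ᵈ (D ∣ F) ∣ E
  ∣-swapʳ = solve 3 (λ a b c → (a ∙ b) ∙ c ⊜ (a ∙ c) ∙ b) ≋-refl _ _ _

  module _ {j : Id} {T : List Id} {R : Reaction} where
    open Algebra Semantics using (par; grant; pre; plus; total)

    outcome-∣ : ∀ {a b E} c → Outcome j T R a E b →
                Outcome j T R (par a c) (E ∣ sends c j) (par b c)
    outcome-∣ c (outcome e h x y) = outcome (∣-cong e ≋-refl) (∣-cong h ≋-refl)
      (≋-trans ∣-swapʳ (∣-cong x ≋-refl))
      (λ k j≢k → ≋-trans ∣-swapʳ (∣-cong (y k j≢k) ≋-refl))

    outcome-⊕ : ∀ {a b E} c → Outcome j T R (total a) E (total b) →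
                Outcome j T R (total (plus a c)) (E ∣ sends c j) (total (plus b c))
    outcome-⊕ c (outcome e h x y) = outcome (⊕-cong e ≋-refl) (∣-cong h ≋-refl)
      (≋-trans ∣-swapʳ (∣-cong x ≋-refl))
      (λ k j≢k → ≋-trans ∣-swapʳ (∣-cong (y k j≢k) ≋-refl))

    outcome-act : ∀ {a b E} f d o i → Outcome j T R a E b →
                  Outcome j T R (total (pre f d o i a)) E (total (pre f d o i b))
    outcome-act f d o i (outcome e h x y) =
      outcome ≋-refl (∣-cong (recv-cong e) h) x y

    outcome-⦅⦆ : ∀ {a b E} k → Outcome j T R a E b →
                 Outcome j T R (grant k a) (enable k j E (bang a)) (grant k b)
    outcome-⦅⦆ k (outcome e h x y) = outcome e h
      (≋-trans (≋-sym (enable-∣ k j)) (enable-cong k j x e))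
      (λ l j≢l → ≋-trans (≋-sym (enable-∣ k l)) (enable-cong k l (y l j≢l) e))

    outcome-≈ : ∀ {a a′ b b′ E E′} → a′ ≈ᵐ a → E ≋ᵈ E′ → b ≈ᵐ b′ →
                Outcome j T R a E b → Outcome j T R a′ E′ b′
    outcome-≈ p q r (outcome e h x y) = outcome
      (≋-trans (_≈ᵐ_.bang≋ p) (≋-trans e (_≈ᵐ_.bang≋ r)))
      (≋-trans (_≈ᵐ_.hears≋ p) (≋-trans h (_≈ᵐ_.hears≋ r)))
      (≋-trans (∣-cong (≋-sym q) ≋-refl) (≋-trans x (sends≋ r j)))
      (λ k j≢k → ≋-trans (∣-cong (sends≋ p k) ≋-refl) (≋-trans (y k j≢k) (sends≋ r k)))

  bang-⦅⦆* : ∀ T P → bang (meaning (⦅ T ⦆* P)) ≡ bang (meaning P)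
  bang-⦅⦆* []      P = refl
  bang-⦅⦆* (j ∷ T) P = bang-⦅⦆* T P

  hears-⦅⦆* : ∀ T P → hears (meaning (⦅ T ⦆* P)) ≡ hears (meaning P)
  hears-⦅⦆* []      P = refl
  hears-⦅⦆* (j ∷ T) P = hears-⦅⦆* T P

  sends-⦅⦆* : ∀ T P k → sends (meaning (⦅ T ⦆* P)) k
                        ≋ᵈ sends (meaning P) k ∣ gain T (bang (meaning P)) k
  sends-⦅⦆* []      P k = ≋-sym ∣-identity
  sends-⦅⦆* (j ∷ T) P k = ≋-trans
    (enable-cong j k (≋-trans (sends-⦅⦆* T P k) ∣-comm) (≡⇒≋ᵈ (cong ⌈_⌉ (bang-⦅⦆* T P))))
    (≋-trans (enable-∣ j k) ∣-comm)

  -- Active nodes affect `sends` only. The `𝟎` is what is left of the resolved choice.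
  fire-outcome : ∀ j T S {f d o i P} →
    let X = sum (act f d o i P ⊕? S) in
    Outcome j T (bang (meaning P)) (meaning (⦅ j ⦆ X)) (sends (meaning X) j ∣ 𝟎)
            (meaning (sum (act f d o i (⦅ T ⦆* P) ⊕? S)))
  fire-outcome j T nothing {P = P} = outcome ≋-refl
    (∣-cong (recv-cong (≡⇒≋ᵈ (cong ⌈_⌉ (sym (bang-⦅⦆* T P))))) (≡⇒≋ᵈ (sym (hears-⦅⦆* T P))))
    (≋-trans (∣-cong ∣-identity ≋-refl) (≋-sym (sends-⦅⦆* T P j)))
    (λ k j≢k → ≋-trans (∣-cong (≡⇒≋ᵈ (enable-other _ _ j≢k)) ≋-refl) (≋-sym (sends-⦅⦆* T P k)))
  fire-outcome j T (just S) {P = P} = outcome ≋-refl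
    (∣-cong (∣-cong (recv-cong (≡⇒≋ᵈ (cong ⌈_⌉ (sym (bang-⦅⦆* T P))))) (≡⇒≋ᵈ (sym (hears-⦅⦆* T P)))) ≋-refl)
    (≋-trans (∣-cong ∣-identity ≋-refl)
      (≋-trans ∣-swapʳ (∣-cong (≋-sym (sends-⦅⦆* T P j)) ≋-refl)))
    (λ k j≢k → ≋-trans (∣-cong (≡⇒≋ᵈ (enable-other _ _ j≢k)) ≋-refl)
      (≋-trans ∣-swapʳ (∣-cong (≋-sym (sends-⦅⦆* T P k)) ≋-refl)))

  fire-received : ∀ j S {f d o i P} →
    Received (hears (meaning (⦅ j ⦆ sum (act f d o i P ⊕? S)))) i f d (bang (meaning P))
  fire-received j nothing  = _ , ∣ˡ here , ≋-refl
  fire-received j (just S) = _ , ∣ˡ (∣ˡ here) , ≋-refl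

  -- All that a network step needs to know of a reduction, independently of the contexts and
  -- congruences that the reduction went through.
  Fires : NetState → Proto 0 → NetState → Proto 0 → Set
  Fires Δ P Δ′ Q =
    ∃[ j ] ∃[ f ] ∃[ d ] ∃[ o ] ∃[ i ] ∃[ T ] ∃[ R ] ∃[ E ]
      (Fire Δ j f d o i T Δ′
      × (sends (meaning P) j —⟨ output o f d ⟩→ E)
      × Received (hears (meaning P)) i f d R
      × Outcome j T R (meaning P) E (meaning Q))

  fire-fires : ∀ {Δ Δ′ j f d o i T P} S → Fire Δ j f d o i T Δ′ →
    Fires Δ (⦅ j ⦆ sum (act f d o i P ⊕? S)) Δ′ (sum (act f d o i (⦅ T ⦆* P) ⊕? S))
  fire-fires {Δ} {j = j} {f} {d} {o} {i} {T} {P} S F =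
    _ , _ , _ , _ , _ , _ , _ , _ , F
    , subst (_—⟨ output o f d ⟩→ (sends (meaning X) j ∣ 𝟎)) (sym (enable-self j _ _)) (∣ʳ (first S))
    , fire-received j S , fire-outcome j T S
    where
    X = sum (act f d o i P ⊕? S)
    first : ∀ S → ⌈ bang (meaning (sum (act f d o i P ⊕? S))) ⌉ —⟨ output o f d ⟩→ 𝟎
    first nothing  = send
    first (just S) = ⊕ˡ send

  enable-output : ∀ {c f d D E} k j R → D —⟨ output c f d ⟩→ E →
                  enable k j D R —⟨ output c f d ⟩→ enable k j E R
  enable-output k j R t with k ≟ j
  ... | yes _ = ∣ˡ t
  ... | no _  = t

  fires : ∀ {Δ Δ′ P Q} → Good P → Δ ⨾ P ⟶ Δ′ ⨾ Q → Fires Δ P Δ′ Q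
  fires g (bin {S = S} a b c d e h) = fire-fires S (bin a b c d e h)
  fires g (brd {S = S} a b c d) = fire-fires S (brd a b c d)
  fires g (loc {S = S} a b c) = fire-fires S (loc a b c)
  fires g (in-act {f = f} {d} {o} {i} {P} r) with fires (good-act⁻ {f} {d} {o} {i} {P} g) r
  ... | _ , _ , _ , _ , _ , _ , _ , _ , F , t , h , x =
    _ , _ , _ , _ , _ , _ , _ , _ , F , t , received-⊑ (⊑-∣ʳ ⊑-refl) h , outcome-act f d o i x
  fires g (in-⦅⦆ {j = k} {P} r) with fires (good-⦅⦆⁻ {k} {P} g) r
  ... | j , _ , _ , _ , _ , _ , _ , _ , F , t , h , x =
    _ , _ , _ , _ , _ , _ , _ , _ , F , enable-output k j (bang (meaning P)) t , h , outcome-⦅⦆ k x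
  fires g (in-⊕ {S = S} {T = T} r) with fires (proj₁ (good-⊕⁻ {S} {T} g)) r
  ... | _ , _ , _ , _ , _ , _ , _ , _ , F , t , h , x =
    _ , _ , _ , _ , _ , _ , _ , _ , F , ∣ˡ t , received-⊑ (⊑-∣ˡ ⊑-refl) h
    , outcome-⊕ (evalˢ closed T) x
  fires g (in-∣ {P = P} {Q = Q} r) with fires (proj₁ (good-∣⁻ {P} {Q} g)) r
  ... | _ , _ , _ , _ , _ , _ , _ , _ , F , t , h , x =
    _ , _ , _ , _ , _ , _ , _ , _ , F , ∣ˡ t , received-⊑ (⊑-∣ˡ ⊑-refl) h
    , outcome-∣ (meaning Q) x
  fires g (in-≋ e r e′) with fires (good-≋ e g) r
  ... | j , _ , _ , _ , _ , _ , _ , _ , F , t , h , x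
    -- The output found after rewriting by `e` is matched by the original protocol, leaving a
    -- congruent remainder.
    with simulate (≋-sym (sends≋ (good-sound e g) j)) t
  ...   | _ , t′ , q =
    _ , _ , _ , _ , _ , _ , _ , _ , F , t′
    , received-⊑ (proj₂ (≋⇒⊑ (hears≋ (good-sound e g)))) h
    , outcome-≈ (good-sound e g) (≋-sym q) (good-sound e′ (good-⟶ (good-≋ e g) r)) x

  -- Protocols matching an output

  -- The head size does not count what is below an action, hence is unchanged
  -- by unfolding a guarded recursion; the size is unchanged by unfolding a
  -- recursion whose variable does not occur.
  HeadSize Size : Algebra
  HeadSize = record
    { Proc = ℕ ; Choices = ⊤ ; nil = 0 ; par = λ a b → suc (a ℕ.+ b)
    ; fix = λ F → suc (F 0)
    ; total = λ _ → 0 ; grant = λ _ → suc ; pre = λ _ _ _ _ _ → tt ; plus = λ _ _ → tt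
    ; fix-cong = λ e → cong suc (e 0) }
  Size = record
    { Proc = ℕ ; Choices = ℕ ; nil = 0 ; par = λ a b → suc (a ℕ.+ b)
    ; fix = λ F → suc (F 0)
    ; total = id ; grant = λ _ → suc ; pre = λ _ _ _ _ → suc ; plus = λ a b → suc (a ℕ.+ b)
    ; fix-cong = λ e → cong suc (e 0) }

  module HeadSized = Eval HeadSize
  module Sized = Eval Size
  open HeadSized using () renaming (eval to headSize)
  open Sized using () renaming (eval to size)

  unweighted : Fin 0 → ℕ
  unweighted ()

  headSize-guarded : ∀ {n} {χ : Fin n → Bool} {φ ψ : Fin n → ℕ} P →
                     unguarded χ P ≡ false → (∀ x → χ x ≡ true ⊎ φ x ≡ ψ x) →
                     headSize φ P ≡ headSize ψ P
  headSize-guarded 𝟎 g h = refl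
  headSize-guarded {χ = χ} (P ∣ Q) g h = cong₂ (λ a b → suc (a ℕ.+ b))
    (headSize-guarded P (∨-conicalˡ (unguarded χ P) _ g) h)
    (headSize-guarded Q (∨-conicalʳ (unguarded χ P) _ g) h)
  headSize-guarded (rec P) g h =
    cong suc (headSize-guarded P g λ { zero → inj₂ refl ; (suc x) → h x })
  headSize-guarded (var x) g h with h x
  ... | inj₁ e = ⊥-elim (false≢true (trans (sym g) e))
  ... | inj₂ e = e
  headSize-guarded (sum S) g h = refl
  headSize-guarded (⦅ j ⦆ P) g h = cong suc (headSize-guarded P g h)

  -- The occurrences of a guarded variable are not counted, so unfolding just removes the `suc` of
  -- the `rec`: a decrease fit for induction.
  headSize-unfold : ∀ {m} P → Guarded (rec P) → headSize unweighted (rec P) ≤ suc m →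
                    headSize unweighted (P [ rec P ]) ≤ m
  headSize-unfold P (g , _) (s≤s p) = subst (_≤ _)
    (sym (trans (HeadSized.eval-unfold unweighted P)
      (headSize-guarded P g λ { zero → inj₁ refl ; (suc ()) }))) p

  size-unfold : ∀ {m} P → grade (3 ▹ ungraded) P < 3 → size unweighted (rec P) ≤ suc m →
                size unweighted (P [ rec P ]) ≤ m
  size-unfold P g (s≤s p) = subst (_≤ _)
    (sym (trans (Sized.eval-unfold unweighted P)
      (eval-irrelevant Size 3 P g λ { zero → inj₂ ≤-refl ; (suc ()) }))) p

  -- P can match an output of j on f that leaves E of the reactions of j; the
  -- type A records whether the reduct is known to be a summation.
  Locates : ∀ {A} → (A → Proto 0) → Id → Proto 0 → Label → Dir → Cond → Def → Set
  Locates {A} inj j P f d o E =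
    ∃[ i ] ∃[ R ] (Received (hears (meaning P)) i f d R
    × (∀ {Δ Δ′ T} → Fire Δ j f d o i T Δ′ →
         Σ[ Q ∈ A ] ((Δ ⨾ P ⟶ Δ′ ⨾ inj Q) × Outcome j T R (meaning P) E (meaning (inj Q)))))

  module _ {j : Id} {f : Label} {d : Dir} {o : Cond} where

    locates-∣ : ∀ {P E} Q → Locates id j P f d o E →
                Locates id j (P ∣ Q) f d o (E ∣ sends (meaning Q) j)
    locates-∣ Q (_ , _ , h , fire) = _ , _ , received-⊑ (⊑-∣ˡ ⊑-refl) h , λ F →
      let _ , r , x = fire F in _ , in-∣ r , outcome-∣ (meaning Q) x

    locates-⊕ : ∀ {S E} T → Locates sum j (sum S) f d o E →
                Locates sum j (sum (S ⊕ T)) f d o (E ∣ sends (meaning (sum T)) j)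
    locates-⊕ T (_ , _ , h , fire) = _ , _ , received-⊑ (⊑-∣ˡ ⊑-refl) h , λ F →
      let _ , r , x = fire F in _ , in-⊕ r , outcome-⊕ (evalˢ closed T) x

    locates-act : ∀ {P E} g d′ o′ i → Locates id j P f d o E →
                  Locates sum j (sum (act g d′ o′ i P)) f d o E
    locates-act g d′ o′ i (_ , _ , h , fire) = _ , _ , received-⊑ (⊑-∣ʳ ⊑-refl) h , λ F →
      let _ , r , x = fire F in _ , in-act r , outcome-act g d′ o′ i x

    locates-⦅⦆ : ∀ {P E} k → Locates id j P f d o E →
                 Locates id j (⦅ k ⦆ P) f d o (enable k j E (bang (meaning P)))
    locates-⦅⦆ k (_ , _ , h , fire) = _ , _ , h , λ F →
      let _ , r , x = fire F in _ , in-⦅⦆ r , outcome-⦅⦆ k x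

    locates-≋ : ∀ {A} {inj : A → Proto 0} {P P′ E E′} → P′ ≋ P → Good P′ → E ≋ᵈ E′ →
                Locates inj j P f d o E → Locates inj j P′ f d o E′
    locates-≋ e g e′ (_ , _ , h , fire) =
      _ , _ , received-⊑ (proj₂ (≋⇒⊑ (hears≋ (good-sound e g)))) h , λ F →
      let _ , r , x = fire F
      in _ , in-≋ e r ≋-refl , outcome-≈ (good-sound e g) e′ ≈ᵐ-refl x

    locates-sum : ∀ {P E} → Locates sum j P f d o E → Locates id j P f d o E
    locates-sum (_ , _ , h , fire) = _ , _ , h , λ F → let _ , r , x = fire F in _ , r , x

  -- Brings the chosen action to the head of the summation, where the reduction rules expect it.
  focus : ∀ S {o f d D} → choice (bang (evalˢ closed S)) —⟨ output o f d ⟩→ D →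
          D ≡ 𝟎 × ∃[ i ] ∃[ P ] ∃[ T ] (sum S ≋ sum (act f d o i P ⊕? T))
  focus (act f d o i P) send = refl , i , P , nothing , ≋-refl
  focus (S ⊕ T) (⊕ˡ t) with focus S t
  ... | e , i , P , nothing , q = e , i , P , just T , ⊕-cong q ≋-refl
  ... | e , i , P , just U  , q =
    e , i , P , just (U ⊕ T) , ≋-trans (⊕-cong q ≋-refl) ⊕-assoc
  focus (S ⊕ T) (⊕ʳ t) with focus T t
  ... | e , i , P , nothing , q = e , i , P , just S , ≋-trans ⊕-comm (⊕-cong q ≋-refl)
  ... | e , i , P , just U  , q =
    e , i , P , just (U ⊕ S) , ≋-trans ⊕-comm (≋-trans (⊕-cong q ≋-refl) ⊕-assoc)

  +-≤ˡ : ∀ {m} a b → suc (a ℕ.+ b) ≤ suc m → a ≤ m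
  +-≤ˡ a b (s≤s p) = ≤-trans (ℕP.m≤m+n a b) p

  +-≤ʳ : ∀ {m} a b → suc (a ℕ.+ b) ≤ suc m → b ≤ m
  +-≤ʳ a b (s≤s p) = ≤-trans (ℕP.m≤n+m b a) p

  ∣-swap : ∀ {D E F G : Def} → (D ∣ E) ∣ (F ∣ G) ≋ᵈ (D ∣ F) ∣ (E ∣ G)
  ∣-swap = solve 4 (λ a b c d → (a ∙ b) ∙ (c ∙ d) ⊜ (a ∙ c) ∙ (b ∙ d)) ≋-refl _ _ _ _

  -- The active node is pushed inward by `⦅⦆-∣`, `⦅⦆-swap` and `unfold` until it stands on the
  -- summation that owns the choice. No action is passed on the way, so the head size suffices as
  -- measure.
  locates-enabled : ∀ m j P {f d o E} → headSize unweighted P ≤ m → Good P →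
    ⌈ bang (meaning P) ⌉ —⟨ output o f d ⟩→ E →
    Locates id j (⦅ j ⦆ P) f d o (sends (meaning P) j ∣ E)
  locates-enabled (suc m) j (P ∣ Q) p g (∣ˡ t) with good-∣⁻ {P} {Q} g
  ... | g₁ , g₂ = locates-≋ ⦅⦆-∣ (good-⦅⦆ {j} {P ∣ Q} g)
    (≋-trans (∣-cong ≋-refl (≡⇒≋ᵈ (enable-self j _ _))) ∣-swap)
    (locates-∣ (⦅ j ⦆ Q)
      (locates-enabled m j P (+-≤ˡ (headSize unweighted P) _ p) g₁ t))
  locates-enabled (suc m) j (P ∣ Q) p g (∣ʳ t) with good-∣⁻ {P} {Q} g
  ... | g₁ , g₂ = locates-≋ (≋-trans ⦅⦆-∣ ∣-comm) (good-⦅⦆ {j} {P ∣ Q} g)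
    (≋-trans (∣-cong ≋-refl (≡⇒≋ᵈ (enable-self j _ _)))
             (≋-trans ∣-swap (∣-cong ∣-comm ∣-comm)))
    (locates-∣ (⦅ j ⦆ P)
      (locates-enabled m j Q (+-≤ʳ (headSize unweighted P) _ p) g₂ t))
  locates-enabled (suc m) j (rec P) p g t with good-sound (unfold {P = P}) g
  ... | s with simulate (bang≋ s) t
  ...   | _ , t′ , e = locates-≋ (⦅⦆-cong unfold) (good-⦅⦆ {j} {rec P} g)
    (∣-cong (≋-sym (sends≋ s j)) e)
    (locates-enabled m j (P [ rec P ]) (headSize-unfold P (proj₁ g) p) (good-≋ (unfold {P = P}) g) t′)
  locates-enabled m j (sum S) p g t with focus S t
  ... | refl , i , P , T , e = locates-≋ (⦅⦆-cong e) (good-⦅⦆ {j} {sum S} g)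
    (∣-cong (≋-sym (sends≋ (good-sound e g) j)) ≋-refl)
    (_ , _ , fire-received j T , λ F → _ , fire-⟶ {S = T} F , fire-outcome j _ T)
  locates-enabled (suc m) j (⦅ k ⦆ P) (s≤s p) g t =
    locates-≋ ⦅⦆-swap (good-⦅⦆ {j} {⦅ k ⦆ P} g) (enable-∣ k j)
      (locates-⦅⦆ k (locates-enabled m j P p (good-⦅⦆⁻ {k} {P} g) t))

  mutual
    -- The search for the active node behind the choice goes below actions, which the head size does
    -- not see. Reduction has no rule inside `rec`, so recursions must be unfolded; one that
    -- contributes an output does not contain its variable, and unfolding it makes the size smaller.
    locates : ∀ m j P {f d o E} → size unweighted P ≤ m → Good P →
              sends (meaning P) j —⟨ output o f d ⟩→ E → Locates id j P f d o E
    locates (suc m) j (P ∣ Q) p g (∣ˡ t) =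
      locates-∣ Q (locates m j P (+-≤ˡ (size unweighted P) _ p) (proj₁ (good-∣⁻ {P} {Q} g)) t)
    locates (suc m) j (P ∣ Q) p g (∣ʳ t) = locates-≋ ∣-comm g ∣-comm
      (locates-∣ P (locates m j Q (+-≤ʳ (size unweighted P) _ p) (proj₂ (good-∣⁻ {P} {Q} g)) t))
    locates (suc m) j (rec P) p g t with grade-rec P (proj₂ g)
    -- A quiet recursion sends only `𝟎`, which has no output.
    ... | inj₁ (_ , q) with simulate (quiet-sends {φ = bound-value closed P ▹ closed}
                              (▹-positive λ ()) (λ { zero → ≋-refl ; (suc ()) }) P q) t
    ...   | _ , () , _
    locates (suc m) j (rec P) p g t | inj₂ q
      with simulate (sends≋ (good-sound (unfold {P = P}) g) j) t
    ... | _ , t′ , e = locates-≋ unfold g e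
      (locates m j (P [ rec P ]) (size-unfold P q p) (good-≋ (unfold {P = P}) g) t′)
    locates m j (sum S) p g t = locates-sum (locatesˢ m j S p g t)
    locates (suc m) j (⦅ k ⦆ P) (s≤s p) g t with k ≟ j in e
    ... | no k≢j = subst (Locates id j (⦅ k ⦆ P) _ _ _) (enable-other _ _ k≢j)
      (locates-⦅⦆ k (locates m j P p (good-⦅⦆⁻ {k} {P} g) t))
    locates (suc m) j (⦅ k ⦆ P) (s≤s p) g (∣ˡ t) | yes refl =
      subst (Locates id j (⦅ k ⦆ P) _ _ _) (enable-self j _ _)
        (locates-⦅⦆ k (locates m j P p (good-⦅⦆⁻ {k} {P} g) t))
    -- This active node released the choice; the search continues with the head size of `P` as a
    -- fresh measure.
    locates (suc m) j (⦅ k ⦆ P) (s≤s p) g (∣ʳ t) | yes refl =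
      locates-enabled _ j P ≤-refl (good-⦅⦆⁻ {k} {P} g) t

    locatesˢ : ∀ m j S {f d o E} → size unweighted (sum S) ≤ m → Good (sum S) →
               sends (meaning (sum S)) j —⟨ output o f d ⟩→ E → Locates sum j (sum S) f d o E
    locatesˢ (suc m) j (act f d o i P) (s≤s p) g t =
      locates-act f d o i (locates m j P p (good-act⁻ {f} {d} {o} {i} {P} g) t)
    locatesˢ (suc m) j (S ⊕ T) p g (∣ˡ t) =
      locates-⊕ T (locatesˢ m j S (+-≤ˡ (size unweighted (sum S)) _ p) (proj₁ (good-⊕⁻ {S} {T} g)) t)
    locatesˢ (suc m) j (S ⊕ T) p g (∣ʳ t) = locates-≋ ⊕-comm g ∣-comm
      (locates-⊕ S (locatesˢ m j T (+-≤ʳ (size unweighted (sum S)) _ p) (proj₂ (good-⊕⁻ {S} {T} g)) t))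

  -- Well-formed protocols

  NoActive⇒grade : ∀ {n} {γ : Fin n → ℕ} → (∀ x → γ x < 2) → ∀ P → NoActive P →
                   grade γ P < 2
  NoActive⇒grade h 𝟎         a       = s≤s z≤n
  NoActive⇒grade h (P ∣ Q)   (a , b) = ⊔-pres-<m (NoActive⇒grade h P a) (NoActive⇒grade h Q b)
  NoActive⇒grade {γ = γ} h (rec P) a
    with grade (1 ▹ γ) P | NoActive⇒grade {γ = 1 ▹ γ} (λ { zero → ≤-refl ; (suc x) → h x }) P a
  ... | 0           | q = s≤s z≤n
  ... | 1           | q = q
  ... | suc (suc _) | s≤s (s≤s ())
  NoActive⇒grade h (var x)   a       = h x
  NoActive⇒grade h (sum (act f d o i P)) a = ⊔-pres-<m ≤-refl (NoActive⇒grade h P a)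
  NoActive⇒grade h (sum (S ⊕ T)) (a , b) =
    ⊔-pres-<m (NoActive⇒grade h (sum S) a) (NoActive⇒grade h (sum T) b)

  ActiveAtTop⇒grade : ∀ P → ActiveAtTop P → grade ungraded P < 3
  ActiveAtTop⇒grade 𝟎         a       = s≤s z≤n
  ActiveAtTop⇒grade (P ∣ Q)   (a , b) = ⊔-pres-<m (ActiveAtTop⇒grade P a) (ActiveAtTop⇒grade Q b)
  ActiveAtTop⇒grade (rec P)   a       = ℕP.m≤n⇒m≤1+n (NoActive⇒grade (λ ()) (rec P) a)
  ActiveAtTop⇒grade (sum S)   a       = ℕP.m≤n⇒m≤1+n (NoActive⇒grade (λ ()) (sum S) a)
  ActiveAtTop⇒grade (⦅ j ⦆ P) a       = boost-<3 (grade ungraded P) (ActiveAtTop⇒grade P a)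

  GuardedIn⇒unguarded : ∀ {n x} {χ : Fin n → Bool} → (∀ y → x ≢ y → χ y ≡ false) →
                        ∀ P → GuardedIn x P → unguarded χ P ≡ false
  GuardedIn⇒unguarded h 𝟎         g       = refl
  GuardedIn⇒unguarded h (P ∣ Q)   (g , k) =
    cong₂ _∨_ (GuardedIn⇒unguarded h P g) (GuardedIn⇒unguarded h Q k)
  GuardedIn⇒unguarded h (rec P)   g       =
    GuardedIn⇒unguarded (λ { zero _ → refl ; (suc y) n → h y (n ∘ cong suc) }) P g
  GuardedIn⇒unguarded h (var y)   g       = h y g
  GuardedIn⇒unguarded h (sum S)   g       = refl
  GuardedIn⇒unguarded h (⦅ j ⦆ P) g       = GuardedIn⇒unguarded h P g

  RecGuarded⇒Guarded : ∀ {n} (P : Proto n) → RecGuarded P → Guarded P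
  RecGuarded⇒Guarded 𝟎         g       = tt
  RecGuarded⇒Guarded (P ∣ Q)   (g , k) = RecGuarded⇒Guarded P g , RecGuarded⇒Guarded Q k
  RecGuarded⇒Guarded (rec P)   (g , k) =
    GuardedIn⇒unguarded (λ { zero n → ⊥-elim (n refl) ; (suc y) _ → refl }) P g
    , RecGuarded⇒Guarded P k
  RecGuarded⇒Guarded (var x)   g       = tt
  RecGuarded⇒Guarded (sum (act f d o i P)) g = RecGuarded⇒Guarded P g
  RecGuarded⇒Guarded (sum (S ⊕ T)) (g , k) =
    RecGuarded⇒Guarded (sum S) g , RecGuarded⇒Guarded (sum T) k
  RecGuarded⇒Guarded (⦅ j ⦆ P) g       = RecGuarded⇒Guarded P g

  -- What remains of the distinctness of labels after unfolding: it ignores copies and is thus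
  -- inherited along `_⊑_`. A network node may use any reception of `f`, and one that discards has
  -- refused them all; agreement ties both to the condition in the reduction.
  Consistent : Def → Set
  Consistent D = ∀ {f c d R c′ d′ R′} → Hears D c f d R → Hears D c′ f d′ R′ →
                 c ≡ c′ × d ≡ d′ × ⌈ R ⌉ ≋ᵈ ⌈ R′ ⌉

  consistent-⊑ : ∀ {D E} → E ⊑ D → Consistent D → Consistent E
  consistent-⊑ p C h h′ with p h | p h′
  ... | _ , k , e | _ , k′ , e′ with C k k′
  ...   | c≡ , d≡ , e″ = c≡ , d≡ , ≋-trans e (≋-trans e″ (≋-sym e′))

  hears-label : ∀ {n} {φ : Valuation n} → Blank φ → ∀ P {c f d R} →
                Hears (hears (eval φ P)) c f d R → f ∈ labels P
  hears-label b (P ∣ Q)   (∣ˡ h) = ∈-++⁺ˡ (hears-label b P h)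
  hears-label b (P ∣ Q)   (∣ʳ h) = ∈-++⁺ʳ (labels P) (hears-label b Q h)
  hears-label b (rec P)   h      = hears-label (▹-blank b) P h
  hears-label b (var x)   h with blank-hears b x {𝟎} h
  ... | _ , () , _
  hears-label b (sum (act f d o i P)) (∣ˡ here) = here refl
  hears-label b (sum (act f d o i P)) (∣ʳ h)    = there (hears-label b P h)
  hears-label b (sum (S ⊕ T)) (∣ˡ h) = ∈-++⁺ˡ (hears-label b (sum S) h)
  hears-label b (sum (S ⊕ T)) (∣ʳ h) = ∈-++⁺ʳ (labelsˢ S) (hears-label b (sum T) h)
  hears-label b (⦅ j ⦆ P) h      = hears-label b P h

  unique-++⁻ : ∀ {A : Set} (xs : List A) {ys} → Unique (xs ++ ys) →
               Unique xs × Unique ys × (∀ {x} → x ∈ xs → x ∈ ys → ⊥)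
  unique-++⁻ []       u = [] , u , λ ()
  unique-++⁻ (x ∷ xs) (x∉ ∷ u) with unique-++⁻ xs u
  ... | u₁ , u₂ , disjoint = AllP.++⁻ˡ xs x∉ ∷ u₁ , u₂ , λ
    { (here refl) y∈ → All.lookup (AllP.++⁻ʳ xs x∉) y∈ refl
    ; (there x∈)  y∈ → disjoint x∈ y∈ }

  consistent-∣ : ∀ {D E} → Consistent D → Consistent E →
                 (∀ {f c d R c′ d′ R′} → Hears D c f d R → Hears E c′ f d′ R′ → ⊥) →
                 Consistent (D ∣ E)
  consistent-∣ p q r (∣ˡ h) (∣ˡ h′) = p h h′
  consistent-∣ p q r (∣ˡ h) (∣ʳ h′) = ⊥-elim (r h h′)
  consistent-∣ p q r (∣ʳ h) (∣ˡ h′) = ⊥-elim (r h′ h)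
  consistent-∣ p q r (∣ʳ h) (∣ʳ h′) = q h h′

  unique-consistent : ∀ {n} {φ : Valuation n} → Blank φ → ∀ P → Unique (labels P) →
                      Consistent (hears (eval φ P))
  unique-consistent b 𝟎 u = λ ()
  unique-consistent b (P ∣ Q) u with unique-++⁻ (labels P) u
  ... | u₁ , u₂ , disjoint = consistent-∣ (unique-consistent b P u₁) (unique-consistent b Q u₂)
    λ h h′ → disjoint (hears-label b P h) (hears-label b Q h′)
  unique-consistent b (rec P) u = unique-consistent (▹-blank b) P u
  unique-consistent b (var x) u h with blank-hears b x {𝟎} h
  ... | _ , () , _
  unique-consistent b (sum (act f d o i P)) (f∉ ∷ u) =
    consistent-∣ (λ { here here → refl , refl , ≋-refl }) (unique-consistent b P u)
      λ { here h → All.lookup f∉ (hears-label b P h) refl }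
  unique-consistent b (sum (S ⊕ T)) u =
    let u₁ , u₂ , disjoint = unique-++⁻ (labelsˢ S) u in
    consistent-∣ (unique-consistent b (sum S) u₁) (unique-consistent b (sum T) u₂)
      λ h h′ → disjoint (hears-label b (sum S) h) (hears-label b (sum T) h′)
  unique-consistent b (⦅ j ⦆ P) u = unique-consistent b P u

  originates⇒good : ∀ {Δ P} → Originates Δ P → Good P × Consistent (hears (meaning P))
  originates⇒good (spec {P = P} (a , u , g)) =
    (RecGuarded⇒Guarded P g , ActiveAtTop⇒grade P a) , unique-consistent (λ ()) P u
  originates⇒good (equi w e) with originates⇒good w
  ... | g , C = good-≋ e g , consistent-⊑ (proj₂ (≋⇒⊑ (hears≋ (good-sound e g)))) C
  originates⇒good (red w r) with originates⇒good w
  ... | g , C with fires g r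
  ...   | _ , _ , _ , _ , _ , _ , _ , _ , _ , _ , _ , x =
    good-⟶ g r , consistent-⊑ (proj₂ (≋⇒⊑ (Outcome.hears≋ x))) C

  -- Steps of a composition of nodes

  Distinct : List State → Set
  Distinct ss = Unique (List.map ident ss)

  distinct-∉ : ∀ {j : Id} {ss : List State} {t} →
               Unique (j ∷ List.map ident ss) → t ∈ ss → j ≢ ident t
  distinct-∉ (s∉ ∷ _) t∈ = All.lookup s∉ (∈-map⁺ ident t∈)

  distinct-≡ : ∀ {ss s t} → Distinct ss → s ∈ ss → t ∈ ss → ident s ≡ ident t → s ≡ t
  distinct-≡ u (here refl) (here refl) e = refl
  distinct-≡ u (here refl) (there t∈)  e = ⊥-elim (distinct-∉ u t∈ e)
  distinct-≡ u (there s∈)  (here refl) e = ⊥-elim (distinct-∉ u s∈ (sym e))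
  distinct-≡ (_ ∷ u) (there s∈) (there t∈) e = distinct-≡ u s∈ t∈ e

  Others : List State → State → (State → Set) → Set
  Others ss t P = ∀ {u} → u ∈ ss → ident u ≢ ident t → P u

  compose-map : ∀ B (g : State → State) s ss →
                compose B (g s) (List.map g ss) ≡ compose (B ∘ g) s ss
  compose-map B g s []       = refl
  compose-map B g s (t ∷ ts) = cong (B (g s) ∥_) (compose-map B g t ts)

  -- `B` and `A` give the nodes before and after a step, both indexed by the states before it;
  -- `compose-map` brings an updated network into this form.
  module Steps (B A : State → Network) where

    Same : State → Set
    Same u = B u ≋ⁿ A u

    compose-≋ : ∀ s ss → (∀ {u} → u ∈ s ∷ ss → Same u) → compose B s ss ≋ⁿ compose A s ss
    compose-≋ s []       h = h (here refl)
    compose-≋ s (t ∷ ts) h = ∥-cong (h (here refl)) (compose-≋ t ts (λ u∈ → h (there u∈)))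

    rest-≋ : ∀ {s t} ts → Distinct (s ∷ t ∷ ts) → Others (s ∷ t ∷ ts) s Same →
             compose B t ts ≋ⁿ compose A t ts
    rest-≋ ts u h = compose-≋ _ ts λ u∈ → h (there u∈) (distinct-∉ u u∈ ∘ sym)

    step-one : ∀ {t ℓ} s ss → Distinct (s ∷ ss) → NonBroadcast ℓ → t ∈ s ∷ ss →
               B t —[ ℓ ]→≋ A t → Others (s ∷ ss) t Same →
               compose B s ss —[ ℓ ]→≋ compose A s ss
    step-one s [] u n (here refl) r h = r
    step-one s (_ ∷ ts) u n (here refl) (_ , r , e) h =
      _ , ∥ˡ r n , ∥-cong e (rest-≋ ts u h)
    step-one s (v ∷ ts) (s∉ ∷ u) n (there t∈) r h
      with step-one v ts u n t∈ r (λ u∈ → h (there u∈))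
    ... | _ , r′ , e =
      _ , ∥ʳ r′ n , ∥-cong (h (here refl) (distinct-∉ (s∉ ∷ u) t∈)) e

    step-two : ∀ {t t′ j k f} s ss → Distinct (s ∷ ss) →
               t ∈ s ∷ ss → t′ ∈ s ∷ ss → ident t ≢ ident t′ →
               B t —[ j ⇢ k by f ]→≋ A t → B t′ —[ k ⇠ j by f ]→≋ A t′ →
               (∀ {u} → u ∈ s ∷ ss → ident u ≢ ident t → ident u ≢ ident t′ → Same u) →
               compose B s ss —[ τ ]→≋ compose A s ss
    step-two s ss u (here refl) (here refl) n r r′ h = ⊥-elim (n refl)
    step-two s (v ∷ ts) (s∉ ∷ u) (here refl) (there t′∈) n (_ , r , e) r′ h
      with step-one v ts u (_ ⇠ _ by _) t′∈ r′
             (λ u∈ u≢ → h (there u∈) (distinct-∉ (s∉ ∷ u) u∈ ∘ sym) u≢)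
    ... | _ , q , e′ = _ , com r q pairˡ , ∥-cong e e′
    step-two s (v ∷ ts) (s∉ ∷ u) (there t∈) (here refl) n r (_ , r′ , e) h
      with step-one v ts u (_ ⇢ _ by _) t∈ r
             (λ u∈ u≢ → h (there u∈) u≢ (distinct-∉ (s∉ ∷ u) u∈ ∘ sym))
    ... | _ , q , e′ = _ , com r′ q pairʳ , ∥-cong e e′
    step-two s (v ∷ ts) (s∉ ∷ u) (there t∈) (there t′∈) n r r′ h
      with step-two v ts u t∈ t′∈ n r r′ (λ u∈ → h (there u∈))
    ... | _ , q , e = _ , ∥ʳ q τ
      , ∥-cong (h (here refl) (distinct-∉ (s∉ ∷ u) t∈) (distinct-∉ (s∉ ∷ u) t′∈)) e

    step-hear : ∀ {j f} s ss → (∀ {u} → u ∈ s ∷ ss → B u —[ j ?⋆by f ]→≋ A u) →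
                compose B s ss —[ j ?⋆by f ]→≋ compose A s ss
    step-hear s [] h = h (here refl)
    step-hear s (t ∷ ts) h with h (here refl) | step-hear t ts (λ u∈ → h (there u∈))
    ... | _ , r , e | _ , r′ , e′ = _ , com r r′ hear , ∥-cong e e′

    step-cast : ∀ {t j f} s ss → Distinct (s ∷ ss) → t ∈ s ∷ ss →
                B t —[ j !⋆by f ]→≋ A t →
                Others (s ∷ ss) t (λ u → B u —[ j ?⋆by f ]→≋ A u) →
                compose B s ss —[ j !⋆by f ]→≋ compose A s ss
    step-cast s [] u (here refl) r h = r
    step-cast s (v ∷ ts) u (here refl) (_ , r , e) h
      with step-hear v ts (λ u∈ → h (there u∈) (distinct-∉ u u∈ ∘ sym))
    ... | _ , r′ , e′ = _ , com r r′ castˡ , ∥-cong e e′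
    step-cast s (v ∷ ts) (s∉ ∷ u) (there t∈) r h
      with h (here refl) (distinct-∉ (s∉ ∷ u) t∈) | step-cast v ts u t∈ r (λ u∈ → h (there u∈))
    ... | _ , q , e | _ , r′ , e′ = _ , com q r′ castʳ , ∥-cong e e′

  open Steps using (Same; rest-≋; step-one; step-two; step-cast)

  -- Inversion of the steps of a composition

  module Inversions (B : State → Network) where

    -- The reduct, and with it the nodes after the step, is found only from the inverted step; hence
    -- `result` leaves `A` open.
    record One (s : State) (ss : List State) (ℓ : NetLabel) (N : Network) : Set where
      constructor one
      field
        {t}    : State
        {M}    : Network
        t∈     : t ∈ s ∷ ss
        step   : B t —[ ℓ ]→ M
        result : ∀ A → M ≋ⁿ A t → Others (s ∷ ss) t (Same B A) → N ≋ⁿ compose A s ss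

    data Single : NetLabel → Set where
      _⇢_by_ : ∀ j k f → Single (j ⇢ k by f)
      _⇠_by_ : ∀ j k f → Single (j ⇠ k by f)

    one-there : ∀ {s t ts ℓ N} → Distinct (s ∷ t ∷ ts) →
                One t ts ℓ N → One s (t ∷ ts) ℓ (B s ∥ N)
    one-there u (one t∈ r w) = one (there t∈) r λ A e h →
      ∥-cong (h (here refl) (distinct-∉ u t∈)) (w A e (λ u∈ → h (there u∈)))

    one-here : ∀ {s t ts ℓ N} → Distinct (s ∷ t ∷ ts) → B s —[ ℓ ]→ N →
               One s (t ∷ ts) ℓ (N ∥ compose B t ts)
    one-here {ts = ts} u r = one (here refl) r λ A e h → ∥-cong e (rest-≋ B A ts u h)

    inv-one : ∀ {ℓ N} s ss → Distinct (s ∷ ss) → Single ℓ →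
              compose B s ss —[ ℓ ]→ N → One s ss ℓ N
    inv-one s [] u l r = one (here refl) r λ A e h → e
    inv-one s (t ∷ ts) u () (com _ _ pairˡ)
    inv-one s (t ∷ ts) u () (com _ _ pairʳ)
    inv-one s (t ∷ ts) u () (com _ _ castˡ)
    inv-one s (t ∷ ts) u () (com _ _ castʳ)
    inv-one s (t ∷ ts) u () (com _ _ hear)
    inv-one s (t ∷ ts) u l (∥ˡ r _) = one-here u r
    inv-one s (t ∷ ts) (s∉ ∷ u) l (∥ʳ r _) = one-there (s∉ ∷ u) (inv-one t ts u l r)

    record Two (s : State) (ss : List State) (N : Network) : Set where
      constructor two
      field
        {t t′} : State
        {M M′} : Network
        {j k}  : Id
        {f}    : Label
        t∈     : t ∈ s ∷ ss
        t′∈    : t′ ∈ s ∷ ss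
        t≢t′   : ident t ≢ ident t′
        step   : B t —[ j ⇢ k by f ]→ M
        step′  : B t′ —[ k ⇠ j by f ]→ M′
        result : ∀ A → M ≋ⁿ A t → M′ ≋ⁿ A t′ →
                 (∀ {u} → u ∈ s ∷ ss → ident u ≢ ident t → ident u ≢ ident t′ → Same B A u) →
                 N ≋ⁿ compose A s ss

    inv-τ : ∀ {N} s ss → Distinct (s ∷ ss) → compose B s ss —[ τ ]→ N →
            One s ss τ N ⊎ Two s ss N
    inv-τ s [] u r = inj₁ (one (here refl) r λ A e h → e)
    inv-τ s (t ∷ ts) (s∉ ∷ u) (com r r′ pairˡ) with inv-one t ts u (_ ⇠ _ by _) r′
    ... | one t∈ q w = inj₂ (two (here refl) (there t∈) (distinct-∉ (s∉ ∷ u) t∈) r q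
      λ A e e′ h → ∥-cong e (w A e′
        λ u∈ → h (there u∈) (distinct-∉ (s∉ ∷ u) u∈ ∘ sym)))
    inv-τ s (t ∷ ts) (s∉ ∷ u) (com r r′ pairʳ) with inv-one t ts u (_ ⇢ _ by _) r′
    ... | one t∈ q w = inj₂ (two (there t∈) (here refl) (distinct-∉ (s∉ ∷ u) t∈ ∘ sym) q r
      λ A e e′ h → ∥-cong e′ (w A e
        λ u∈ u≢ → h (there u∈) u≢ (distinct-∉ (s∉ ∷ u) u∈ ∘ sym)))
    inv-τ s (t ∷ ts) u (∥ˡ r _) = inj₁ (one-here u r)
    inv-τ s (t ∷ ts) (s∉ ∷ u) (∥ʳ r _) with inv-τ t ts u r
    ... | inj₁ x = inj₁ (one-there (s∉ ∷ u) x)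
    ... | inj₂ (two t∈ t′∈ n q q′ w) = inj₂ (two (there t∈) (there t′∈) n q q′
      λ A e e′ h → ∥-cong (h (here refl) (distinct-∉ (s∉ ∷ u) t∈) (distinct-∉ (s∉ ∷ u) t′∈))
                          (w A e e′ (λ u∈ → h (there u∈))))

    Reaches : NetLabel → State → Set
    Reaches ℓ u = ∃[ M ] (B u —[ ℓ ]→ M)

    inv-hear : ∀ {j f N} s ss → compose B s ss —[ j ?⋆by f ]→ N →
      Σ[ r ∈ (∀ {u} → u ∈ s ∷ ss → Reaches (j ?⋆by f) u) ]
        (∀ A → (∀ {u} (u∈ : u ∈ s ∷ ss) → proj₁ (r u∈) ≋ⁿ A u) → N ≋ⁿ compose A s ss)
    inv-hear s [] r = (λ { (here refl) → _ , r }) , λ A h → h (here refl)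
    inv-hear s (t ∷ ts) (com r r′ hear) with inv-hear t ts r′
    ... | q , w = (λ { (here refl) → _ , r ; (there u∈) → q u∈ })
                , λ A h → ∥-cong (h (here refl)) (w A (λ u∈ → h (there u∈)))

    record Cast (s : State) (ss : List State) (j : Id) (f : Label) (N : Network) : Set where
      constructor cast
      field
        {t}    : State
        {M}    : Network
        t∈     : t ∈ s ∷ ss
        step   : B t —[ j !⋆by f ]→ M
        steps  : Others (s ∷ ss) t (Reaches (j ?⋆by f))
        result : ∀ A → M ≋ⁿ A t →
                 (∀ {u} (u∈ : u ∈ s ∷ ss) u≢ → proj₁ (steps u∈ u≢) ≋ⁿ A u) →
                 N ≋ⁿ compose A s ss

    inv-cast : ∀ {j f N} s ss → Distinct (s ∷ ss) → compose B s ss —[ j !⋆by f ]→ N →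
               Cast s ss j f N
    inv-cast s [] u r = cast (here refl) r
      (λ { (here refl) u≢ → ⊥-elim (u≢ refl) }) λ A e h → e
    inv-cast s (t ∷ ts) u (com r r′ castˡ) with inv-hear t ts r′
    ... | q , w = cast (here refl) r
      (λ { (here refl) u≢ → ⊥-elim (u≢ refl) ; (there u∈) _ → q u∈ })
      λ A e h → ∥-cong e (w A λ u∈ → h (there u∈) (distinct-∉ u u∈ ∘ sym))
    inv-cast s (t ∷ ts) (s∉ ∷ u) (com r r′ castʳ) with inv-cast t ts u r′
    ... | cast t∈ q qs w = cast (there t∈) q
      (λ { (here refl) _ → _ , r ; (there u∈) u≢ → qs u∈ u≢ })
      λ A e h → ∥-cong (h (here refl) (distinct-∉ (s∉ ∷ u) t∈)) (w A e (λ u∈ → h (there u∈)))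

  open Inversions using (one; two; cast; inv-τ; inv-cast)

  -- Transitions of a single node

  sends-senders : ∀ {n} {φ : Valuation n} {k} → (∀ x → Senders (sends (φ x) k)) →
                  ∀ P → Senders (sends (eval φ P) k)
  sends-senders h 𝟎         = 𝟎
  sends-senders h (P ∣ Q)   = sends-senders h P ∣ sends-senders h Q
  sends-senders h (rec P)   = sends-senders (λ { zero → 𝟎 ; (suc x) → h x }) P
  sends-senders h (var x)   = h x
  sends-senders h (sum (act f d o i P)) = sends-senders h P
  sends-senders h (sum (S ⊕ T)) = sends-senders h (sum S) ∣ sends-senders h (sum T)
  sends-senders {k = k} h (⦅ j ⦆ P) with j ≟ k
  ... | yes _ = sends-senders h P ∣ ⌈⌉-senders (bang (eval _ P))
  ... | no _  = sends-senders h P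

  module _ {D E : Def} (r : Receivers D) (s : Senders E) where

    node-input : ∀ {c f d X} → D ∣ E —⟨ input c f d ⟩→ X →
                 ∃[ R ] ∃[ D′ ] (Hears D c f d R × X ≡ D′ ∣ E × D′ ≋ᵈ D ∣ ⌈ R ⌉)
    node-input (∣ˡ t) with hears⁻ t
    ... | _ , h , e = _ , _ , h , refl , e
    node-input (∣ʳ t) with senders-only-output s t
    ... | _ , _ , _ , ()

    node-output : ∀ {c f d X} → D ∣ E —⟨ output c f d ⟩→ X →
                  ∃[ E′ ] ((E —⟨ output c f d ⟩→ E′) × X ≡ D ∣ E′)
    node-output (∣ʳ t) = _ , t , refl
    node-output (∣ˡ t) with receivers-only-input r t
    ... | _ , _ , _ , ()

    node-local : ∀ {c f X} → D ∣ E —⟨ local c f ⟩→ X →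
                 ∃[ c₁ ] ∃[ c₂ ] ∃[ R ] ∃[ D′ ] ∃[ E′ ]
                   (c ≡ c₁ ∧ c₂ × (E —⟨ output c₁ f • ⟩→ E′)
                   × Hears D c₂ f • R × X ≡ D′ ∣ E′ × D′ ≋ᵈ D ∣ ⌈ R ⌉)
    node-local (∣ˡ t) with receivers-only-input r t
    ... | _ , _ , _ , ()
    node-local (∣ʳ t) with senders-only-output s t
    ... | _ , _ , _ , ()
    node-local (syncˡ t _) with receivers-only-input r t
    ... | _ , _ , _ , ()
    node-local (syncʳ t t′) with hears⁻ t
    ... | _ , h , e = _ , _ , _ , _ , _ , refl , t′ , h , refl , e

  inv-node-hear : ∀ {s D j f N} → s ⦂ D —[ j ?⋆by f ]→ N →
    (∃[ c ] ∃[ D′ ] (provider s ≡ j × (D —⟨ input c f ⋆ ⟩→ D′) × s ⊨ c × N ≡ s ⦂ D′))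
    ⊎ (Discards s D j f × N ≡ s ⦂ D)
  inv-node-hear (hear t x)  = inj₁ (_ , _ , refl , t , x , refl)
  inv-node-hear (discard x) = inj₂ (x , refl)

  -- Yields the target list of a broadcast. Decidability is asked only at the listed states, because
  -- satisfaction is not decidable in general.
  select : ∀ {Q : State → Set} ss → Distinct ss → (∀ {t} → t ∈ ss → Dec (Q t)) →
           ∃[ I ] (Unique I × (∀ k → k ∈ I ⇔ (∃[ t ] (t ∈ ss × ident t ≡ k × Q t))))
  select [] u d = [] , [] , λ k → mk⇔ (λ ()) λ { (_ , () , _) }
  select (s ∷ ss) (s∉ ∷ u) d with d (here refl) | select ss u (λ t∈ → d (there t∈))
  ... | no ¬q | I , v , w = I , v , λ k → mk⇔
    (λ k∈ → let t , t∈ , e , q = Equivalence.to (w k) k∈ in t , there t∈ , e , q)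
    λ { (_ , here refl , _ , q) → ⊥-elim (¬q q)
      ; (_ , there t∈ , e , q)  → Equivalence.from (w k) (_ , t∈ , e , q) }
  ... | yes q | I , v , w = ident s ∷ I , All.tabulate fresh ∷ v , λ k → mk⇔
    (λ { (here refl) → s , here refl , refl , q
       ; (there k∈)  → let t , t∈ , e , q = Equivalence.to (w k) k∈ in t , there t∈ , e , q })
    λ { (_ , here refl , refl , q) → here refl
      ; (_ , there t∈ , e , q)     → there (Equivalence.from (w k) (_ , t∈ , e , q)) }
    where
    fresh : ∀ {k} → k ∈ I → ident s ≢ k
    fresh {k} k∈ s≡k with Equivalence.to (w k) k∈
    ... | _ , t∈ , e , _ = distinct-∉ (s∉ ∷ u) t∈ (trans s≡k (sym e))

  -- The four parts a node can play in a step. `R′` is the reaction of the reception that the node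
  -- uses, which agrees with `R` only up to congruence.
  module Contents {j T R a E b} (x : Outcome j T R a E b) (u : Unique T) where
    open Outcome x using (fired; others)

    idle : ∀ {k} → j ≢ k → k ∉ T → hears a ∣ sends a k ≋ᵈ hears b ∣ sends b k
    idle j≢k k∉ = ∣-cong (Outcome.hears≋ x) (≋-trans (≋-sym ∣-identity)
      (≋-trans (∣-cong ≋-refl (≡⇒≋ᵈ (sym (gain-∉ R k∉)))) (others _ j≢k)))

    receiving : ∀ {k D R′} → j ≢ k → k ∈ T → D ≋ᵈ hears a ∣ ⌈ R′ ⌉ → ⌈ R ⌉ ≋ᵈ ⌈ R′ ⌉ →
                D ∣ sends a k ≋ᵈ hears b ∣ sends b k
    receiving j≢k k∈ e e′ = ≋-trans (∣-cong e ≋-refl)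
      (≋-trans ∣-assoc (∣-cong (Outcome.hears≋ x) (≋-trans (≋-trans (∣-cong (≋-sym e′) ≋-refl) ∣-comm)
        (≋-trans (∣-cong ≋-refl (≋-sym (gain-∈ R u k∈))) (others _ j≢k)))))

    sending : j ∉ T → hears a ∣ E ≋ᵈ hears b ∣ sends b j
    sending j∉ = ∣-cong (Outcome.hears≋ x) (≋-trans (≋-sym ∣-identity)
      (≋-trans (∣-cong ≋-refl (≡⇒≋ᵈ (sym (gain-∉ R j∉)))) fired))

    synchronising : ∀ {D R′} → j ∈ T → D ≋ᵈ hears a ∣ ⌈ R′ ⌉ → ⌈ R ⌉ ≋ᵈ ⌈ R′ ⌉ →
                    D ∣ E ≋ᵈ hears b ∣ sends b j
    synchronising j∈ e e′ = ≋-trans (∣-cong e ≋-refl)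
      (≋-trans ∣-assoc (∣-cong (Outcome.hears≋ x) (≋-trans (≋-trans (∣-cong (≋-sym e′) ≋-refl) ∣-comm)
        (≋-trans (∣-cong ≋-refl (≋-sym (gain-∈ R u j∈))) fired))))

  node-≋ⁿ : ∀ b {s t k D} → s ≡ t → ident t ≡ k → D ≋ᵈ hears b ∣ sends b k →
            s ⦂ D ≋ⁿ node-network b t
  node-≋ⁿ b refl refl e = ⦂-cong e

  updState-sender : ∀ {j} k f d s → ident s ≡ j → updState j k f d s ≡ side! f d s k
  updState-sender {j} k f d s e with ident s ≟ j | ident s ≟ k
  ... | yes _  | _ = refl
  ... | no s≢j | _ = ⊥-elim (s≢j e)

  updState-receiver : ∀ {j k} f d s → ident s ≢ j → ident s ≡ k →
                      updState j k f d s ≡ side? f d s j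
  updState-receiver {j} {k} f d s n e with ident s ≟ j | ident s ≟ k
  ... | yes s≡j | _      = ⊥-elim (n s≡j)
  ... | no _    | yes _  = refl
  ... | no _    | no s≢k = ⊥-elim (s≢k e)

  updState-other : ∀ {j k} f d s → ident s ≢ j → ident s ≢ k → updState j k f d s ≡ s
  updState-other {j} {k} f d s n n′ with ident s ≟ j | ident s ≟ k
  ... | yes s≡j | _       = ⊥-elim (n s≡j)
  ... | no _    | yes s≡k = ⊥-elim (n′ s≡k)
  ... | no _    | no _    = refl

  -- Operational correspondence

  open import Data.List.Membership.DecPropositional _≟_ using (_∈?_)

  module _ (P : Proto 0) (g : Good P) (C : Consistent (hears (meaning P)))
           (Δ : NetState) (noSelf : NoSelfProvider Δ) where

    private
      a : Meaning Reaction
      a = meaning P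

      first : State
      first = List⁺.head (states Δ)

      rest : List State
      rest = List⁺.tail (states Δ)

      receivers : Receivers (hears a)
      receivers = hears-receivers (λ ()) P

      senders : ∀ k → Senders (sends a k)
      senders k = sends-senders (λ ()) P

    same-state : ∀ {k s t} → Δ at k is s → Δ at k is t → s ≡ t
    same-state (s∈ , refl) (t∈ , e) = distinct-≡ (unique Δ) s∈ t∈ (sym e)

    -- By consistency every reception of `f` carries the condition `i`.
    input-received : ∀ {s j f i d R c D′} → Received (hears a) i f d R →
      hears a ∣ sends a j —⟨ input c f d ⟩→ D′ → s ⊨ c → s ⊨ i
    input-received {s} {j} (_ , h , _) t x with node-input receivers (senders j) t
    ... | _ , _ , h′ , _ = subst (s ⊨_) (proj₁ (C h′ h)) x

    forward : ∀ {b Δ′ j f d o i T R E} → Fire Δ j f d o i T Δ′ →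
              sends a j —⟨ output o f d ⟩→ E → Received (hears a) i f d R →
              Outcome j T R a E b →
              ∃[ ℓ ] (Hat ℓ × (network Δ a —[ ℓ ]→≋ network Δ′ b))
    forward {b} (bin {k} {s} {s′} {link-d} (s∈ , refl) so tgt (s′∈ , refl) si j≢k) t (_ , h , e) x
      with hears⁺ h
    ... | _ , t′ , e′ = τ , τ , subst (network Δ a —[ τ ]→≋_)
      (sym (compose-map (node-network b) upd′ first rest))
      (step-two (node-network a) (node-network b ∘ upd′) first rest (unique Δ) s∈ s′∈ j≢k
        (_ , out (∣ʳ t) so tgt , node-≋ⁿ b (sym (updState-sender _ _ link-d s refl))
          (updState-ident _ _ _ link-d s) (sending (j≢k ∘ λ { (here e) → e })))
        (_ , inp (∣ˡ t′) si , node-≋ⁿ b (sym (updState-receiver _ link-d s′ (j≢k ∘ sym) refl))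
          (updState-ident _ _ _ link-d s′) (receiving j≢k (here refl) e′ e))
        λ {u} _ n n′ → node-≋ⁿ b (sym (updState-other _ link-d u n n′))
          (updState-ident _ _ _ link-d u) (idle (n ∘ sym) (n′ ∘ λ { (here e) → e })))
      where
      upd′ = updState (ident s) (ident s′) _ link-d
      open Contents x ([] ∷ [])
    forward {b} {j = j} {f} (loc (s∈ , refl) so si) t (_ , h , e) x with hears⁺ h
    ... | _ , t′ , e′ = τ , τ ,
      step-one (node-network a) (node-network b) first rest (unique Δ) τ s∈
        (_ , local (syncʳ t′ t) (Equivalence.from ⊨-∧ (so , si))
           , node-≋ⁿ b refl refl (synchronising (here refl) e′ e))
        λ _ n → node-≋ⁿ b refl refl (idle (n ∘ sym) (n ∘ λ { (here e) → e }))
      where open Contents x ([] ∷ [])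
    forward {b} {j = j} {f} {i = i} {T} (brd {s} (s∈ , refl) so u w) t (R′ , h , e) x =
      ident s !⋆by f , (ident s !⋆by f) ,
      step-cast (node-network a) (node-network b) first rest (unique Δ) s∈
        (_ , cast (∣ʳ t) so , node-≋ⁿ b refl refl (sending self∉)) others
      where
      open Contents x u

      -- A sender does not hear its own broadcast in a network, so it must not be a target of the
      -- reduction either.
      self∉ : ident s ∉ T
      self∉ j∈ with Equivalence.to (w _) j∈
      ... | (_ , at , e′) , _ = noSelf at e′

      others : Others (first ∷ rest) s
        (λ v → node-network a v —[ ident s ?⋆by f ]→≋ node-network b v)
      others {v} v∈ n with ident v ∈? T
      ... | no v∉ = _ , discard discards , node-≋ⁿ b refl refl (idle (n ∘ sym) v∉)
        where
        -- A node able to hear would be a child satisfying `i`, hence a target.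
        discards : Discards v (hears a ∣ sends a (ident v)) (ident s) f
        discards (p , _ , _ , t′ , x′) = v∉ (Equivalence.from (w _)
          ((v , (v∈ , refl) , p) , v , (v∈ , refl) , input-received {v} {ident v} (R′ , h , e) t′ x′))
      ... | yes v∈T with Equivalence.to (w _) v∈T | hears⁺ h
      ...   | (_ , at , p) , (_ , at′ , si) | _ , t′ , e′
        with same-state (v∈ , refl) at | same-state (v∈ , refl) at′
      ...     | refl | refl = _
        , subst (λ k → _ —[ k ?⋆by f ]→ _) p (hear (∣ˡ t′) si)
        , node-≋ⁿ b refl refl (receiving (n ∘ sym) v∈T e′ e)

    Reduces : Network → Set
    Reduces N = ∃[ Δ′ ] ∃[ Q ] ((Δ ⨾ P ⟶ Δ′ ⨾ Q) × (N ≋ⁿ network Δ′ (meaning Q)))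

    located : ∀ {j f d o E} → sends a j —⟨ output o f d ⟩→ E → Locates id j P f d o E
    located {j} = locates _ j P ≤-refl g

    backward-local : ∀ {N} → Inversions.One (node-network a) first rest τ N → Reduces N
    backward-local (one {s} s∈ (local t x) w) with node-local receivers (senders _) t
    ... | _ , _ , _ , _ , _ , refl , t , h , refl , e
      with located t | Equivalence.to ⊨-∧ x
    -- The reception used by the node need not be that of the located action, but both have label
    -- `f`.
    ...   | _ , _ , (_ , h′ , e′) , fire | so , sc with C h h′
    ...     | refl , _ , e″ with fire (loc (s∈ , refl) so sc)
    ...       | Q , r , x = Δ , Q , r , w (node-network (meaning Q))
      (node-≋ⁿ (meaning Q) refl refl (synchronising (here refl) e (≋-trans e′ (≋-sym e″))))
      λ _ n → node-≋ⁿ (meaning Q) refl refl (idle (n ∘ sym) (n ∘ λ { (here e) → e }))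
      where open Contents x ([] ∷ [])

    backward-link : ∀ {N} → Inversions.Two (node-network a) first rest N → Reduces N
    backward-link (two {s} {s′} {f = f} s∈ s′∈ n (out {d = d} t so tgt) (inp t′ sc) w)
      with node-output receivers (senders _) t | node-input receivers (senders _) t′
    ... | _ , t , refl | _ , _ , h , refl , e with located t
    ...   | _ , _ , (_ , h′ , e′) , fire with C h h′
    -- The network label does not mention the direction; consistency shows that the receiver's is
    -- the sender's.
    ...     | refl , refl , e″ with fire (bin (s∈ , refl) so tgt (s′∈ , refl) sc n)
    ...       | Q , r , x = upd (ident s) (ident s′) f d Δ , Q , r ,
      subst (_ ≋ⁿ_) (sym (compose-map (node-network b) upd′ first rest))
        (w (node-network b ∘ upd′)
          (node-≋ⁿ b (sym (updState-sender _ _ d s refl))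
            (updState-ident _ _ _ d s) (sending (n ∘ λ { (here e) → e })))
          (node-≋ⁿ b (sym (updState-receiver _ d s′ (n ∘ sym) refl))
            (updState-ident _ _ _ d s′) (receiving n (here refl) e (≋-trans e′ (≋-sym e″))))
          λ {u} _ n n′ → node-≋ⁿ b (sym (updState-other _ d u n n′))
            (updState-ident _ _ _ d u) (idle (n ∘ sym) (n′ ∘ λ { (here e) → e })))
      where
      b = meaning Q
      upd′ = updState (ident s) (ident s′) f d
      open Contents x ([] ∷ [])

    backward-cast : ∀ {j f N} → Inversions.Cast (node-network a) first rest j f N → Reduces N
    backward-cast {f = f} (cast {s} s∈ (cast t so) steps w)
      with node-output receivers (senders _) t
    ... | _ , t , refl with located t
    ...   | i , R , (R′ , h , e) , fire
      with select (first ∷ rest) (unique Δ) decide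
      where
      Hearer : State → Set
      Hearer v = provider v ≡ ident s × v ⊨ i

      -- The broadcast itself decides: each other node has either heard or discarded it. Only the
      -- sender takes no part, and it is excluded by `noSelf`.
      decide : ∀ {v} → v ∈ first ∷ rest → Dec (Hearer v)
      decide {v} v∈ with ident v ≟ ident s
      ... | yes v≡s = no λ { (p , _) → noSelf (v∈ , v≡s) p }
      ... | no v≢s with inv-node-hear (proj₂ (steps v∈ v≢s))
      ...   | inj₁ (_ , _ , p , t′ , x , _) =
        yes (p , input-received {v} {ident v} (R′ , h , e) t′ x)
      ...   | inj₂ (d , _) = no λ { (p , x) → d (p , _ , _ , ∣ˡ (proj₁ (proj₂ (hears⁺ h))) , x) }
    ...     | I , u , sel with fire (brd (s∈ , refl) so u (λ k → mk⇔ (to k) (from k)))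
      where
      to : ∀ k → k ∈ I → Child Δ (ident s) k × ∃[ s′ ] (Δ at k is s′ × s′ ⊨ i)
      to k k∈ with Equivalence.to (sel k) k∈
      ... | v , v∈ , e , p , x = (v , (v∈ , e) , p) , v , (v∈ , e) , x

      from : ∀ k → Child Δ (ident s) k × ∃[ s′ ] (Δ at k is s′ × s′ ⊨ i) → k ∈ I
      from k ((v , at , p) , _ , at′ , x) with same-state at at′
      ... | refl = Equivalence.from (sel k) (v , proj₁ at , proj₂ at , p , x)
    ...       | Q , r , x = Δ , Q , r , w (node-network b)
      (node-≋ⁿ b refl refl (sending self∉)) others
      where
      b = meaning Q
      open Contents x u

      self∉ : ident s ∉ I
      self∉ j∈ with Equivalence.to (sel _) j∈
      ... | _ , v∈ , e , p , _ = noSelf (v∈ , e) p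

      others : ∀ {v} (v∈ : v ∈ first ∷ rest) v≢s → proj₁ (steps v∈ v≢s) ≋ⁿ node-network b v
      others {v} v∈ v≢s with steps v∈ v≢s
      ... | _ , q with inv-node-hear q
      ...   | inj₁ (_ , _ , p , t′ , x , refl) with node-input receivers (senders _) t′
      ...     | _ , _ , h′ , refl , e′ with C h′ h
      ...       | refl , _ , e″ = node-≋ⁿ b refl refl (receiving (v≢s ∘ sym)
        (Equivalence.from (sel _) (v , v∈ , refl , p , x)) e′ (≋-trans e (≋-sym e″)))
      others {v} v∈ v≢s | _ , q | inj₂ (d , refl) =
        node-≋ⁿ b refl refl (idle (v≢s ∘ sym) v∉)
        where
        v∉ : ident v ∉ I
        v∉ v∈I with Equivalence.to (sel _) v∈I
        ... | _ , v′∈ , e , p , x with same-state (v∈ , refl) (v′∈ , e)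
        ...   | refl = d (p , _ , _ , ∣ˡ (proj₁ (proj₂ (hears⁺ h))) , x)

    backward : ∀ {ℓ N} → Hat ℓ → network Δ a —[ ℓ ]→ N → Reduces N
    backward τ r with inv-τ (node-network a) first rest (unique Δ) r
    ... | inj₁ x = backward-local x
    ... | inj₂ x = backward-link x
    backward (_ !⋆by _) r = backward-cast (inv-cast (node-network a) first rest (unique Δ) r)

theorem3p1 : (𝒮 : Setting) → let open Language 𝒮 in
    (P : Proto 0) → WellFormed P →
    (Δ : NetState) → NoSelfProvider Δ →
    ∃[ N₀ ] ((⟦ Δ ⨾ P ⟧↦ N₀)
    × (∀ Δ′ Q → Δ ⨾ P ⟶ Δ′ ⨾ Q →
    ∃[ λ̂ ] ∃[ N₁ ] (Hat λ̂ × (⟦ Δ′ ⨾ Q ⟧↦ N₁) × (N₀ —[ λ̂ ]→≋ N₁)))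
    × (∀ λ̂ N → Hat λ̂ → N₀ —[ λ̂ ]→ N →
    ∃[ Δ′ ] ∃[ Q ] ∃[ N₁ ]
    ((Δ ⨾ P ⟶ Δ′ ⨾ Q) × (⟦ Δ′ ⨾ Q ⟧↦ N₁) × (N ≋ⁿ N₁))))
theorem3p1 𝒮 P (_ , w) Δ noSelf =
  network Δ (meaning P) , project-network Δ P (proj₁ g)
  , (λ Δ′ Q r →
      let _ , _ , _ , _ , _ , _ , _ , _ , F , t , h , x = fires g r
          λ̂ , hat , step = forward P g C Δ noSelf F t h x
      in λ̂ , _ , hat , project-network Δ′ Q (proj₁ (good-⟶ g r)) , step)
  , (λ λ̂ N hat step →
      let Δ′ , Q , r , e = backward P g C Δ noSelf hat step
      in Δ′ , Q , _ , r , project-network Δ′ Q (proj₁ (good-⟶ g r)) , e)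
  where
  open Language 𝒮
  open Proof 𝒮
  g = proj₁ (originates⇒good w)
  C = proj₂ (originates⇒good w)
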